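{- Let $G$ be a 2-connected graph on at least four vertices. Then $G$ has the $\mathcal{H}_4$ property: for any four distinct vertices $x_1,x_2,x_3,x_4$ of $G$ there exist vertices $y_1,y_2,y_3,y_4$ such that $x_1y_1,x_2y_2,x_3y_3,x_4y_4$ are four distinct edges of $G$ and there is a hamiltonian cycle in $G^2$ containing all four of these edges. Moreover, for every integer $n>4$ there exists a 2-connected graph of order $n$ which does not have the $\mathcal{H}_5$ property.
   Context: All graphs are finite and simple. The square $G^2$ of a graph $G$ is the graph on $V(G)$ obtained from $G$ by joining by an edge any two nonadjacent vertices that have a common neighbour in $G$. For a positive integer $k$, a graph $G$ has the $\mathcal{H}_k$ property if for any $k$ distinct vertices $x_1,\dots,x_k$ of $G$ there is a hamiltonian cycle in $G^2$ containing $k$ distinct edges $x_1y_1,\dots,x_ky_k$ of $G$ (for some vertices $y_1,\dots,y_k$). -}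

module Defs where

open import Data.Nat using (ℕ; zero; suc; _≤_; _<_; _∸_)
open import Data.Fin using (Fin; toℕ)
open import Data.Unit using (⊤)
open import Data.Bool using (Bool; true; false)
open import Data.Product using (Σ; ∃; _×_; _,_)
open import Data.Sum using (_⊎_)
open import Relation.Binary.PropositionalEquality using (_≡_; _≢_)
open import Relation.Nullary using (¬_)
open import Data.Fin.Permutation using (Permutation′; _⟨$⟩ʳ_)

record Graph (n : ℕ) : Set where
  field
    adj   : Fin n → Fin n → Bool
    sym   : ∀ u v → adj u v ≡ adj v u
    irref : ∀ u → adj u u ≡ false

open Graph public

Adj : ∀ {n} → Graph n → Fin n → Fin n → Set
Adj G u v = adj G u v ≡ true

data WalkIn {n : ℕ} (G : Graph n) (S : Fin n → Set) : Fin n → Fin n → Set where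
  stop : ∀ {u} → S u → WalkIn G S u u
  step : ∀ {u v w} → S u → Adj G u v → WalkIn G S v w → WalkIn G S u w

ConnectedOn : ∀ {n} → Graph n → (Fin n → Set) → Set
ConnectedOn {n} G S = ∀ (u v : Fin n) → S u → S v → WalkIn G S u v

TwoConnected : ∀ {n} → Graph n → Set
TwoConnected {n} G =
  3 ≤ n × ConnectedOn G (λ _ → ⊤) × (∀ (v : Fin n) → ConnectedOn G (λ u → u ≢ v))

Adj² : ∀ {n} → Graph n → Fin n → Fin n → Set
Adj² {n} G u v = u ≢ v × (Adj G u v ⊎ Σ (Fin n) (λ w → Adj G u w × Adj G w v))

CycSucc : ∀ {n} → Fin n → Fin n → Set
CycSucc {n} j k = toℕ k ≡ suc (toℕ j) ⊎ (toℕ j ≡ n ∸ 1 × toℕ k ≡ 0)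

record HamCycle {n : ℕ} (H : Fin n → Fin n → Set) : Set where
  field
    three : 3 ≤ n
    order : Permutation′ n
    cons  : ∀ (j k : Fin n) → CycSucc j k → H (order ⟨$⟩ʳ j) (order ⟨$⟩ʳ k)

open HamCycle public

CycleContains : ∀ {n} {H : Fin n → Fin n → Set} → HamCycle H → Fin n → Fin n → Set
CycleContains {n} C x y =
  Σ (Fin n) λ j → Σ (Fin n) λ k → CycSucc j k ×
    ((order C ⟨$⟩ʳ j ≡ x × order C ⟨$⟩ʳ k ≡ y) ⊎ (order C ⟨$⟩ʳ j ≡ y × order C ⟨$⟩ʳ k ≡ x))

SamePair : ∀ {n} → Fin n → Fin n → Fin n → Fin n → Set
SamePair a b c d = (a ≡ c × b ≡ d) ⊎ (a ≡ d × b ≡ c)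

Hk : ℕ → ∀ {n} → Graph n → Set
Hk k {n} G =
  ∀ (x : Fin k → Fin n) → (∀ i j → x i ≡ x j → i ≡ j) →
  Σ (Fin k → Fin n) λ y →
    (∀ i → Adj G (x i) (y i)) ×
    (∀ i j → i ≢ j → ¬ SamePair (x i) (y i) (x j) (y j)) ×
    Σ (HamCycle (Adj² G)) λ C → ∀ i → CycleContains C (x i) (y i)

{-# OPTIONS --safe #-}
-- To force an edge of G at x into the cycle, hang a path x p q at x: in a hamiltonian cycle of the square, q can only
-- lie between x and p, so x q p w are consecutive for some neighbour w of x, and the three edges from x to w contract
-- to the edge x w.  So one has to find a hamiltonian cycle of the square of G with four such paths ("tokens").
--
-- Let R be a set of vertices.  By induction over ears, the other vertices are covered by disjoint paths of the square
-- ("items") whose ends have neighbours ("labels") in R.  A vertex y leaves R by a local surgery: if the number of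
-- labels y is even, y hangs over to the next vertex of R on the way; if it is odd, one item now ends there.  A token
-- can be inserted at a vertex where an item ends, i.e. where the number of labels passed so far is odd.  An item
-- covering may moreover absorb one token at a vertex off R having a neighbour off R.
--
-- By Menger's theorem some cycle K has four disjoint legs ending in the four given vertices.  If the token of one leg
-- can be absorbed in the covering of the vertices off K, the other three are scanned down to K, and for three tokens
-- there always is a suitable place of K to start from.  Otherwise the legs have length at most one; cover the vertices
-- off K and the legs.  If all items have both labels within closed segments of K between consecutive feet, a single
-- strand running around K works.  An item joining two other places gives a chord of K, and rerouting K along it makes
-- the legs longer, or allows one to absorb a token, or K is a 4-cycle of feet with a label-free foot.
--
-- For the second part, a cycle has at most four edges at the two vertices of one side of K_{2,n-2}.
module Submission where

open import Defs renaming (sym to adj-sym; step to onward; three to length≥3)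
open import Data.Bool using (Bool; true; false; _xor_; not)
import Data.Bool.Properties as BoolP
open import Data.Empty using (⊥; ⊥-elim)
open import Data.Fin as Fin using (Fin; zero; suc; toℕ; cast; inject≤)
import Data.Fin.Properties as FinP
open import Data.Fin.Permutation using (permutation; _⟨$⟩ʳ_)
open import Data.List using (List; []; _∷_; _++_; reverse; length; [_]; map; allFin; lookup)
open import Data.List.Properties
  using (++-identityʳ; ++-assoc; unfold-reverse; length-++; reverse-++; reverse-involutive; length-map; length-tabulate)
import Data.List.Membership.DecPropositional as DecMembership
open import Data.List.Membership.Propositional using (_∈_; _∉_; find; lose)
open import Data.List.Membership.Propositional.Properties
  using (∈-++⁺ˡ; ∈-++⁺ʳ; ∈-++⁻; ∈-∃++; ∈-map⁺; ∈-map⁻; ∈-allFin; ∈-lookup)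
open import Data.List.Relation.Binary.Permutation.Propositional
  using (_↭_; ↭-refl; ↭-sym; ↭-trans; ↭-prep; ↭-swap; ↭-reflexive)
open import Data.List.Relation.Binary.Permutation.Propositional.Properties
  using (++⁺; ++⁺ˡ; ++⁺ʳ; ↭-reverse; ∈-resp-↭; All-resp-↭; shift; ++-comm; ↭-length; drop-∷)
open import Data.List.Relation.Unary.All as All using (All; []; _∷_)
import Data.List.Relation.Unary.All.Properties as AllP
open import Data.List.Relation.Unary.AllPairs using ([]; _∷_)
open import Data.List.Relation.Unary.Any as Any using (Any; here; there)
import Data.List.Relation.Unary.Any.Properties as AnyP
open import Data.List.Relation.Unary.Unique.Propositional using (Unique)
import Data.List.Relation.Unary.Unique.Propositional.Properties as UP
open import Data.Nat using (ℕ; zero; suc; _≤_; _<_; z≤n; s≤s; _+_; _∸_)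
import Data.Nat.Properties as ℕP
open import Data.Product using (Σ; ∃; _×_; _,_; proj₁; proj₂)
import Data.Product.Properties as ×P
open import Data.Sum using (_⊎_; inj₁; inj₂; [_,_]′)
import Data.Sum.Properties as ⊎P
open import Data.Unit using (⊤; tt)
open import Data.Vec as Vec using (Vec; []; _∷_)
open import Data.Vec.N-ary using (N-ary; _$ⁿ_)
open import Function.Bundles using (module Inverse)
open import Relation.Binary.PropositionalEquality using (_≡_; _≢_; refl; sym; trans; cong; cong₂; subst; subst₂)
open import Relation.Nullary using (Dec; yes; no; ¬_; does)
open import Relation.Nullary.Decidable using (_×-dec_; _⊎-dec_; ¬?)

-- What makes the surgery local is that the links inside an item belong to the square, whereas its
-- ends are true neighbours of its labels: two ends with the same label `y` can be joined through
-- `y`, and `y` can be put between them. A list that hangs over at a vertex and a token at that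
-- vertex claim the same place; hence a token can be inserted only where nothing hangs, and
-- everything comes down to parities of labels. Parities alone do not suffice when all of them are
-- even, for then no item end is at hand to start from. Off `K` the remedy is to choose each ear
-- with a vertex that has no neighbour among the vertices covered before it: this vertex carries no
-- label and can be made a new item. On `K` itself, evenness at every vertex lets a single strand
-- run around. With four odd feet on a 4-cycle there would be no suitable start, so the exceptional
-- case has to produce a foot without labels. The four legs come from applying Menger's theorem for
-- two paths twice: to the four given vertices, and then to the two resulting paths.

data Ch {A : Set} (R : A → A → Set) : A → List A → A → Set where
  one : ∀ {a} → Ch R a (a ∷ []) a
  _◅_ : ∀ {a b c xs} → R a b → Ch R b xs c → Ch R a (a ∷ xs) c

Ch-map : ∀ {A : Set} {R T : A → A → Set} {a xs b} → (∀ {u v} → R u v → T u v) → Ch R a xs b → Ch T a xs b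
Ch-map f one = one
Ch-map f (l ◅ c) = f l ◅ Ch-map f c

Ch-++ : ∀ {A : Set} {R : A → A → Set} {a xs b c ys d} → Ch R a xs b → R b c → Ch R c ys d → Ch R a (xs ++ ys) d
Ch-++ one l d = l ◅ d
Ch-++ (k ◅ c) l d = k ◅ Ch-++ c l d

Ch-rev : ∀ {A : Set} {R : A → A → Set} {a xs b} → (∀ {u v} → R u v → R v u) → Ch R a xs b → Ch R b (reverse xs) a
Ch-rev sy one = one
Ch-rev {R = R} {a} {_} {b} sy (_◅_ {xs = xs} l c) =
  subst (λ z → Ch R b z a) (sym (unfold-reverse a xs)) (Ch-++ (Ch-rev sy c) (sy l) one)

ch-head : ∀ {A : Set} {R : A → A → Set} {a xs b} → Ch R a xs b → a ∈ xs
ch-head one = here refl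
ch-head (_ ◅ _) = here refl

ch-last : ∀ {A : Set} {R : A → A → Set} {a xs b} → Ch R a xs b → b ∈ xs
ch-last one = here refl
ch-last (_ ◅ c) = there (ch-last c)

abstract
  Unique-resp : ∀ {A : Set} {xs ys : List A} → xs ↭ ys → Unique xs → Unique ys
  Unique-resp _↭_.refl u = u
  Unique-resp (_↭_.prep x p) (n ∷ u) = All.tabulate (λ m → All.lookup n (∈-resp-↭ (↭-sym p) m)) ∷ Unique-resp p u
  Unique-resp (_↭_.swap x y p) ((n ∷ ns) ∷ m ∷ u) = ((λ e → n (sym e)) ∷ All.tabulate (λ k → All.lookup m (∈-resp-↭ (↭-sym p) k)))
    ∷ All.tabulate (λ k → All.lookup ns (∈-resp-↭ (↭-sym p) k)) ∷ Unique-resp p u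
  Unique-resp (_↭_.trans p q) u = Unique-resp q (Unique-resp p u)

-- Rearranging concatenations

infixr 5 _⊕_
infix 4 _⊜_
data Expr (n : ℕ) : Set where
  var : Fin n → Expr n
  id : Expr n
  _⊕_ : Expr n → Expr n → Expr n

_⊜_ : ∀ {n} → Expr n → Expr n → Expr n × Expr n
_⊜_ = _,_

⟦_⟧ : ∀ {A : Set} {n} → Expr n → Vec (List A) n → List A
⟦ var i ⟧ ρ = Vec.lookup ρ i
⟦ id ⟧ ρ = []
⟦ e ⊕ f ⟧ ρ = ⟦ e ⟧ ρ ++ ⟦ f ⟧ ρ

times : ∀ {A : Set} → ℕ → List A → List A
times zero xs = []
times (suc k) xs = xs ++ times k xs

⟦_⟧⇓ : ∀ {A : Set} {n} → Vec ℕ n → Vec (List A) n → List A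
⟦ [] ⟧⇓ [] = []
⟦ k ∷ v ⟧⇓ (xs ∷ ρ) = times k xs ++ ⟦ v ⟧⇓ ρ

single : ∀ {n} → Fin n → Vec ℕ n
single zero = 1 ∷ Vec.replicate _ 0
single (suc i) = 0 ∷ single i

-- Multiset normal form: concatenations with equal multiplicities are permutations of each other, so
-- every rearrangement below is discharged by `refl` on vectors of numbers.
bag : ∀ {n} → Expr n → Vec ℕ n
bag (var i) = single i
bag id = Vec.replicate _ 0
bag (e ⊕ f) = Vec.zipWith _+_ (bag e) (bag f)

interchange : ∀ {A : Set} (a b c d : List A) → (a ++ b) ++ c ++ d ↭ (a ++ c) ++ b ++ d
interchange a b c d = ↭-trans (↭-reflexive (++-assoc a b (c ++ d))) (↭-trans (++⁺ˡ a (↭-trans (↭-reflexive (sym (++-assoc b c d)))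
  (↭-trans (++⁺ʳ d (++-comm b c)) (↭-reflexive (++-assoc c b d))))) (↭-reflexive (sym (++-assoc a c (b ++ d)))))

zero-correct : ∀ {A : Set} {n} (ρ : Vec (List A) n) → [] ≡ ⟦ Vec.replicate n 0 ⟧⇓ ρ
zero-correct [] = refl
zero-correct (x ∷ ρ) = zero-correct ρ

single-correct : ∀ {A : Set} {n} (i : Fin n) (ρ : Vec (List A) n) → Vec.lookup ρ i ≡ ⟦ single i ⟧⇓ ρ
single-correct zero (x ∷ ρ) = trans (sym (++-identityʳ x)) (cong₂ _++_ (sym (++-identityʳ x)) (zero-correct ρ))
single-correct (suc i) (x ∷ ρ) = single-correct i ρ

times-+ : ∀ {A : Set} k l (xs : List A) → times k xs ++ times l xs ≡ times (k + l) xs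
times-+ zero l xs = refl
times-+ (suc k) l xs = trans (++-assoc xs (times k xs) (times l xs)) (cong (xs ++_) (times-+ k l xs))

plus-correct : ∀ {A : Set} {n} (u v : Vec ℕ n) (ρ : Vec (List A) n) → ⟦ u ⟧⇓ ρ ++ ⟦ v ⟧⇓ ρ ↭ ⟦ Vec.zipWith _+_ u v ⟧⇓ ρ
plus-correct [] [] [] = ↭-refl
plus-correct (k ∷ u) (l ∷ v) (xs ∷ ρ) = ↭-trans (interchange (times k xs) (⟦ u ⟧⇓ ρ) (times l xs) (⟦ v ⟧⇓ ρ)) (++⁺ (↭-reflexive (times-+ k l xs)) (plus-correct u v ρ))

bag-correct : ∀ {A : Set} {n} (e : Expr n) (ρ : Vec (List A) n) → ⟦ e ⟧ ρ ↭ ⟦ bag e ⟧⇓ ρ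
bag-correct (var i) ρ = ↭-reflexive (single-correct i ρ)
bag-correct id ρ = ↭-reflexive (zero-correct ρ)
bag-correct (e ⊕ f) ρ = ↭-trans (++⁺ (bag-correct e ρ) (bag-correct f ρ)) (plus-correct (bag e) (bag f) ρ)

closeⁿ : ∀ {A : Set} n → N-ary n (Expr n) A → A
closeⁿ n f = f $ⁿ Vec.map var (Vec.allFin n)

-- abstract, since with-abstractions would unfold these proofs
abstract
  solve : ∀ {A : Set} n (f : N-ary n (Expr n) (Expr n × Expr n)) → bag (proj₁ (closeⁿ n f)) ≡ bag (proj₂ (closeⁿ n f)) →
          (ρ : Vec (List A) n) → ⟦ proj₁ (closeⁿ n f) ⟧ ρ ↭ ⟦ proj₂ (closeⁿ n f) ⟧ ρ
  solve n f eq ρ = ↭-trans (bag-correct (proj₁ (closeⁿ n f)) ρ) (↭-trans (↭-reflexive (cong (λ b → ⟦ b ⟧⇓ ρ) eq)) (↭-sym (bag-correct (proj₂ (closeⁿ n f)) ρ)))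

-- The vertices are kept abstract because they will be those of `G` together with those of the four
-- hung paths; a list `VS` will single out the vertices of `G`.
record Setting : Set₁ where
  field
    V : Set
    _≟_ : (u v : V) → Dec (u ≡ v)
    _~_ : V → V → Set
    ~sym : ∀ {u v} → u ~ v → v ~ u
    _~?_ : ∀ u v → Dec (u ~ v)

module Core (setting : Setting) where

  open Setting setting

  open DecMembership _≟_ using (_∈?_)

  infix 4 _~~_

  infixr 4 _∙_
  _∙_ : ∀ {xs ys zs : List V} → xs ↭ ys → ys ↭ zs → xs ↭ zs
  _∙_ = ↭-trans

  -- Parities of labels

  xor-assoc : ∀ a b c → (a xor b) xor c ≡ a xor (b xor c)
  xor-assoc true true true = refl
  xor-assoc true true false = refl
  xor-assoc true false c = refl
  xor-assoc false b c = refl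

  xor-comm : ∀ a b → a xor b ≡ b xor a
  xor-comm true true = refl
  xor-comm true false = refl
  xor-comm false true = refl
  xor-comm false false = refl

  xor-same : ∀ a → a xor a ≡ false
  xor-same true = refl
  xor-same false = refl

  xor-false : ∀ a → a xor false ≡ a
  xor-false true = refl
  xor-false false = refl

  xor-mid : ∀ a b c d → (a xor b) xor (c xor d) ≡ (a xor c) xor (b xor d)
  xor-mid a b c d = trans (xor-assoc a b (c xor d)) (trans (cong (a xor_) (trans (sym (xor-assoc b c d)) (trans (cong (_xor d) (xor-comm b c)) (xor-assoc c b d)))) (sym (xor-assoc a c (b xor d))))

  -- Parity of the multiplicity rather than membership: this is additive under concatenation and
  -- invariant under permutation without any uniqueness hypothesis, and on lists without repetition
  -- it is membership (`mem-∈`).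
  mem : List V → V → Bool
  mem [] v = false
  mem (p ∷ ps) v = does (p ≟ v) xor mem ps v

  pin : List V → List V → Bool
  pin A [] = false
  pin A (l ∷ ls) = mem A l xor pin A ls

  mem-++ : ∀ A B v → mem (A ++ B) v ≡ mem A v xor mem B v
  mem-++ [] B v = refl
  mem-++ (p ∷ A) B v = trans (cong (does (p ≟ v) xor_) (mem-++ A B v)) (sym (xor-assoc (does (p ≟ v)) (mem A v) (mem B v)))

  pin-++ : ∀ A xs ys → pin A (xs ++ ys) ≡ pin A xs xor pin A ys
  pin-++ A [] ys = refl
  pin-++ A (x ∷ xs) ys = trans (cong (mem A x xor_) (pin-++ A xs ys)) (sym (xor-assoc (mem A x) (pin A xs) (pin A ys)))

  pin-app : ∀ A B ls → pin (A ++ B) ls ≡ pin A ls xor pin B ls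
  pin-app A B [] = refl
  pin-app A B (l ∷ ls) rewrite mem-++ A B l | pin-app A B ls = xor-mid (mem A l) (mem B l) (pin A ls) (pin B ls)

  pin-↭ : ∀ A {xs ys} → xs ↭ ys → pin A xs ≡ pin A ys
  pin-↭ A _↭_.refl = refl
  pin-↭ A (_↭_.prep x p) = cong (mem A x xor_) (pin-↭ A p)
  pin-↭ A (_↭_.swap {xs} {ys} x y p) = trans (cong (λ z → mem A x xor (mem A y xor z)) (pin-↭ A p))
    (trans (sym (xor-assoc (mem A x) (mem A y) _)) (trans (cong (_xor pin A ys) (xor-comm (mem A x) (mem A y))) (xor-assoc (mem A y) (mem A x) _)))
  pin-↭ A (_↭_.trans p q) = trans (pin-↭ A p) (pin-↭ A q)

  mem-∉ : ∀ A {v} → v ∉ A → mem A v ≡ false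
  mem-∉ [] _ = refl
  mem-∉ (p ∷ A) {v} n with p ≟ v
  ... | yes e = ⊥-elim (n (here (sym e)))
  ... | no _ = mem-∉ A (λ m → n (there m))

  pin-∉ : ∀ A ls → All (_∉ A) ls → pin A ls ≡ false
  pin-∉ A [] [] = refl
  pin-∉ A (l ∷ ls) (n ∷ ns) rewrite mem-∉ A n = pin-∉ A ls ns

  pin-[] : ∀ ls → pin [] ls ≡ false
  pin-[] [] = refl
  pin-[] (l ∷ ls) = pin-[] ls

  not-not : ∀ b → not (not b) ≡ b
  not-not true = refl
  not-not false = refl

  odd : List V → Bool
  odd [] = false
  odd (_ ∷ xs) = not (odd xs)

  -- The middle vertex is confined to `S` so that an item built inside `D` can later be turned, by
  -- `through`, into a path of the graph inside `D`.
  Lk : (V → Set) → V → V → Set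
  Lk S u v = u ~ v ⊎ ∃ λ w → S w × u ~ w × w ~ v

  _~~_ : V → V → Set
  b ~~ y = b ≡ y ⊎ b ~ y

  Lk-sym : ∀ {S u v} → Lk S u v → Lk S v u
  Lk-sym (inj₁ e) = inj₁ (~sym e)
  Lk-sym (inj₂ (w , s , a , b)) = inj₂ (w , s , ~sym b , ~sym a)

  Lk-map : ∀ {S T : V → Set} {u v} → (∀ {w} → S w → T w) → Lk S u v → Lk T u v
  Lk-map f (inj₁ e) = inj₁ e
  Lk-map f (inj₂ (w , s , a , b)) = inj₂ (w , f s , a , b)

  Ch-reverse : ∀ {S a xs b} → Ch (Lk S) a xs b → Ch (Lk S) b (reverse xs) a
  Ch-reverse = Ch-rev Lk-sym

  Ch-++[] : ∀ {R : V → V → Set} {a xs b} → Ch R a xs b → Ch R a (xs ++ []) b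
  Ch-++[] {xs = xs} c = subst (λ z → Ch _ _ z _) (sym (++-identityʳ xs)) c

  -- Items and their normal form at a vertex

  data Loop (S : V → Set) (y : V) : List V → Set where
    nil : Loop S y []
    lp : ∀ {a xs b} → Ch (Lk S) a xs b → a ~ y → b ~ y → Loop S y xs

  -- What can be put next to `y` on one side: its first vertex is a neighbour of `y` and therefore
  -- linked to every other neighbour of `y`, and its last vertex is linked to `y` itself. Tokens
  -- have this shape, and so do the vertices that a scan carries along.
  data Hung (S : V → Set) (y : V) : List V → Set where
    nil : Hung S y []
    hg : ∀ {a xs b} → Ch (Lk S) a xs b → a ~ y → Lk S b y → Hung S y xs

  -- An item is a path in the square whose ends are neighbours of its labels s and t; a half has t = y.
  record Half (S : V → Set) (y : V) : Set where
    constructor mkHalf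
    field
      {s a b} : V
      {xs} : List V
      ch : Ch (Lk S) a xs b
      sa : s ~ a
      by : b ~ y

  record Item (S : V → Set) : Set where
    constructor mkItem
    field
      {s a b t} : V
      {xs} : List V
      ch : Ch (Lk S) a xs b
      sa : s ~ a
      bt : b ~ t

  flat : ∀ {S} → List (Item S) → List V
  flat [] = []
  flat (i ∷ is) = Item.xs i ++ flat is

  labs : ∀ {S} → List (Item S) → List V
  labs [] = []
  labs (i ∷ is) = Item.s i ∷ Item.t i ∷ labs is

  ex : Bool → V → List V
  ex true v = v ∷ []
  ex false v = []

  -- The balance of a scan ending at `r`, where `b` will be the parity of the labels met. If it is
  -- odd, one item end has been moved to `r` and nothing hangs there. If it is even, no label is
  -- added, and a list may or may not hang at `r`; hence `clean` is an implication in one direction.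
  record Out (S : V → Set) (r : V) (ps F : List V) (is : List (Item S)) (ls : List V) (b : Bool) : Set where
    constructor mkOut
    field
      {hs ys zs} : List V
      items : List (Item S)
      hung : Hung S r hs
      clean : b ≡ true → hs ≡ []
      perm : hs ++ flat items ↭ F ++ flat is
      split : ls ↭ ys ++ zs
      ins : All (_∈ ps) ys
      outs : All (_∉ ps) zs
      labels : labs items ↭ ex b r ++ zs

  ≢⇒∉ : ∀ {l y : V} → l ≢ y → l ∉ (y ∷ [])
  ≢⇒∉ ne (here e) = ne e
  ≢⇒∉ ne (there ())

  module _ {S : V → Set} {y : V} (Sy : S y) where

    lift : ∀ {a b} → a ~ y → b ~ y → Lk S a b
    lift p q = inj₂ (y , Sy , p , ~sym q)

    nearLk : ∀ {b r} → b ~~ y → y ~ r → Lk S b r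
    nearLk (inj₁ refl) e = inj₁ e
    nearLk (inj₂ p) e = inj₂ (y , Sy , p , e)

    attach : ∀ {a xs b H} → Ch (Lk S) a xs b → b ~ y → Hung S y H → Ch (Lk S) a (xs ++ H ++ y ∷ []) y
    attach c by nil = Ch-++ c (inj₁ by) one
    attach c by (hg h ha hb) = Ch-++ c (lift by ha) (Ch-++ h hb one)

    start : ∀ {H} → Hung S y H → ∃ λ a → Ch (Lk S) a (H ++ y ∷ []) y × a ~~ y
    start nil = y , one , inj₁ refl
    start (hg h ha hb) = _ , Ch-++ h hb one , inj₂ ha

    tailH : ∀ {a xs H} → Ch (Lk S) a xs y → Hung S y H → ∃ λ b → Ch (Lk S) a (xs ++ reverse H) b × b ~~ y
    tailH c nil = y , Ch-++[] c , inj₁ refl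
    tailH c (hg h ha hb) = _ , Ch-++ c (Lk-sym hb) (Ch-reverse h) , inj₂ ha

    tailL : ∀ {a xs b L} → Ch (Lk S) a xs b → b ~~ y → Loop S y L → ∃ λ b′ → Ch (Lk S) a (xs ++ L) b′ × b′ ~~ y
    tailL c n nil = _ , Ch-++[] c , n
    tailL c n (lp l la lb) = _ , Ch-++ c (nearLk n (~sym la)) l , inj₂ lb

    attachL : ∀ {a xs b L} → Ch (Lk S) a xs b → b ~ y → Loop S y L → ∃ λ b′ → Ch (Lk S) a (xs ++ L) b′ × b′ ~ y
    attachL c n nil = _ , Ch-++[] c , n
    attachL c n (lp l la lb) = _ , Ch-++ c (lift n la) l , lb

    joinLL : ∀ {L L′} → Loop S y L → Loop S y L′ → Loop S y (L ++ L′)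
    joinLL nil l = l
    joinLL (lp c a b) l with attachL c b l
    ... | _ , c′ , b′ = lp c′ a b′

  module Normal {S : V → Set} {y : V} (Sy : S y) where

    -- Apart from loops at `y`, at most two item ends labelled `y` have to be kept, since further
    -- ones can be joined in pairs through `y`. In the even case two halves are not joined at once,
    -- because `y` and whatever hangs there can be put between them.
    data Form (is : List (Item S)) : Bool → Set where
      closed : ∀ {L ys} (rest : List (Item S)) → Loop S y L → flat is ↭ L ++ flat rest →
               labs is ↭ ys ++ labs rest → All (_≡ y) ys → odd ys ≡ false →
               All (_≢ y) (labs rest) → Form is false
      half : ∀ {ys} (h : Half S y) (rest : List (Item S)) → flat is ↭ Half.xs h ++ flat rest →
             labs is ↭ ys ++ Half.s h ∷ labs rest → All (_≡ y) ys → odd ys ≡ true →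
             All (_≢ y) (Half.s h ∷ labs rest) → Form is true
      two : ∀ {ys} (h h′ : Half S y) (rest : List (Item S)) →
            flat is ↭ Half.xs h ++ Half.xs h′ ++ flat rest →
            labs is ↭ ys ++ Half.s h ∷ Half.s h′ ∷ labs rest → All (_≡ y) ys → odd ys ≡ false →
            All (_≢ y) (Half.s h ∷ Half.s h′ ∷ labs rest) → Form is false

    merge : (h h′ : Half S y) → Item S
    merge (mkHalf c sa by) (mkHalf c′ sa′ by′) =
      mkItem (Ch-++ c (lift Sy by by′) (Ch-reverse c′)) sa (~sym sa′)

    absorb : ∀ (h : Half S y) {L} → Loop S y L → Σ (Half S y) λ h′ → Half.s h′ ≡ Half.s h × Half.xs h′ ≡ Half.xs h ++ L
    absorb (mkHalf c sa by) l with attachL Sy c by l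
    ... | _ , c′ , by′ = mkHalf c′ sa by′ , refl , refl

    addNone : ∀ (i : Item S) {is d} → Item.s i ≢ y → Item.t i ≢ y → Form is d → Form (i ∷ is) d
    addNone i ns nt (closed {L} {ys} rest l p q e o n) =
      closed (i ∷ rest) l
        (++⁺ˡ (Item.xs i) p ∙ solve 3 (λ a b c → a ⊕ b ⊕ c ⊜ b ⊕ a ⊕ c) refl ((Item.xs i) ∷ L ∷ (flat rest) ∷ []))
        (↭-prep _ (↭-prep _ q) ∙ solve 4 (λ s t b c → s ⊕ t ⊕ b ⊕ c ⊜ b ⊕ s ⊕ t ⊕ c) refl ([ Item.s i ] ∷ [ Item.t i ] ∷ ys ∷ (labs rest) ∷ []))
        e o (ns ∷ nt ∷ n)
    addNone i ns nt (half {ys} h rest p q e o (nh ∷ n)) =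
      half h (i ∷ rest)
        (++⁺ˡ (Item.xs i) p ∙ solve 3 (λ a b c → a ⊕ b ⊕ c ⊜ b ⊕ a ⊕ c) refl ((Item.xs i) ∷ (Half.xs h) ∷ (flat rest) ∷ []))
        (↭-prep _ (↭-prep _ q) ∙ solve 5 (λ s t b u c → s ⊕ t ⊕ b ⊕ u ⊕ c ⊜ b ⊕ u ⊕ s ⊕ t ⊕ c) refl ([ Item.s i ] ∷ [ Item.t i ] ∷ ys ∷ [ Half.s h ] ∷ (labs rest) ∷ []))
        e o (nh ∷ ns ∷ nt ∷ n)
    addNone i ns nt (two {ys} h h′ rest p q e o (nh ∷ nh′ ∷ n)) =
      two h h′ (i ∷ rest)
        (++⁺ˡ (Item.xs i) p ∙ solve 4 (λ a b b′ c → a ⊕ b ⊕ b′ ⊕ c ⊜ b ⊕ b′ ⊕ a ⊕ c) refl ((Item.xs i) ∷ (Half.xs h) ∷ (Half.xs h′) ∷ (flat rest) ∷ []))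
        (↭-prep _ (↭-prep _ q) ∙ solve 6 (λ s t b u u′ c → s ⊕ t ⊕ b ⊕ u ⊕ u′ ⊕ c ⊜ b ⊕ u ⊕ u′ ⊕ s ⊕ t ⊕ c) refl ([ Item.s i ] ∷ [ Item.t i ] ∷ ys ∷ [ Half.s h ] ∷ [ Half.s h′ ] ∷ (labs rest) ∷ []))
        e o (nh ∷ nh′ ∷ ns ∷ nt ∷ n)

    addLoop : ∀ (i : Item S) {is d} → Item.s i ≡ y → Item.t i ≡ y → Form is d → Form (i ∷ is) d
    addLoop (mkItem {xs = xs} c sa bt) refl refl (closed {L} {ys} rest l p q e o n) =
      closed rest (joinLL Sy (lp c (~sym sa) bt) l) (++⁺ˡ xs p ∙ ↭-sym (++-assoc-↭ xs L _))
        (↭-prep _ (↭-prep _ q)) (refl ∷ refl ∷ e) (trans (not-not (odd ys)) o) n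
      where
      ++-assoc-↭ : ∀ (a b c : List V) → (a ++ b) ++ c ↭ a ++ b ++ c
      ++-assoc-↭ a b c = solve 3 (λ a b c → (a ⊕ b) ⊕ c ⊜ a ⊕ b ⊕ c) refl (a ∷ b ∷ c ∷ [])
    addLoop (mkItem {xs = xs} c sa bt) refl refl (half {ys} h rest p q e o n) with absorb h (lp c (~sym sa) bt)
    ... | h₂ , refl , refl =
      half h₂ rest (++⁺ˡ xs p ∙ solve 3 (λ a b c → a ⊕ b ⊕ c ⊜ (b ⊕ a) ⊕ c) refl (xs ∷ (Half.xs h) ∷ (flat rest) ∷ []))
        (↭-prep _ (↭-prep _ q)) (refl ∷ refl ∷ e) (trans (not-not (odd ys)) o) n
    addLoop (mkItem {xs = xs} c sa bt) refl refl (two {ys} h h′ rest p q e o n) with absorb h (lp c (~sym sa) bt)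
    ... | h₂ , refl , refl =
      two h₂ h′ rest (++⁺ˡ xs p ∙ solve 4 (λ a b b′ c → a ⊕ b ⊕ b′ ⊕ c ⊜ (b ⊕ a) ⊕ b′ ⊕ c) refl (xs ∷ (Half.xs h) ∷ (Half.xs h′) ∷ (flat rest) ∷ []))
        (↭-prep _ (↭-prep _ q)) (refl ∷ refl ∷ e) (trans (not-not (odd ys)) o) n

    addHalf : ∀ (i : Item S) {is d} (h : Half S y) → Item.xs i ↭ Half.xs h →
              Item.s i ∷ Item.t i ∷ [] ↭ y ∷ Half.s h ∷ [] → Half.s h ≢ y → Form is d → Form (i ∷ is) (not d)
    addHalf i h pf pl nh (closed {L} {ys} rest l p q e o n) with absorb h l
    ... | h₂ , refl , refl =
      half h₂ rest (++⁺ pf p ∙ solve 3 (λ a b c → a ⊕ b ⊕ c ⊜ (a ⊕ b) ⊕ c) refl ((Half.xs h) ∷ L ∷ (flat rest) ∷ []))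
        (++⁺ pl q ∙ solve 4 (λ y s b c → (y ⊕ s) ⊕ b ⊕ c ⊜ (y ⊕ b) ⊕ s ⊕ c) refl ([ y ] ∷ [ Half.s h ] ∷ ys ∷ (labs rest) ∷ []))
        (refl ∷ e) (cong not o) (nh ∷ n)
    addHalf i h pf pl nh (half {ys} h₁ rest p q e o (nh₁ ∷ n)) =
      two h h₁ rest (++⁺ pf p)
        (++⁺ pl q ∙ solve 5 (λ y s b u c → (y ⊕ s) ⊕ b ⊕ u ⊕ c ⊜ (y ⊕ b) ⊕ s ⊕ u ⊕ c) refl ([ y ] ∷ [ Half.s h ] ∷ ys ∷ [ Half.s h₁ ] ∷ (labs rest) ∷ []))
        (refl ∷ e) (cong not o) (nh ∷ nh₁ ∷ n)
    addHalf i h pf pl nh (two {ys} h₁ h₂ rest p q e o (nh₁ ∷ nh₂ ∷ n)) =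
      half h (merge h₁ h₂ ∷ rest)
        (++⁺ pf p ∙ ++⁺ˡ (Half.xs h) (++⁺ˡ (Half.xs h₁) (++⁺ʳ _ (↭-sym (↭-reverse (Half.xs h₂))))
          ∙ solve 3 (λ a b c → a ⊕ b ⊕ c ⊜ (a ⊕ b) ⊕ c) refl ((Half.xs h₁) ∷ (reverse (Half.xs h₂)) ∷ (flat rest) ∷ [])))
        (++⁺ pl q ∙ solve 6 (λ y s b u u′ c → (y ⊕ s) ⊕ b ⊕ u ⊕ u′ ⊕ c ⊜ (y ⊕ b) ⊕ s ⊕ u ⊕ u′ ⊕ c) refl ([ y ] ∷ [ Half.s h ] ∷ ys ∷ [ Half.s h₁ ] ∷ [ Half.s h₂ ] ∷ (labs rest) ∷ []))
        (refl ∷ e) (cong not o) (nh ∷ nh₁ ∷ nh₂ ∷ n)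

    norm : (is : List (Item S)) → ∃ λ d → Form is d
    norm [] = false , closed [] nil ↭-refl ↭-refl [] refl []
    norm (i@(mkItem {s} {t = t} c sa bt) ∷ is) with norm is | s ≟ y | t ≟ y
    ... | d , f | yes p | yes q = d , addLoop i p q f
    ... | d , f | no p | no q = d , addNone i p q f
    ... | d , f | yes refl | no q = not d , addHalf i (mkHalf (Ch-reverse c) (~sym bt) (~sym sa)) (↭-sym (↭-reverse _)) ↭-refl q f
    ... | d , f | no p | yes refl = not d , addHalf i (mkHalf c sa bt) ↭-refl (↭-swap _ _ ↭-refl) p f

    allMem : ∀ ys → All (_≡ y) ys → pin (y ∷ []) ys ≡ odd ys
    allMem [] [] = refl
    allMem (x ∷ ys) (refl ∷ e) with y ≟ y
    ... | yes _ = cong not (allMem ys e)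
    ... | no n = ⊥-elim (n refl)

    notMem : ∀ ls → All (_≢ y) ls → pin (y ∷ []) ls ≡ false
    notMem ls n = pin-∉ (y ∷ []) ls (All.map (λ { ne (here e) → ne e ; ne (there ()) }) n)

    private
      parity′ : ∀ ls ys zs {d} → ls ↭ ys ++ zs → All (_≡ y) ys → odd ys ≡ d → All (_≢ y) zs → pin (y ∷ []) ls ≡ d
      parity′ ls ys zs q e o n = trans (pin-↭ (y ∷ []) q) (trans (pin-++ (y ∷ []) ys zs)
        (trans (cong₂ _xor_ (trans (allMem ys e) o) (notMem zs n)) (xor-false _)))

    formParity : ∀ {is d} → Form is d → pin (y ∷ []) (labs is) ≡ d
    formParity (closed rest l p q e o n) = parity′ _ _ _ q e o n
    formParity (half h rest p q e o n) = parity′ _ _ _ q e o n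
    formParity (two h h′ rest p q e o n) = parity′ _ _ _ q e o n

    -- The index is rewritten to the label parity so that `step` can match on the parity and on the
    -- normal form together.
    form : (is : List (Item S)) → Form is (pin (y ∷ []) (labs is))
    form is with norm is
    ... | d , f = subst (Form is) (sym (formParity f)) f

    -- The list starts at `y`, a neighbour of `r`. From `y` one enters `H` at its far end and comes
    -- back to a neighbour of `y`, and so does the loop; hence the last vertex is equal or adjacent
    -- to `y` and is linked to `r`.
    rehang : ∀ {r H L} → y ~ r → Hung S y H → Loop S y L → Hung S r (y ∷ reverse H ++ reverse L)
    rehang yr h l with tailH Sy one h
    ... | b , c , n with tailL Sy c n (rev l)
      where
      rev : ∀ {L} → Loop S y L → Loop S y (reverse L)
      rev nil = nil
      rev (lp c a b) = lp (Ch-reverse c) b a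
    ... | b′ , c′ , n′ = hg c′ yr (nearLk Sy n′ yr)

    pass : (h h′ : Half S y) {H : List V} → Hung S y H → Item S
    pass (mkHalf c sa by) (mkHalf c′ sa′ by′) h =
      mkItem (Ch-++ (attach Sy c by h) (inj₁ (~sym by′)) (Ch-reverse c′)) sa (~sym sa′)

    -- A single open end at `y` is carried through `y` and receives the label `r`; two open ends are
    -- closed by `y`; without an open end there is no strand for `y` to join, and it is carried
    -- along, hanging at `r`.
    step : ∀ {r H} → y ~ r → Hung S y H → (is : List (Item S)) →
           Out S r (y ∷ []) (H ++ y ∷ []) is (labs is) (pin (y ∷ []) (labs is))
    step {r} {H} yr h is with pin (y ∷ []) (labs is) | form is
    ... | false | closed {L} {ys} rest l p q e o n = mkOut rest (rehang yr h l) (λ ())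
      (++⁺ʳ (flat rest) (↭-prep y (++⁺ (↭-reverse H) (↭-reverse L)))
       ∙ solve 4 (λ y h l c → (y ⊕ h ⊕ l) ⊕ c ⊜ (h ⊕ y) ⊕ l ⊕ c) refl ([ y ] ∷ H ∷ L ∷ (flat rest) ∷ [])
       ∙ ++⁺ˡ (H ++ y ∷ []) (↭-sym p))
      q (All.map here e) (All.map ≢⇒∉ n) ↭-refl
    ... | true | half u rest p q e o (nu ∷ n) =
      mkOut (mkItem (attach Sy (Half.ch u) (Half.by u) h) (Half.sa u) yr ∷ rest) nil (λ _ → refl)
        (solve 4 (λ y h l c → (l ⊕ h ⊕ y) ⊕ c ⊜ (h ⊕ y) ⊕ l ⊕ c) refl ([ y ] ∷ H ∷ (Half.xs u) ∷ (flat rest) ∷ [])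
         ∙ ++⁺ˡ (H ++ y ∷ []) (↭-sym p))
        q (All.map here e) (All.map ≢⇒∉ (nu ∷ n)) (↭-swap _ _ ↭-refl)
    ... | false | two u u′ rest p q e o (nu ∷ nu′ ∷ n) =
      mkOut (pass u u′ h ∷ rest) nil (λ _ → refl)
        (++⁺ʳ (flat rest) (++⁺ˡ (Half.xs u ++ H ++ y ∷ []) (↭-reverse (Half.xs u′)))
         ∙ solve 5 (λ y h l l′ c → ((l ⊕ h ⊕ y) ⊕ l′) ⊕ c ⊜ (h ⊕ y) ⊕ l ⊕ l′ ⊕ c) refl ([ y ] ∷ H ∷ (Half.xs u) ∷ (Half.xs u′) ∷ (flat rest) ∷ [])
         ∙ ++⁺ˡ (H ++ y ∷ []) (↭-sym p))
        q (All.map here e) (All.map ≢⇒∉ (nu ∷ nu′ ∷ n)) ↭-refl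

  -- Scanning a path whose vertices may carry tokens

  record Sta (S : V → Set) : Set where
    constructor sta
    field
      v : V
      {ts} : List V
      tok : Hung S v ts

  verts : ∀ {S} → List (Sta S) → List V
  verts [] = []
  verts (s ∷ ss) = Sta.v s ∷ verts ss

  toks : ∀ {S} → List (Sta S) → List V
  toks [] = []
  toks (s ∷ ss) = Sta.ts s ++ toks ss

  hd : List V → V → V
  hd [] t = t
  hd (p ∷ ps) t = p

  To : List V → V → Set
  To [] t = ⊤
  To (p ∷ ps) t = p ~ hd ps t × To ps t

  -- Every token is met by a strand (c is the parity of the number of strands arriving).
  Good : ∀ {S} → Bool → List (Sta S) → List V → Set
  Good c [] ls = ⊤
  Good c (s ∷ ss) ls = (Sta.ts s ≡ [] ⊎ c ≡ true) × Good (c xor pin (Sta.v s ∷ []) ls) ss ls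

  pin-split : ∀ A {ls ys zs} → ls ↭ ys ++ zs → All (_∉ A) ys → pin A ls ≡ pin A zs
  pin-split A {ls} {ys} {zs} p n = trans (pin-↭ A p) (trans (pin-++ A ys zs) (cong (_xor pin A zs) (pin-∉ A ys n)))

  Good-resp : ∀ {S} c (ss : List (Sta S)) {ls ys zs} → ls ↭ ys ++ zs → All (_∉ verts ss) ys → Good c ss ls → Good c ss zs
  Good-resp c [] p n g = tt
  Good-resp c (s ∷ ss) {ls} {ys} {zs} p n (g , gs) = g ,
    subst (λ d → Good (c xor d) ss zs) (pin-split (Sta.v s ∷ []) p (All.map (λ { f (here e) → f (here e) ; f (there ()) }) n))
      (Good-resp _ ss p (All.map (λ f m → f (there m)) n) gs)

  Good-notoks : ∀ {S} c (ss : List (Sta S)) ls → toks ss ≡ [] → Good c ss ls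
  Good-notoks c [] ls e = tt
  Good-notoks c (sta v {[]} tok ∷ ss) ls e = inj₁ refl , Good-notoks _ ss ls e

  pin-ex : ∀ y c ls → pin (y ∷ []) (ex c y ++ ls) ≡ c xor pin (y ∷ []) ls
  pin-ex y false ls = refl
  pin-ex y true ls with y ≟ y
  ... | yes _ = refl
  ... | no n = ⊥-elim (n refl)

  -- The label that the scan itself has brought to `y` is used up at `y`; taking it away leaves a
  -- splitting of the original labels.
  stripEx : ∀ c {y ls ys zs} → ex c y ++ ls ↭ ys ++ zs → All (_∈ y ∷ []) ys → All (_∉ y ∷ []) zs →
            ∃ λ ys′ → ls ↭ ys′ ++ zs × All (_∈ y ∷ []) ys′
  stripEx false {ys = ys} p a n = ys , p , a
  stripEx true {ys = []} p a n with All.lookup n (∈-resp-↭ p (here refl)) (here refl)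
  ... | ()
  stripEx true {ys = x ∷ ys} p (here refl ∷ a) n = ys , drop-∷ p , a

  -- Next to `y` there is one place, claimed by the list carried along and by the token of `y`. This
  -- is the reason for asking for odd parity on arrival at a token.
  plug : ∀ {S y hs ts} → Hung S y hs → Hung S y ts → hs ≡ [] ⊎ ts ≡ [] → Hung S y (hs ++ ts)
  plug h t (inj₁ refl) = t
  plug {hs = hs} h t (inj₂ refl) = subst (Hung _ _) (sym (++-identityʳ hs)) h

  -- Stated for an arbitrary moment of the scan: `ls` are the original labels still in play, and `c`
  -- says whether the scan has added the label of the current vertex to them. `Good` concerns the
  -- later stations, the current one being covered by the hypothesis on `hs`.
  scan : ∀ {S} (s : Sta S) (ss : List (Sta S)) {t c hs ls} (is : List (Item S)) →
         All S (verts (s ∷ ss)) → Unique (verts (s ∷ ss)) → To (verts (s ∷ ss)) t →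
         Hung S (Sta.v s) hs → (c ≡ true → hs ≡ []) → hs ≡ [] ⊎ Sta.ts s ≡ [] →
         Good (c xor pin (Sta.v s ∷ []) ls) ss ls → labs is ↭ ex c (Sta.v s) ++ ls →
         Out S t (verts (s ∷ ss)) (hs ++ toks (s ∷ ss) ++ verts (s ∷ ss)) is ls (c xor pin (verts (s ∷ ss)) ls)
  scan (sta y {ts} tok) ss {t} {c} {hs} {ls} is (Sy ∷ Sa) (u ∷ us) (yr , to) h hc ht g p
    with Normal.step Sy yr (plug h tok ht) is
  ... | mkOut {hs′} {ys} {zs} is′ h′ cl pe sp inn out lb
    with stripEx c (↭-sym p ∙ sp) inn out
  ... | ys′ , sp′ , inn′ with ss
  ... | [] = subst (Out _ _ _ _ _ _) d-eq
         (mkOut is′ h′ cl (pe ∙ solve 4 (λ a b y f → ((a ⊕ b) ⊕ y) ⊕ f ⊜ (a ⊕ (b ⊕ id) ⊕ y) ⊕ f) refl (hs ∷ ts ∷ [ y ] ∷ (flat is) ∷ []))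
           sp′ inn′ out lb)
    where
    d-eq : pin (y ∷ []) (labs is) ≡ c xor pin (y ∷ []) ls
    d-eq = trans (pin-↭ (y ∷ []) p) (pin-ex y c ls)
  ... | s₂ ∷ ss₂ = result
    where
    d = pin (y ∷ []) (labs is)
    d-eq : d ≡ c xor pin (y ∷ []) ls
    d-eq = trans (pin-↭ (y ∷ []) p) (pin-ex y c ls)
    vs = verts (s₂ ∷ ss₂)
    y∉ : ∀ {l} → l ∈ y ∷ [] → l ∉ vs
    y∉ (here refl) m = All.lookup u m refl
    nys : All (_∉ vs) ys′
    nys = All.map y∉ inn′
    g₂ : Good (c xor pin (y ∷ []) ls) (s₂ ∷ ss₂) zs
    g₂ = Good-resp _ (s₂ ∷ ss₂) sp′ nys g
    ht′ : hs′ ≡ [] ⊎ Sta.ts s₂ ≡ []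
    ht′ with proj₁ g₂
    ... | inj₁ e = inj₂ e
    ... | inj₂ e = inj₁ (cl (trans d-eq e))
    rec = scan s₂ ss₂ {t} {d} {hs′} {zs} is′ Sa us to h′ cl ht′
            (subst (λ e → Good (e xor pin (Sta.v s₂ ∷ []) zs) ss₂ zs) (sym d-eq) (proj₂ g₂)) lb
    pin-eq : d xor pin vs zs ≡ c xor pin (y ∷ vs) ls
    pin-eq = trans (cong₂ _xor_ d-eq (sym (pin-split vs sp′ nys)))
               (trans (xor-assoc c _ _) (cong (c xor_) (sym (pin-app (y ∷ []) vs ls))))
    result : Out _ t (y ∷ vs) (hs ++ (ts ++ toks (s₂ ∷ ss₂)) ++ y ∷ vs) is ls (c xor pin (y ∷ vs) ls)
    result with rec
    ... | mkOut {hs₂} {ys₂} {zs₂} is₂ h₂ cl₂ pe₂ sp₂ inn₂ out₂ lb₂ =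
      subst (Out _ _ _ _ _ _) pin-eq
        (mkOut is₂ h₂ cl₂
          (pe₂ ∙ solve 4 (λ a b c f → (a ⊕ b ⊕ c) ⊕ f ⊜ (b ⊕ c) ⊕ a ⊕ f) refl (hs′ ∷ (toks (s₂ ∷ ss₂)) ∷ vs ∷ (flat is′) ∷ [])
           ∙ ++⁺ˡ (toks (s₂ ∷ ss₂) ++ vs) pe
           ∙ solve 6 (λ a b c d y f → (a ⊕ b) ⊕ ((c ⊕ d) ⊕ y) ⊕ f ⊜ (c ⊕ (d ⊕ a) ⊕ y ⊕ b) ⊕ f) refl ((toks (s₂ ∷ ss₂)) ∷ vs ∷ hs ∷ ts ∷ [ y ] ∷ (flat is) ∷ []))
          (sp′ ∙ ++⁺ˡ ys′ sp₂ ∙ solve 3 (λ a b c → a ⊕ b ⊕ c ⊜ (a ⊕ b) ⊕ c) refl (ys′ ∷ ys₂ ∷ zs₂ ∷ []))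
          (AllP.++⁺ (All.map (λ { (here e) → here e }) inn′) (All.map there inn₂))
          (All.zipWith (λ { (a , b) (here e) → b (here e) ; (a , b) (there m) → a m }) (out₂ , All-zs))
          lb₂)
      where
      All-zs : All (_∉ y ∷ []) zs₂
      All-zs = AllP.++⁻ʳ ys₂ (All-resp-↭ sp₂ out)

  -- Cutting and simplifying paths

  chFrom : ∀ {R : V → V → Set} {a} α {p β b} → Ch R a (α ++ p ∷ β) b → Ch R p (p ∷ β) b
  chFrom [] one = one
  chFrom [] (l ◅ c) = l ◅ c
  chFrom (x ∷ []) (l ◅ c) = chFrom [] c
  chFrom (x ∷ y ∷ α) (l ◅ c) = chFrom (y ∷ α) c

  chTo : ∀ {R : V → V → Set} {a} α {p β b} → Ch R a (α ++ p ∷ β) b → Ch R a (α ++ p ∷ []) p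
  chTo [] one = one
  chTo [] (l ◅ c) = one
  chTo (x ∷ []) (l ◅ c) = l ◅ chTo [] c
  chTo (x ∷ y ∷ α) (l ◅ c) = l ◅ chTo (y ∷ α) c

  chInit : ∀ {R : V → V → Set} {a} α {p b} → Ch R a (α ++ p ∷ []) b → α ≡ [] ⊎ ∃ λ c → Ch R a α c × R c p
  chInit [] c = inj₁ refl
  chInit (x ∷ []) (l ◅ one) = inj₂ (_ , one , l)
  chInit (x ∷ y ∷ α) (l ◅ c) with chInit (y ∷ α) c
  ... | inj₂ (_ , c′ , r) = inj₂ (_ , l ◅ c′ , r)

  chTail : ∀ {R : V → V → Set} {p β b} → Ch R p (p ∷ β) b → β ≡ [] ⊎ ∃ λ c → Ch R c β b × R p c
  chTail one = inj₁ refl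
  chTail (l ◅ c) = inj₂ (_ , c , l)

  ToCh : ∀ {a xs b t} → Ch _~_ a xs b → b ~ t → To xs t
  ToCh one e = e , tt
  ToCh (l ◅ one) e = l , e , tt
  ToCh (l ◅ (k ◅ c)) e = l , ToCh (k ◅ c) e

  hdCh : ∀ {R : V → V → Set} {a xs b} t → Ch R a xs b → hd xs t ≡ a
  hdCh t one = refl
  hdCh t (_ ◅ _) = refl

  first : ∀ {A : V → Set} → (∀ v → Dec (A v)) → ∀ xs → Any A xs →
          ∃ λ α → ∃ λ p → ∃ λ β → xs ≡ α ++ p ∷ β × All (λ v → ¬ A v) α × A p
  first A? (x ∷ xs) a with A? x
  ... | yes y = [] , x , xs , refl , [] , y
  first A? (x ∷ xs) (here y) | no n = ⊥-elim (n y)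
  first A? (x ∷ xs) (there a) | no n with first A? xs a
  ... | α , p , β , refl , al , y = x ∷ α , p , β , refl , n ∷ al , y

  abstract
    Unique-++ˡ : ∀ (xs : List V) {ys} → Unique (xs ++ ys) → Unique xs
    Unique-++ˡ [] u = []
    Unique-++ˡ (x ∷ xs) (n ∷ u) = AllP.++⁻ˡ xs n ∷ Unique-++ˡ xs u

  abstract
    Unique-++ʳ : ∀ (xs : List V) {ys} → Unique (xs ++ ys) → Unique ys
    Unique-++ʳ [] u = u
    Unique-++ʳ (x ∷ xs) (n ∷ u) = Unique-++ʳ xs u

  abstract
    Unique-disj : ∀ (xs : List V) {ys v} → Unique (xs ++ ys) → v ∈ xs → v ∉ ys
    Unique-disj (x ∷ xs) (n ∷ u) (here refl) m = All.lookup (AllP.++⁻ʳ xs n) m refl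
    Unique-disj (x ∷ xs) (n ∷ u) (there k) m = Unique-disj xs u k m

  remove : ∀ {v : V} {xs} → v ∈ xs → ∃ λ ys → v ∷ ys ↭ xs
  remove {v} m with ∈-∃++ m
  ... | α , β , refl = α ++ β , ↭-sym (shift v α β)

  abstract
    takeOut : ∀ (Q : List V) {H} → Unique Q → All (_∈ H) Q → ∃ λ H′ → Q ++ H′ ↭ H
    takeOut [] {H} u a = H , ↭-refl
    takeOut (q ∷ Q) (n ∷ u) (m ∷ a) with remove m
    ... | ys , p with takeOut Q u (All.zipWith (λ { (ne , k) → strip ne (∈-resp-↭ (↭-sym p) k) }) (n , a))
      where
      strip : ∀ {x} → q ≢ x → x ∈ q ∷ ys → x ∈ ys
      strip ne (here e) = ⊥-elim (ne (sym e))
      strip ne (there m) = m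
    ... | H′ , r = H′ , (↭-prep q r ∙ p)

  suffix : ∀ {R : V → V → Set} {a xs b v} → Ch R a xs b → Unique xs → v ∈ xs → ∃ λ ys → Ch R v ys b × Unique ys × All (_∈ xs) ys
  suffix {xs = xs} c u m with ∈-∃++ m
  ... | α , β , refl = _ , chFrom α c , Unique-++ʳ α u , All.tabulate (∈-++⁺ʳ α)

  abstract
    simple : ∀ {R : V → V → Set} {a xs b} → Ch R a xs b → ∃ λ ys → Ch R a ys b × Unique ys × All (_∈ xs) ys
    simple one = _ , one , [] ∷ [] , here refl ∷ []
    simple {a = a} (l ◅ c) with simple c
    ... | ys , d , u , s with a ∈? ys
    ... | yes m with suffix d u m
    ... | zs , e , u′ , s′ = zs , e , u′ , All.map (λ k → there (All.lookup s k)) s′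
    simple {a = a} (l ◅ c) | ys , d , u , s | no n =
      a ∷ ys , l ◅ d , All.tabulate (λ { k refl → n k }) ∷ u , here refl ∷ All.map there s

  exit : ∀ {R : V → V → Set} {a xs b} H → Ch R a xs b → a ∈ H → b ∉ H → ∃ λ u → ∃ λ w → R u w × u ∈ H × w ∉ H × w ∈ xs
  exit H one m n = ⊥-elim (n m)
  exit H (_◅_ {b = b} l c) m n with b ∈? H
  ... | no k = _ , b , l , m , k , there (ch-head c)
  ... | yes k with exit H c k n
  ... | u , w , e , p , q , r = u , w , e , p , q , there r

  -- Attachments and components

  Att : V → List V → Set
  Att v H = Any (v ~_) H

  att? : ∀ H v → Dec (Att v H)
  att? H v = Any.any? (v ~?_) H

  record Comp (h : V) (S : List V) : Set where
    field
      {C S′} : List V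
      perm : C ++ S′ ↭ S
      h∈ : h ∈ C
      conn : All (λ c → ∃ λ xs → Ch _~_ h xs c × All (_∈ C) xs) C
      sep : ∀ {c s} → c ∈ C → s ∈ S′ → ¬ (c ~ s)

  grow : ∀ n {h S} (C S′ : List V) → length S′ ≤ n → C ++ S′ ↭ S → h ∈ C →
         All (λ c → ∃ λ xs → Ch _~_ h xs c × All (_∈ C) xs) C → Comp h S
  grow n C S′ le p m c with Any.any? (λ s → Any.any? (_~? s) C) S′
  ... | no ne = record { perm = p ; h∈ = m ; conn = c ; sep = λ a b e → ne (lose b (lose a e)) }
  grow n C S′ le p m c | yes a with find a
  ... | s , s∈ , b with find b | remove s∈
  ... | x , x∈ , e | S″ , q with n
  ... | zero with trans (↭-length q) (ℕP.n≤0⇒n≡0 le)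
  ... | ()
  grow n {h} C S′ le p m c | yes a | s , s∈ , b | x , x∈ , e | S″ , q | suc n′ =
    grow n′ (s ∷ C) S″ (ℕP.≤-pred (subst (_≤ suc n′) (sym (↭-length q)) le))
      (↭-sym (shift s C S″) ∙ ++⁺ˡ C q ∙ p) (there m)
      (new (All.lookup c x∈) ∷ All.map (λ { (xs , d , a) → xs , d , All.map there a }) c)
    where
    new : (∃ λ xs → Ch _~_ h xs x × All (_∈ C) xs) → ∃ λ xs → Ch _~_ h xs s × All (_∈ s ∷ C) xs
    new (xs , d , a) = _ , Ch-++ d e one , AllP.++⁺ (All.map there a) (here refl ∷ [])

  comp : ∀ {h S} → h ∈ S → Comp h S
  comp {h} {S} m with remove m
  ... | S′ , p = grow (length S′) (h ∷ []) S′ ℕP.≤-refl p (here refl) ((_ , one , here refl ∷ []) ∷ [])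

  mem-↭ : ∀ {A B} → A ↭ B → ∀ v → mem A v ≡ mem B v
  mem-↭ _↭_.refl v = refl
  mem-↭ (_↭_.prep x p) v = cong (does (x ≟ v) xor_) (mem-↭ p v)
  mem-↭ (_↭_.swap {xs} {ys} x y p) v = trans (cong (λ z → does (x ≟ v) xor (does (y ≟ v) xor z)) (mem-↭ p v))
    (trans (sym (xor-assoc (does (x ≟ v)) (does (y ≟ v)) (mem ys v))) (trans (cong (_xor mem ys v) (xor-comm (does (x ≟ v)) (does (y ≟ v)))) (xor-assoc (does (y ≟ v)) (does (x ≟ v)) (mem ys v))))
  mem-↭ (_↭_.trans p q) v = trans (mem-↭ p v) (mem-↭ q v)

  pin-perm : ∀ {A B} → A ↭ B → ∀ ls → pin A ls ≡ pin B ls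
  pin-perm p [] = refl
  pin-perm p (l ∷ ls) = cong₂ _xor_ (mem-↭ p l) (pin-perm p ls)

  -- Scans of a whole path and the labels they leave

  toSta : ∀ {S : V → Set} → List V → List (Sta S)
  toSta [] = []
  toSta (x ∷ xs) = sta x nil ∷ toSta xs

  verts-toSta : ∀ {S} xs → verts (toSta {S} xs) ≡ xs
  verts-toSta [] = refl
  verts-toSta (x ∷ xs) = cong (x ∷_) (verts-toSta xs)

  toks-toSta : ∀ {S} xs → toks (toSta {S} xs) ≡ []
  toks-toSta [] = refl
  toks-toSta (x ∷ xs) = toks-toSta xs

  -- The outcome of a scan of odd total parity, where nothing is left hanging. About the labels it
  -- keeps just what a second scan needs: where they can lie, and that parities on lists disjoint
  -- from the scanned path and `t` are unchanged.
  record Run (S : V → Set) (t : V) (ps F : List V) (is : List (Item S)) : Set₁ where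
    field
      items : List (Item S)
      perm : flat items ↭ F ++ flat is
      labelled : ∀ (A : V → Set) → A t → All (λ l → l ∈ ps ⊎ A l) (labs is) → All A (labs items)
      pins : ∀ B → t ∉ B → (∀ {v} → v ∈ ps → v ∉ B) → pin B (labs items) ≡ pin B (labs is)

  ∈-subst : ∀ {xs ys : List V} {l} → xs ≡ ys → l ∈ xs → l ∈ ys
  ∈-subst refl m = m

  ToEq : ∀ {xs ys t} → xs ≡ ys → To xs t → To ys t
  ToEq refl x = x

  module OutProps {S t ps F} {is : List (Item S)} {ls b} (o : Out S t ps F is ls b) where
    labelled : ∀ (A : V → Set) → A t → All (λ l → l ∈ ps ⊎ A l) ls → All A (labs (Out.items o))
    labelled A At al = All-resp-↭ (↭-sym (Out.labels o)) (AllP.++⁺ (exA b) (All.zipWith (λ { (n , inj₁ m) → ⊥-elim (n m) ; (n , inj₂ a) → a })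
      (Out.outs o , AllP.++⁻ʳ (Out.ys o) (All-resp-↭ (Out.split o) al))))
      where
      exA : ∀ b → All A (ex b t)
      exA true = At ∷ []
      exA false = []

    pins : ∀ B → t ∉ B → (∀ {v} → v ∈ ps → v ∉ B) → pin B (labs (Out.items o)) ≡ pin B ls
    pins B tB dj = trans (pin-↭ B (Out.labels o)) (trans (pin-++ B (ex b t) (Out.zs o)) (trans (cong (_xor pin B (Out.zs o)) (exB b))
      (sym (pin-split B (Out.split o) (All.map dj (Out.ins o))))))
      where
      exB : ∀ b → pin B (ex b t) ≡ false
      exB true = trans (xor-false _) (mem-∉ B tB)
      exB false = refl

  GoodStart : ∀ {S} → List (Sta S) → List V → Set
  GoodStart [] ls = ⊤
  GoodStart (s ∷ ss) ls = Good (pin (Sta.v s ∷ []) ls) ss ls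

  runS : ∀ {S} (ss : List (Sta S)) {t} → All S (verts ss) → Unique (verts ss) → To (verts ss) t → (is : List (Item S)) →
         ss ≡ [] ⊎ pin (verts ss) (labs is) ≡ true → GoodStart ss (labs is) →
         Run S t (verts ss) (toks ss ++ verts ss) is
  runS [] Sa u to is _ _ = record { items = is ; perm = ↭-refl
    ; labelled = λ A At → All.map λ { (inj₁ ()) ; (inj₂ a) → a } ; pins = λ B _ _ → refl }
  runS (s ∷ ss) Sa u to is (inj₁ ())
  runS {S} (s ∷ ss) {t} Sa u to is (inj₂ odd!) g =
    record { items = Out.items o
      ; perm = subst (λ z → z ++ flat (Out.items o) ↭ (toks (s ∷ ss) ++ verts (s ∷ ss)) ++ flat is) (Out.clean o odd!) (Out.perm o)
      ; labelled = OutProps.labelled o ; pins = OutProps.pins o }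
    where
    o = scan s ss {t} {false} {[]} {labs is} is Sa u to nil (λ ()) (inj₁ refl) g ↭-refl

  run : ∀ {S} ps {t} → All S ps → Unique ps → To ps t → (is : List (Item S)) →
        ps ≡ [] ⊎ pin ps (labs is) ≡ true → Run S t ps ps is
  run {S} ps {t} Sa u to is c =
    subst (λ z → Run S t z ps is) eqv (subst (λ z → Run S t (verts (toSta {S} ps)) z is) (trans (cong (_++ verts (toSta {S} ps)) (toks-toSta {S} ps)) eqv)
      (runS (toSta ps) (subst (All S) (sym eqv) Sa) (subst Unique (sym eqv) u) (ToEq (sym eqv) to) is (odd! ps c) (good ps)))
    where
    eqv : verts (toSta {S} ps) ≡ ps
    eqv = verts-toSta ps
    odd! : ∀ ps → ps ≡ [] ⊎ pin ps (labs is) ≡ true → toSta {S} ps ≡ [] ⊎ pin (verts (toSta {S} ps)) (labs is) ≡ true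
    odd! ps (inj₁ refl) = inj₁ refl
    odd! ps (inj₂ e) = inj₂ (trans (cong (λ z → pin z (labs is)) (verts-toSta {S} ps)) e)
    good : ∀ ps → GoodStart (toSta {S} ps) (labs is)
    good [] = tt
    good (p ∷ ps) = Good-notoks _ (toSta ps) _ (toks-toSta ps)

  scanL : ∀ {S} ps {t} → All S ps → Unique ps → To ps t → (is : List (Item S)) → Out S t ps ps is (labs is) (pin ps (labs is))
  scanL [] {t} Sa u to is = subst (Out _ t [] [] is (labs is)) (sym (pin-[] (labs is)))
    (mkOut {ys = []} is nil (λ ()) ↭-refl ↭-refl [] (All.tabulate (λ _ ())) ↭-refl)
  scanL {S} (p ∷ ps) {t} Sa u to is =
    subst (λ z → Out S t z (p ∷ ps) is (labs is) (pin (p ∷ ps) (labs is))) eqv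
     (subst (λ z → Out S t (verts (toSta {S} (p ∷ ps))) z is (labs is) (pin (p ∷ ps) (labs is))) (trans (cong (_++ verts (toSta {S} (p ∷ ps))) (toks-toSta {S} ps)) eqv)
      (subst (Out S t _ _ is (labs is)) (cong (λ z → pin z (labs is)) eqv)
       (scan (sta p nil) (toSta ps) {t} {false} {[]} {labs is} is (subst (All S) (sym eqv) Sa) (subst Unique (sym eqv) u)
          (ToEq (sym eqv) to) nil (λ ()) (inj₁ refl) (Good-notoks _ (toSta ps) _ (toks-toSta ps)) ↭-refl)))
    where
    eqv : verts (toSta {S} (p ∷ ps)) ≡ p ∷ ps
    eqv = verts-toSta (p ∷ ps)

  -- The way in which saturation is exploited: a vertex without neighbours in the covered set cannot
  -- be a label.
  labAdj : ∀ {S} (is : List (Item S)) → All (λ l → ∃ λ d → d ∈ flat is × l ~ d) (labs is)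
  labAdj [] = []
  labAdj (mkItem {xs = xs} c sa bt ∷ is) = (_ , ∈-++⁺ˡ (ch-head c) , sa) ∷ (_ , ∈-++⁺ˡ (ch-last c) , ~sym bt) ∷
    All.map (λ { (d , m , e) → d , ∈-++⁺ʳ xs m , e }) (labAdj is)

  mapI : ∀ {S T : V → Set} → (∀ {w} → S w → T w) → List (Item S) → List (Item T)
  mapI f [] = []
  mapI f (mkItem c p q ∷ is) = mkItem (Ch-map (Lk-map f) c) p q ∷ mapI f is

  flat-mapI : ∀ {S T : V → Set} (f : ∀ {w} → S w → T w) is → flat (mapI {S} {T} f is) ≡ flat is
  flat-mapI f [] = refl
  flat-mapI f (i ∷ is) = cong (Item.xs i ++_) (flat-mapI f is)

  labs-mapI : ∀ {S T : V → Set} (f : ∀ {w} → S w → T w) is → labs (mapI {S} {T} f is) ≡ labs is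
  labs-mapI f [] = refl
  labs-mapI f (i ∷ is) = cong (λ z → Item.s i ∷ Item.t i ∷ z) (labs-mapI f is)

  mem-∈ : ∀ {A v} → Unique A → v ∈ A → mem A v ≡ true
  mem-∈ {p ∷ A} {v} (n ∷ u) m with p ≟ v
  mem-∈ {p ∷ A} {v} (n ∷ u) m | yes refl rewrite mem-∉ A (λ k → All.lookup n k refl) = refl
  mem-∈ {p ∷ A} {v} (n ∷ u) (here e) | no ne = ⊥-elim (ne (sym e))
  mem-∈ {p ∷ A} {v} (n ∷ u) (there m) | no ne = mem-∈ u m

  hd-∈ : ∀ ps {t} → ps ≢ [] → hd ps t ∈ ps
  hd-∈ [] n = ⊥-elim (n refl)
  hd-∈ (p ∷ ps) n = here refl

  U : V → Set
  U _ = ⊤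

  allU : ∀ xs → All U xs
  allU = All.universal (λ _ → tt)

  pin-∷ : ∀ p ps ls → pin (p ∷ ps) ls ≡ pin (p ∷ []) ls xor pin ps ls
  pin-∷ p ps ls = pin-app (p ∷ []) ps ls

  chSplit : ∀ {R : V → V → Set} {a b} α {β} → β ≢ [] → Ch R a (α ++ β) b → ∃ λ c → Ch R c β b × (α ≡ [] × a ≡ c ⊎ ∃ λ d → Ch R a α d × R d c)
  chSplit [] n c = _ , c , inj₁ (refl , refl)
  chSplit (x ∷ []) {[]} n c = ⊥-elim (n refl)
  chSplit (x ∷ []) {_ ∷ _} n (l ◅ c) = _ , c , inj₂ (_ , one , l)
  chSplit (x ∷ y ∷ α) n (l ◅ c) with chSplit (y ∷ α) n c
  ... | c′ , d , inj₂ (e , f , r) = c′ , d , inj₂ (e , l ◅ f , r)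

  rev-mid : ∀ (α : List V) z γ → reverse (α ++ z ∷ γ) ≡ reverse γ ++ z ∷ reverse α
  rev-mid α z γ = trans (reverse-++ α (z ∷ γ)) (trans (cong (_++ reverse α) (unfold-reverse z γ)) (++-assoc (reverse γ) (z ∷ []) (reverse α)))

  -- A strand X labelled s at its first end, whose last end is only near the next vertex, is scanned along ps.
  data DOut (S : V → Set) (y : V) (ps : List V) (s : V) (X : List V) (is : List (Item S)) : Set where
    still : ∀ {a X′ b ys zs} (is′ : List (Item S)) → Ch (Lk S) a X′ b → s ~ a → Lk S b y → X′ ++ flat is′ ↭ X ++ ps ++ flat is →
            labs is ↭ ys ++ zs → All (_∈ ps) ys → All (_∉ ps) zs → labs is′ ↭ zs → s ∉ ps → pin ps (labs is) ≡ false → DOut S y ps s X is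
    back : ∀ {b} → Out S y ps (X ++ ps) is (s ∷ labs is) b → b ≡ not (pin ps (s ∷ labs is)) → DOut S y ps s X is

  -- The strand counts like an item whose second label is the next vertex; the negated parity in
  -- `back` accounts for this missing label. At the vertex `s` the strand is an ordinary hanging
  -- list. A single open end met on the way completes it to an item. Two open ends at the same
  -- vertex are joined to each other, and the strand goes on.
  dirtyScan : ∀ {S} ps {y a X b s} → Ch (Lk S) a X b → s ~ a → Lk S b (hd ps y) → All S ps → Unique ps → To ps y →
              (is : List (Item S)) → DOut S y ps s X is
  dirtyScan [] {X = X} c sa by Sa u to is =
    still {ys = []} is c sa by ↭-refl ↭-refl [] (All.tabulate (λ _ ())) ↭-refl (λ ()) (pin-[] (labs is))
  dirtyScan {S} (p ∷ ps) {y} {a} {X} {b} {s} c sa bp Sp u to is with p ≟ s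
  dirtyScan {S} (p ∷ ps) {y} {a} {X} {b} c sa bp Sp u to is | yes refl =
    back (mkOut (Out.items o) (Out.hung o) (Out.clean o)
           (subst (λ z → Out.hs o ++ flat (Out.items o) ↭ (X ++ z) ++ flat is) eqv
             (subst (λ z → Out.hs o ++ flat (Out.items o) ↭ (X ++ z ++ verts (toSta {S} (p ∷ ps))) ++ flat is) (toks-toSta {S} ps) (Out.perm o)))
           (↭-prep p (Out.split o))
           (here refl ∷ All.map (∈-subst eqv) (Out.ins o)) (All.map (λ n m → n (∈-subst (sym eqv) m)) (Out.outs o)) (Out.labels o))
      (trans (cong (λ z → pin z (labs is)) eqv) (sym (trans (cong (λ z → not (z xor pin (p ∷ ps) (labs is))) (mem-∈ u (here refl))) (not-not _))))
    where
    eqv : verts (toSta {S} (p ∷ ps)) ≡ p ∷ ps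
    eqv = verts-toSta (p ∷ ps)
    o = scan (sta p nil) (toSta ps) {y} {false} {X} {labs is} is (subst (All S) (sym eqv) Sp) (subst Unique (sym eqv) u)
          (ToEq (sym eqv) to) (hg c (~sym sa) bp) (λ ()) (inj₂ refl) (Good-notoks _ (toSta ps) _ (toks-toSta ps)) ↭-refl
  dirtyScan {S} (p ∷ ps) {y} {a} {X} {b} {s} c sa bp (Sp ∷ Sps) u@(nps ∷ ups) (pr , to) is | no p≢s = go (Normal.norm Sp is)
    where
    p∉ : ∀ {l} → l ≡ p → l ∉ ps
    p∉ refl m = All.lookup nps m refl
    s-no : mem (p ∷ []) s ≡ false
    s-no = mem-∉ (p ∷ []) (λ { (here e) → p≢s (sym e) ; (there ()) })
    cont : ∀ {a′ X′ b′} (is′ : List (Item S)) {ys} → Ch (Lk S) a′ X′ b′ → s ~ a′ → Lk S b′ (hd ps y) → X′ ++ flat is′ ↭ X ++ p ∷ flat is →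
           labs is ↭ ys ++ labs is′ → All (_≡ p) ys → All (_≢ p) (labs is′) → pin (p ∷ []) (labs is) ≡ false → DOut S y (p ∷ ps) s X is
    cont {a′} {X′} {b′} is′ {ys} c′ sa′ br pe sp ey ny ev with dirtyScan ps c′ sa′ br Sps ups to is′
    ... | still {X′ = X″} {ys = ys₂} {zs₂} is″ c″ sa″ by″ pe″ sp″ in″ out″ lb″ s∉ ev″ =
      still is″ c″ sa″ by″ (pe″ ∙ solve 3 (λ x q f → x ⊕ q ⊕ f ⊜ q ⊕ x ⊕ f) refl (X′ ∷ ps ∷ (flat is′) ∷ []) ∙ ++⁺ˡ ps pe
          ∙ solve 4 (λ q x p f → q ⊕ x ⊕ p ⊕ f ⊜ x ⊕ (p ⊕ q) ⊕ f) refl (ps ∷ X ∷ (p ∷ []) ∷ (flat is) ∷ []))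
        (sp ∙ ++⁺ˡ ys sp″ ∙ solve 3 (λ a b c → a ⊕ b ⊕ c ⊜ (a ⊕ b) ⊕ c) refl (ys ∷ ys₂ ∷ zs₂ ∷ []))
        (AllP.++⁺ (All.map here ey) (All.map there in″))
        (All.zipWith (λ { (n , m) (here e) → m e ; (n , m) (there k) → n k }) (out″ , AllP.++⁻ʳ ys₂ (All-resp-↭ sp″ ny)))
        lb″ (λ { (here e) → p≢s (sym e) ; (there k) → s∉ k })
        (trans (pin-∷ p ps (labs is)) (trans (cong (_xor pin ps (labs is)) ev) (trans (pin-split ps sp (All.map p∉ ey)) ev″)))
    ... | back o eb = back
      (mkOut (Out.items o) (Out.hung o) (Out.clean o)
        (Out.perm o ∙ solve 3 (λ x q f → (x ⊕ q) ⊕ f ⊜ q ⊕ x ⊕ f) refl (X′ ∷ ps ∷ (flat is′) ∷ []) ∙ ++⁺ˡ ps pe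
          ∙ solve 4 (λ q x p f → q ⊕ x ⊕ p ⊕ f ⊜ (x ⊕ (p ⊕ q)) ⊕ f) refl (ps ∷ X ∷ (p ∷ []) ∷ (flat is) ∷ []))
        (↭-prep s sp ∙ solve 3 (λ s a b → s ⊕ a ⊕ b ⊜ a ⊕ s ⊕ b) refl ((s ∷ []) ∷ ys ∷ (labs is′) ∷ []) ∙ ++⁺ˡ ys (Out.split o)
          ∙ solve 3 (λ a b c → a ⊕ b ⊕ c ⊜ (a ⊕ b) ⊕ c) refl (ys ∷ (Out.ys o) ∷ (Out.zs o) ∷ []))
        (AllP.++⁺ (All.map here ey) (All.map there (Out.ins o)))
        (All.zipWith (λ { (n , m) (here e) → m e ; (n , m) (there k) → n k }) (Out.outs o , AllP.++⁻ʳ (Out.ys o) (All-resp-↭ (Out.split o) ((λ e → p≢s (sym e)) ∷ ny))))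
        (Out.labels o))
      (trans eb (cong not (sym (trans (pin-∷ p ps (s ∷ labs is)) (trans (cong₂ _xor_ (cong₂ _xor_ s-no ev) (cong (mem ps s xor_) (pin-split ps sp (All.map p∉ ey)))) refl)))))
    go : (∃ λ d → Normal.Form Sp is d) → DOut S y (p ∷ ps) s X is
    go (_ , f@(Normal.closed {L} rest l pe q e o n)) with tailL Sp (Ch-++ c bp one) (inj₁ refl) l
    ... | b′ , c′ , near = cont rest c′ sa (nearLk Sp near pr)
          (solve 4 (λ x p l f → ((x ⊕ p) ⊕ l) ⊕ f ⊜ x ⊕ p ⊕ l ⊕ f) refl (X ∷ (p ∷ []) ∷ L ∷ (flat rest) ∷ []) ∙ ++⁺ˡ X (↭-prep p (↭-sym pe)))
          q e n (Normal.formParity Sp f)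
    go (_ , f@(Normal.two h h′ rest pe q e o n)) = cont (Normal.merge Sp h h′ ∷ rest) (Ch-++ c bp one) sa (inj₁ pr)
          (++⁺ˡ (X ++ p ∷ []) (++⁺ʳ (flat rest) (++⁺ˡ (Half.xs h) (↭-reverse (Half.xs h′))))
           ∙ solve 5 (λ x p h k f → (x ⊕ p) ⊕ (h ⊕ k) ⊕ f ⊜ x ⊕ p ⊕ h ⊕ k ⊕ f) refl (X ∷ (p ∷ []) ∷ (Half.xs h) ∷ (Half.xs h′) ∷ (flat rest) ∷ [])
           ∙ ++⁺ˡ X (↭-prep p (↭-sym pe)))
          q e n (Normal.formParity Sp f)
    go (_ , f@(Normal.half {ys} h rest pe q e o n)) = back
      (mkOut (Out.items o₂) (Out.hung o₂) (Out.clean o₂)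
        (Out.perm o₂ ∙ ++⁺ˡ ps (++⁺ʳ (flat rest) (++⁺ˡ (X ++ p ∷ []) (↭-reverse (Half.xs h))))
         ∙ solve 5 (λ q x p h f → q ⊕ ((x ⊕ p) ⊕ h) ⊕ f ⊜ (x ⊕ (p ⊕ q)) ⊕ h ⊕ f) refl (ps ∷ X ∷ (p ∷ []) ∷ (Half.xs h) ∷ (flat rest) ∷ [])
         ∙ ++⁺ˡ (X ++ p ∷ ps) (↭-sym pe))
        (↭-prep s q ∙ solve 4 (λ s a h b → s ⊕ a ⊕ h ⊕ b ⊜ a ⊕ s ⊕ h ⊕ b) refl ((s ∷ []) ∷ ys ∷ (Half.s h ∷ []) ∷ (labs rest) ∷ []) ∙ ++⁺ˡ ys (Out.split o₂)
          ∙ solve 3 (λ a b c → a ⊕ b ⊕ c ⊜ (a ⊕ b) ⊕ c) refl (ys ∷ (Out.ys o₂) ∷ (Out.zs o₂) ∷ []))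
        (AllP.++⁺ (All.map here e) (All.map there (Out.ins o₂)))
        (All.zipWith (λ { (n , m) (here e) → m e ; (n , m) (there k) → n k }) (Out.outs o₂ , AllP.++⁻ʳ (Out.ys o₂) (All-resp-↭ (Out.split o₂) ((λ e → p≢s (sym e)) ∷ n))))
        (Out.labels o₂))
      (sym (trans (cong not (trans (pin-∷ p ps (s ∷ labs is)) (cong₂ _xor_ (trans (cong₂ _xor_ s-no (Normal.formParity Sp f)) refl)
         (cong (mem ps s xor_) (pin-split ps q (All.map p∉ e)))))) (not-not _)))
      where
      is₂ : List (Item S)
      is₂ = mkItem (Ch-++ (Ch-++ c bp one) (inj₁ (~sym (Half.by h))) (Ch-reverse (Half.ch h))) sa (~sym (Half.sa h)) ∷ rest
      o₂ = scanL ps Sps ups to is₂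

  verts-++ : ∀ {S} (xs : List (Sta S)) ys → verts (xs ++ ys) ≡ verts xs ++ verts ys
  verts-++ [] ys = refl
  verts-++ (x ∷ xs) ys = cong (Sta.v x ∷_) (verts-++ xs ys)

  toks-++ : ∀ {S} (xs : List (Sta S)) ys → toks (xs ++ ys) ≡ toks xs ++ toks ys
  toks-++ [] ys = refl
  toks-++ (x ∷ xs) ys = trans (cong (Sta.ts x ++_) (toks-++ xs ys)) (sym (++-assoc (Sta.ts x) (toks xs) (toks ys)))

  []? : ∀ (xs : List V) → xs ≡ [] ⊎ xs ≢ []
  []? [] = inj₁ refl
  []? (x ∷ xs) = inj₂ (λ ())

  To-rev : ∀ {α a b c t} → α ≡ [] × a ≡ c ⊎ (∃ λ d → Ch _~_ a α d × d ~ b) → a ~ t → To (reverse α) t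
  To-rev (inj₁ (refl , _)) e = tt
  To-rev (inj₂ (d , p , _)) e = ToCh (Ch-rev ~sym p) e

  xor-f : ∀ {a b} → a ≡ false → a xor b ≡ b
  xor-f refl = refl

  -- Absorbing a token on an ear

  module EarTok {R P ts : List V} {z : V} (tok : Hung U z ts) (uP : Unique P) (RP : ∀ {v} → v ∈ R → v ∉ P)
    (is : List (Item U)) (lab0 : All (λ l → l ∈ P ⊎ l ∈ R) (labs is)) where

    Res : Set
    Res = ∃ λ (is′ : List (Item U)) → flat is′ ↭ ts ++ P ++ flat is × All (_∈ R) (labs is′)

    record Seat (α γ : List V) : Set where
      constructor seat
      field
        {a b r r′} : V
        path : Ch _~_ a (α ++ z ∷ γ) b
        ar : a ~ r
        r∈ : r ∈ R
        br : b ~ r′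
        r′∈ : r′ ∈ R
        perm : α ++ z ∷ γ ↭ P

    flip : ∀ {α γ} → Seat α γ → Seat (reverse γ) (reverse α)
    flip {α} {γ} (seat p ar r∈ br r′∈ pe) = seat (subst (λ x → Ch _~_ _ x _) (rev-mid α z γ) (Ch-rev ~sym p)) br r′∈ ar r∈
      (↭-reflexive (sym (rev-mid α z γ)) ∙ ↭-reverse (α ++ z ∷ γ) ∙ pe)

    mk : List V → List V → List (Sta U)
    mk α γ = toSta α ++ sta z tok ∷ toSta γ

    verts-mk : ∀ α γ → verts (mk α γ) ≡ α ++ z ∷ γ
    verts-mk α γ = trans (verts-++ (toSta α) _) (cong₂ _++_ (verts-toSta α) (cong (z ∷_) (verts-toSta γ)))

    toks-mk : ∀ α γ → toks (mk α γ) ≡ ts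
    toks-mk α γ = trans (toks-++ (toSta α) _) (trans (cong₂ _++_ (toks-toSta α) (cong (ts ++_) (toks-toSta γ))) (++-identityʳ ts))

    good : ∀ c α γ ls → c xor pin α ls ≡ true → Good c (mk α γ) ls
    good c [] γ ls e = inj₂ (trans (sym (xor-false c)) (trans (cong (c xor_) (sym (pin-[] ls))) e)) , Good-notoks _ (toSta γ) ls (toks-toSta γ)
    good c (p ∷ α) γ ls e = inj₁ refl , good (c xor pin (p ∷ []) ls) α γ ls
      (trans (xor-assoc c _ _) (trans (cong (c xor_) (sym (pin-∷ p α ls))) e))

    goodStart : ∀ α γ ls → α ≡ [] ⊎ pin α ls ≡ true → GoodStart (mk α γ) ls
    goodStart [] γ ls _ = Good-notoks _ (toSta γ) ls (toks-toSta γ)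
    goodStart (p ∷ α) γ ls (inj₂ e) = good (pin (p ∷ []) ls) α γ ls (trans (sym (pin-∷ p α ls)) e)

    runZ : ∀ α γ {t} → Unique (α ++ z ∷ γ) → To (α ++ z ∷ γ) t → (js : List (Item U)) → α ≡ [] ⊎ pin α (labs js) ≡ true →
           pin (α ++ z ∷ γ) (labs js) ≡ true → Run U t (α ++ z ∷ γ) (ts ++ α ++ z ∷ γ) js
    runZ α γ {t} u to js c odd! = subst (λ w → Run U t w (ts ++ α ++ z ∷ γ) js) (verts-mk α γ)
      (subst (λ w → Run U t (verts (mk α γ)) w js) (cong₂ _++_ (toks-mk α γ) (verts-mk α γ))
        (runS (mk α γ) (allU _) (subst Unique (sym (verts-mk α γ)) u) (ToEq (sym (verts-mk α γ)) to) js
          (inj₂ (trans (cong (λ w → pin w (labs js)) (verts-mk α γ)) odd!)) (goodStart α γ (labs js) c)))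

    z∷≢ : ∀ (α : List V) {γ} → α ++ z ∷ γ ≢ []
    z∷≢ [] ()
    z∷≢ (_ ∷ _) ()

    -- The two pieces are scanned outwards, each to its own end in `R`. A piece has to be odd, or
    -- empty, to end cleanly; and `z` has to be the first vertex of its piece or be reached after an
    -- odd number of labels, so that nothing hangs there.
    cutLeft : ∀ α₁ α₂ γ → Seat (α₁ ++ α₂) γ → α₁ ≡ [] ⊎ pin α₁ (labs is) ≡ true → α₂ ≡ [] ⊎ pin α₂ (labs is) ≡ true →
              pin (α₂ ++ z ∷ γ) (labs is) ≡ true → Res
    cutLeft α₁ α₂ γ (seat {a} {b} {r} {r′} path ar r∈ br r′∈ pe) c₁ c₂ odd!
      with chSplit α₁ (z∷≢ α₂) (subst (λ w → Ch _~_ a w b) (++-assoc α₁ α₂ (z ∷ γ)) path)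
    ... | c , right , left = Run.items r₂
        , (Run.perm r₂ ∙ ++⁺ˡ (ts ++ B) (Run.perm r₁) ∙ solve 4 (λ t b a f → (t ⊕ b) ⊕ a ⊕ f ⊜ t ⊕ (a ⊕ b) ⊕ f) refl (ts ∷ B ∷ (reverse α₁) ∷ (flat is) ∷ [])
           ∙ ++⁺ˡ ts (++⁺ʳ (flat is) (++⁺ʳ B (↭-reverse α₁) ∙ pP)))
        , Run.labelled r₂ (_∈ R) r′∈ (Run.labelled r₁ (λ v → v ∈ B ⊎ v ∈ R) (inj₂ r∈) (All.map classify lab0))
      where
      B = α₂ ++ z ∷ γ
      pP : α₁ ++ B ↭ P
      pP = ↭-reflexive (sym (++-assoc α₁ α₂ (z ∷ γ))) ∙ pe
      u : Unique (α₁ ++ B)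
      u = Unique-resp (↭-sym pP) uP
      r∉B : r ∉ B
      r∉B m = RP r∈ (∈-resp-↭ pP (∈-++⁺ʳ α₁ m))
      dj : ∀ {v} → v ∈ reverse α₁ → v ∉ B
      dj m = Unique-disj α₁ u (∈-resp-↭ (↭-reverse α₁) m)
      classify : ∀ {l} → l ∈ P ⊎ l ∈ R → l ∈ reverse α₁ ⊎ l ∈ B ⊎ l ∈ R
      classify (inj₂ k) = inj₂ (inj₂ k)
      classify (inj₁ k) with ∈-++⁻ α₁ (∈-resp-↭ (↭-sym pP) k)
      ... | inj₁ m = inj₁ (∈-resp-↭ (↭-sym (↭-reverse α₁)) m)
      ... | inj₂ m = inj₂ (inj₁ m)
      c₁′ : reverse α₁ ≡ [] ⊎ pin (reverse α₁) (labs is) ≡ true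
      c₁′ = [ (λ { refl → inj₁ refl }) , (λ e → inj₂ (trans (pin-perm (↭-reverse α₁) (labs is)) e)) ]′ c₁
      r₁ = run (reverse α₁) (allU _) (Unique-resp (↭-sym (↭-reverse α₁)) (Unique-++ˡ α₁ u)) (To-rev {b = c} {c = c} left ar) is c₁′
      c₂′ : α₂ ≡ [] ⊎ pin α₂ (labs (Run.items r₁)) ≡ true
      c₂′ = [ inj₁ , (λ e → inj₂ (trans (Run.pins r₁ α₂ (λ m → r∉B (∈-++⁺ˡ m)) (λ m k → dj m (∈-++⁺ˡ k))) e)) ]′ c₂
      r₂ = runZ α₂ γ (Unique-++ʳ α₁ u) (ToCh right br) (Run.items r₁) c₂′ (trans (Run.pins r₁ B r∉B dj) odd!)

    -- With everything even no cut helps. But `y` is free of labels and can be made an item of its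
    -- own, labelled by the next vertices on both sides. These two labels make both pieces odd from
    -- their first vertex on, so the token at `z` meets a strand.
    yStart : ∀ α γ₁ y γ₂ → Seat α (γ₁ ++ y ∷ γ₂) → All (_≢ y) (labs is) → pin α (labs is) ≡ false → pin (z ∷ []) (labs is) ≡ false →
             pin γ₁ (labs is) ≡ false → pin γ₂ (labs is) ≡ false → Res
    yStart α γ₁ y γ₂ (seat {a} {b} {r} {r′} path ar r∈ br r′∈ pe) y∉ eα ez e₁ e₂
      with subst (λ w → Ch _~_ a w b) (sym (++-assoc α (z ∷ γ₁) (y ∷ γ₂))) path
    ... | path′ with chInit (α ++ z ∷ γ₁) (chTo (α ++ z ∷ γ₁) path′)
    ... | inj₁ e = ⊥-elim (z∷≢ α e)
    ... | inj₂ (d , left , dy) = Run.items r₂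
        , (Run.perm r₂ ∙ ++⁺ˡ γ₂ (Run.perm r₁)
           ∙ solve 5 (λ g t l y f → g ⊕ (t ⊕ l) ⊕ y ⊕ f ⊜ t ⊕ (l ⊕ y ⊕ g) ⊕ f) refl (γ₂ ∷ ts ∷ Lf ∷ (y ∷ []) ∷ (flat is) ∷ [])
           ∙ ++⁺ˡ ts (++⁺ʳ (flat is) (++⁺ʳ (y ∷ γ₂) pLf ∙ pP)))
        , Run.labelled r₂ (_∈ R) r′∈ (Run.labelled r₁ (λ v → v ∈ γ₂ ⊎ v ∈ R) (inj₂ r∈) lab₁)
      where
      L = α ++ z ∷ γ₁
      Lf = reverse γ₁ ++ z ∷ reverse α
      tl : γ₂ ≡ [] ⊎ ∃ λ c → Ch _~_ c γ₂ b × y ~ c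
      tl = chTail (chFrom L path′)
      Lf≡ : reverse L ≡ Lf
      Lf≡ = rev-mid α z γ₁
      pLf : Lf ↭ L
      pLf = ↭-reflexive (sym Lf≡) ∙ ↭-reverse L
      pP : L ++ y ∷ γ₂ ↭ P
      pP = ↭-reflexive (++-assoc α (z ∷ γ₁) (y ∷ γ₂)) ∙ pe
      u : Unique (L ++ y ∷ γ₂)
      u = Unique-resp (↭-sym pP) uP
      dj : ∀ {v} → v ∈ Lf → v ∉ y ∷ γ₂
      dj m = Unique-disj L u (∈-resp-↭ pLf m)
      r∉ : r ∉ γ₂
      r∉ m = RP r∈ (∈-resp-↭ pP (∈-++⁺ʳ L (there m)))
      r′∉ : r′ ∉ Lf
      r′∉ m = RP r′∈ (∈-resp-↭ pP (∈-++⁺ˡ (∈-resp-↭ pLf m)))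
      uγ : Unique γ₂
      uγ = Unique-++ʳ (y ∷ []) (Unique-++ʳ L u)
      uLf : Unique Lf
      uLf = Unique-resp (↭-sym pLf) (Unique-++ˡ L u)
      l₁ = d
      l₂ = hd γ₂ r′
      d∈ : d ∈ L
      d∈ = ch-last left
      revL : Ch _~_ d Lf a
      revL = subst (λ w → Ch _~_ d w a) Lf≡ (Ch-rev ~sym left)
      yl₂ : y ~ l₂
      yl₂ with tl
      ... | inj₂ (c , p , e) = subst (y ~_) (sym (hdCh r′ p)) e
      ... | inj₁ e = subst (λ w → y ~ hd w r′) (sym e) (lastY (chFrom L path′) e)
        where
        lastY : ∀ {w} → Ch _~_ y (y ∷ w) b → w ≡ [] → y ~ r′
        lastY one refl = br
      is₀ : List (Item U)
      is₀ = mkItem one dy yl₂ ∷ is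
      l₂∉ : l₂ ∉ Lf
      l₂∉ m with []? γ₂
      ... | inj₂ n = dj m (there (hd-∈ γ₂ n))
      ... | inj₁ e = r′∉ (subst (λ w → hd w r′ ∈ Lf) e m)
      l₁∉ : l₁ ∉ γ₂
      l₁∉ m = Unique-disj L u d∈ (there m)
      pinLf : pin Lf (labs is) ≡ false
      pinLf = trans (pin-perm pLf (labs is)) (trans (pin-app α (z ∷ γ₁) (labs is)) (cong₂ _xor_ eα (trans (pin-∷ z γ₁ (labs is)) (cong₂ _xor_ ez e₁))))
      c₁ : reverse γ₁ ≡ [] ⊎ pin (reverse γ₁) (labs is₀) ≡ true
      c₁ with []? (reverse γ₁)
      ... | inj₁ e = inj₁ e
      ... | inj₂ n = inj₂ (trans (cong₂ _xor_ (mem-∈ (Unique-++ˡ (reverse γ₁) uLf) d∈rev)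
          (cong₂ _xor_ (mem-∉ (reverse γ₁) (λ m → l₂∉ (∈-++⁺ˡ m))) (trans (pin-perm (↭-reverse γ₁) (labs is)) e₁))) refl)
        where
        d∈rev : d ∈ reverse γ₁
        d∈rev = subst (_∈ reverse γ₁) (trans (sym (hd-++′ (reverse γ₁) {z ∷ reverse α} {r} {r} n)) (hdCh r revL)) (hd-∈ (reverse γ₁) {r} n)
          where
          hd-++′ : ∀ xs {ys t t′} → xs ≢ [] → hd (xs ++ ys) t ≡ hd xs t′
          hd-++′ [] n = ⊥-elim (n refl)
          hd-++′ (x ∷ xs) n = refl
      r₁ = runZ (reverse γ₁) (reverse α) uLf (ToCh revL ar) is₀ c₁
             (trans (cong₂ _xor_ (mem-∈ uLf (∈-resp-↭ (↭-sym pLf) d∈)) (cong₂ _xor_ (mem-∉ Lf l₂∉) pinLf)) refl)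
      ToR : To γ₂ r′
      ToR with tl
      ... | inj₁ e = subst (λ w → To w r′) (sym e) tt
      ... | inj₂ (c , p , _) = ToCh p br
      c₂ : γ₂ ≡ [] ⊎ pin γ₂ (labs (Run.items r₁)) ≡ true
      c₂ with []? γ₂
      ... | inj₁ e = inj₁ e
      ... | inj₂ n = inj₂ (trans (Run.pins r₁ γ₂ r∉ (λ m k → dj m (there k)))
          (trans (cong₂ _xor_ (mem-∉ γ₂ l₁∉) (cong₂ _xor_ (mem-∈ uγ (hd-∈ γ₂ n)) e₂)) refl))
      r₂ = run γ₂ (allU _) uγ ToR (Run.items r₁) c₂
      l₂-where : l₂ ∈ Lf ⊎ l₂ ∈ γ₂ ⊎ l₂ ∈ R
      l₂-where with []? γ₂
      ... | inj₂ n = inj₂ (inj₁ (hd-∈ γ₂ n))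
      ... | inj₁ e = inj₂ (inj₂ (subst (λ w → hd w r′ ∈ R) (sym e) r′∈))
      lab₁ : All (λ l → l ∈ Lf ⊎ l ∈ γ₂ ⊎ l ∈ R) (labs is₀)
      lab₁ = inj₁ (∈-resp-↭ (↭-sym pLf) d∈) ∷ l₂-where ∷ All.zipWith (λ { (inj₂ k , _) → inj₂ (inj₂ k)
        ; (inj₁ k , ne) → [ (λ m → inj₁ (∈-resp-↭ (↭-sym pLf) m)) , (λ { (here e) → ⊥-elim (ne e) ; (there m) → inj₂ (inj₁ m) }) ]′ (∈-++⁻ L (∈-resp-↭ (↭-sym pP) k)) }) (lab0 , y∉)

    xor-0 : ∀ {a b} → a xor b ≡ false → a ≡ false → b ≡ false
    xor-0 e refl = e

    -- The token at z is met by a hanging list, so the strand leaving z is not clean before y.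
    dirtyStart : ∀ α γ₁ y γ₂ → Seat α (γ₁ ++ y ∷ γ₂) → All (_≢ y) (labs is) → pin α (labs is) ≡ false → pin (z ∷ []) (labs is) ≡ true →
                 pin (γ₁ ++ y ∷ γ₂) (labs is) ≡ false → Res
    dirtyStart α γ₁ y γ₂ (seat {a} {b} {r} {r′} path ar r∈ br r′∈ pe) y∉ eα ez eγ = go (Normal.norm {U} {z} tt is₁)
      where
      γ = γ₁ ++ y ∷ γ₂
      uαzγ : Unique (α ++ z ∷ γ)
      uαzγ = Unique-resp (↭-sym pe) uP
      uα : Unique α
      uα = Unique-++ˡ α uαzγ
      α# : ∀ {v} → v ∈ α → v ∉ z ∷ γ
      α# = Unique-disj α uαzγ
      uγ : Unique γ
      uγ = Unique-++ʳ (z ∷ []) (Unique-++ʳ α uαzγ)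
      z∉γ : z ∉ γ
      z∉γ = Unique-disj (z ∷ []) (Unique-++ʳ α uαzγ) (here refl)
      Toα : To α z
      Toα with chInit α (chTo α path)
      ... | inj₁ e = subst (λ w → To w z) (sym e) tt
      ... | inj₂ (d , p , e) = ToCh p e
      pz : Ch _~_ z (z ∷ γ) b
      pz = chFrom α path
      z~γ : ∀ γ₁ → Ch _~_ z (z ∷ γ₁ ++ y ∷ γ₂) b → z ~ hd γ₁ y
      z~γ [] (l ◅ c) = subst (z ~_) (sym (hdCh y c)) l
      z~γ (x ∷ γ₁) (l ◅ c) = subst (z ~_) (sym (hdCh y c)) l
      To₁ : ∀ γ₁ {a} → Ch _~_ a (γ₁ ++ y ∷ γ₂) b → To γ₁ y
      To₁ [] c = tt
      To₁ (x ∷ []) (l ◅ c) = subst (x ~_) (sym (hdCh y c)) l , tt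
      To₁ (x ∷ x′ ∷ γ₁) (l ◅ c) = subst (x ~_) (sym (hdCh y c)) l , To₁ (x′ ∷ γ₁) c
      py : Ch _~_ y (y ∷ γ₂) b
      py = chFrom (z ∷ γ₁) pz
      toY : To (y ∷ γ₂) r′
      toY = ToCh py br
      o₁ = scanL {U} α (allU _) uα Toα is
      is₁ = Out.items o₁
      z≢y : z ≢ y
      z≢y refl = z∉γ (∈-++⁺ʳ γ₁ (here refl))
      r′∉ : r′ ∉ γ
      r′∉ m = RP r′∈ (∈-resp-↭ pe (∈-++⁺ʳ α (there m)))
      ez₁ : pin (z ∷ []) (labs is₁) ≡ true
      ez₁ = trans (pin-↭ (z ∷ []) (Out.labels o₁)) (trans (cong (λ w → pin (z ∷ []) (ex w z ++ Out.zs o₁)) eα)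
              (trans (sym (pin-split (z ∷ []) (Out.split o₁) (All.map (λ { m (here refl) → α# m (here refl) }) (Out.ins o₁)))) ez))
      eγ₁ : pin γ (labs is₁) ≡ false
      eγ₁ = trans (OutProps.pins o₁ γ z∉γ (λ m k → α# m (there k))) eγ
      A : V → Set
      A l = l ≡ z ⊎ l ∈ γ₁ ⊎ l ∈ γ₂ ⊎ l ∈ R
      lab₁ : All A (labs is₁)
      lab₁ = OutProps.labelled o₁ A (inj₁ refl) (All.zipWith (λ { (inj₂ k , _) → inj₂ (inj₂ (inj₂ (inj₂ k))) ; (inj₁ k , ne) → cl (∈-resp-↭ (↭-sym pe) k) ne }) (lab0 , y∉))
        where
        cl : ∀ {l} → l ∈ α ++ z ∷ γ → l ≢ y → l ∈ α ⊎ A l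
        cl m ne with ∈-++⁻ α m
        ... | inj₁ k = inj₁ k
        ... | inj₂ (here e) = inj₂ (inj₁ e)
        ... | inj₂ (there k) with ∈-++⁻ γ₁ k
        ... | inj₁ k′ = inj₂ (inj₂ (inj₁ k′))
        ... | inj₂ (here e) = ⊥-elim (ne e)
        ... | inj₂ (there k′) = inj₂ (inj₂ (inj₂ (inj₁ k′)))
      abs : ∀ {B : Set} {d} → Normal.Form {U} {z} tt is₁ d → d ≡ false → B
      abs f refl with trans (sym (Normal.formParity {U} {z} tt f)) ez₁
      ... | ()
      perm₁ : Out.hs o₁ ++ flat is₁ ↭ α ++ flat is
      perm₁ = Out.perm o₁
      go : (∃ λ d → Normal.Form {U} {z} tt is₁ d) → Res
      go (_ , f@(Normal.closed rest l q₁ q₂ q₃ q₄ q₅)) = abs f refl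
      go (_ , f@(Normal.two h h′ rest q₁ q₂ q₃ q₄ q₅)) = abs f refl
      -- As `z` is odd, a strand ends there. It takes the hanging list before `z` and the token
      -- after it, so it leaves from a vertex that need not be adjacent to the next one but is
      -- linked to it.
      go (_ , Normal.half {ys} h rest pf pl ey oy ny) with tailH {U} {z} tt (attach {U} {z} tt (Half.ch h) (Half.by h) (Out.hung o₁)) tok
      ... | bX , cX , nearX = fin (dirtyScan γ₁ cX (Half.sa h) (nearLk {U} {z} tt nearX (z~γ γ₁ pz)) (allU _) (Unique-++ˡ γ₁ uγ) (To₁ γ₁ (proj₁ (proj₂ pγ))) rest)
        where
        s = Half.s h
        pγ : ∃ λ c → Ch _~_ c γ b × ⊤
        pγ with chTail pz
        ... | inj₂ (c , p , _) = c , p , tt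
        ... | inj₁ e = ⊥-elim (nonempty γ₁ e)
          where
          nonempty : ∀ xs → xs ++ y ∷ γ₂ ≢ []
          nonempty [] ()
          nonempty (_ ∷ _) ()
        X = (Half.xs h ++ Out.hs o₁ ++ z ∷ []) ++ reverse ts
        Ls = s ∷ labs rest
        labL : All (λ l → l ∈ γ₁ ⊎ l ∈ γ₂ ⊎ l ∈ R) Ls
        labL = All.zipWith (λ { (inj₁ e , n) → ⊥-elim (n e) ; (inj₂ k , _) → k }) (AllP.++⁻ʳ ys (All-resp-↭ pl lab₁) , ny)
        noY : All (_≢ y) Ls
        noY = AllP.++⁻ʳ ys (All-resp-↭ pl (OutProps.labelled o₁ (_≢ y) z≢y (All.map inj₂ y∉)))
        pinL : pin γ Ls ≡ false
        pinL = trans (sym (pin-split γ pl (All.map (λ { refl → z∉γ }) ey))) eγ₁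
        pinY : pin (y ∷ []) Ls ≡ false
        pinY = Normal.notMem {U} {y} tt Ls noY
        split₁ : pin γ₁ Ls xor pin γ₂ Ls ≡ false
        split₁ = trans (cong (pin γ₁ Ls xor_) (sym (trans (pin-∷ y γ₂ Ls) (cong (_xor pin γ₂ Ls) pinY)))) (trans (sym (pin-app γ₁ (y ∷ γ₂) Ls)) pinL)
        γ₁# : ∀ {v} → v ∈ γ₁ → v ∉ y ∷ γ₂
        γ₁# = Unique-disj γ₁ uγ
        permX : X ++ flat rest ↭ ts ++ α ++ z ∷ flat is
        permX = ++⁺ʳ (flat rest) (++⁺ˡ (Half.xs h ++ Out.hs o₁ ++ z ∷ []) (↭-reverse ts))
          ∙ solve 5 (λ x h z t f → ((x ⊕ h ⊕ z) ⊕ t) ⊕ f ⊜ t ⊕ z ⊕ h ⊕ x ⊕ f) refl ((Half.xs h) ∷ (Out.hs o₁) ∷ (z ∷ []) ∷ ts ∷ (flat rest) ∷ [])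
          ∙ ++⁺ˡ ts (↭-prep z (++⁺ˡ (Out.hs o₁) (↭-sym pf) ∙ perm₁) ∙ solve 3 (λ z a f → z ⊕ a ⊕ f ⊜ a ⊕ z ⊕ f) refl ((z ∷ []) ∷ α ∷ (flat is) ∷ []))
        fin : DOut U y γ₁ s X rest → Res
        -- No label equals `y`, so the strand can simply be ended with `y`. This makes it an item
        -- whose second label is the vertex behind `y`, and turns the even rest odd.
        fin (still {X′ = X′} {ys = ys₂} is′ c′ sa′ by′ pe′ sp′ in′ out′ lb′ s∉ ev′) = Run.items r₂
          , (Run.perm r₂ ∙ ++⁺ˡ γ₂ (++⁺ʳ (flat is′) ↭-refl ∙ solve 3 (λ x y f → (x ⊕ y) ⊕ f ⊜ y ⊕ x ⊕ f) refl (X′ ∷ (y ∷ []) ∷ (flat is′) ∷ []) ∙ ↭-prep y pe′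
               ∙ solve 4 (λ y x g f → y ⊕ x ⊕ g ⊕ f ⊜ (y ⊕ g) ⊕ x ⊕ f) refl ((y ∷ []) ∷ X ∷ γ₁ ∷ (flat rest) ∷ []) ∙ ++⁺ˡ (y ∷ γ₁) permX)
             ∙ solve 7 (λ g₂ y g₁ t a z f → g₂ ⊕ (y ⊕ g₁) ⊕ t ⊕ a ⊕ z ⊕ f ⊜ t ⊕ (a ⊕ z ⊕ g₁ ⊕ y ⊕ g₂) ⊕ f) refl (γ₂ ∷ (y ∷ []) ∷ γ₁ ∷ ts ∷ α ∷ (z ∷ []) ∷ (flat is) ∷ [])
             ∙ ++⁺ˡ ts (++⁺ʳ (flat is) pe))
          , Run.labelled r₂ (_∈ R) r′∈ (lab-s ∷ l₂-where ∷ lab-is)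
          where
          l₂ = hd γ₂ r′
          is″ : List (Item U)
          is″ = mkItem (Ch-++ c′ by′ one) sa′ (proj₁ toY) ∷ is′
          lab-s : s ∈ γ₂ ⊎ s ∈ R
          lab-s with All.head labL
          ... | inj₁ k = ⊥-elim (s∉ k)
          ... | inj₂ k = k
          l₂-where : l₂ ∈ γ₂ ⊎ l₂ ∈ R
          l₂-where with []? γ₂
          ... | inj₂ n = inj₁ (hd-∈ γ₂ n)
          ... | inj₁ e = inj₂ (subst (λ w → hd w r′ ∈ R) (sym e) r′∈)
          lab-is : All (λ l → l ∈ γ₂ ⊎ l ∈ R) (labs is′)
          lab-is = All-resp-↭ (↭-sym lb′) (All.zipWith (λ { (n , inj₁ k) → ⊥-elim (n k) ; (n , inj₂ k) → k }) (out′ , AllP.++⁻ʳ ys₂ (All-resp-↭ sp′ (All.tail labL))))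
          r₂ = run γ₂ (allU _) (Unique-++ʳ (y ∷ []) (Unique-++ʳ γ₁ uγ)) (proj₂ toY) is″ odd₂
            where
            pin₁ : pin γ₁ Ls ≡ false
            pin₁ = trans (cong (_xor pin γ₁ (labs rest)) (mem-∉ γ₁ s∉)) ev′
            γ₂#γ₁ : ∀ {v} → v ∈ γ₁ → v ∉ γ₂
            γ₂#γ₁ m k = γ₁# m (there k)
            pin₂ : mem γ₂ s xor pin γ₂ (labs is′) ≡ false
            pin₂ = trans (cong (mem γ₂ s xor_) (trans (pin-↭ γ₂ lb′) (sym (pin-split γ₂ sp′ (All.map γ₂#γ₁ in′))))) (xor-0 split₁ pin₁)
            odd₂ : γ₂ ≡ [] ⊎ pin γ₂ (labs is″) ≡ true
            odd₂ with []? γ₂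
            ... | inj₁ e = inj₁ e
            ... | inj₂ n = inj₂ (trans (cong (λ w → mem γ₂ s xor (w xor pin γ₂ (labs is′))) (mem-∈ (Unique-++ʳ (y ∷ []) (Unique-++ʳ γ₁ uγ)) (hd-∈ γ₂ n)))
                (trans (sym (xor-assoc (mem γ₂ s) true _)) (trans (cong (_xor pin γ₂ (labs is′)) (xor-comm (mem γ₂ s) true)) (trans (xor-assoc true (mem γ₂ s) _) (cong not pin₂)))))
        -- The parity shift due to the strand turns the even total into an odd one, so the scan
        -- arrives at `r′` with nothing hanging.
        fin (back {b = bb} o eb) = Out.items o₂
          , (subst (λ w → w ++ flat (Out.items o₂) ↭ Out.hs o ++ (y ∷ γ₂) ++ flat (Out.items o)) (Out.clean o₂ odd₂)
               (Out.perm o₂ ∙ ↭-reflexive (cong₂ (λ w w′ → (Out.hs o ++ w ++ w′) ++ flat (Out.items o)) (toks-toSta {U} (y ∷ γ₂)) eqv) ∙ ↭-reflexive (++-assoc (Out.hs o) (y ∷ γ₂) _))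
             ∙ solve 3 (λ h g f → h ⊕ g ⊕ f ⊜ g ⊕ h ⊕ f) refl ((Out.hs o) ∷ (y ∷ γ₂) ∷ (flat (Out.items o)) ∷ []) ∙ ++⁺ˡ (y ∷ γ₂) (Out.perm o
               ∙ solve 3 (λ x g f → (x ⊕ g) ⊕ f ⊜ g ⊕ x ⊕ f) refl (X ∷ γ₁ ∷ (flat rest) ∷ []) ∙ ++⁺ˡ γ₁ permX)
             ∙ solve 6 (λ g₂ g₁ t a z f → g₂ ⊕ g₁ ⊕ t ⊕ a ⊕ z ⊕ f ⊜ t ⊕ (a ⊕ z ⊕ g₁ ⊕ g₂) ⊕ f) refl ((y ∷ γ₂) ∷ γ₁ ∷ ts ∷ α ∷ (z ∷ []) ∷ (flat is) ∷ [])
             ∙ ++⁺ˡ ts (++⁺ʳ (flat is) pe))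
          , OutProps.labelled o₂ (_∈ R) r′∈ (All.zipWith (λ { (n , inj₁ k) → ⊥-elim (n k) ; (n , inj₂ (inj₁ k)) → inj₁ (∈-subst (sym eqv) (there k)) ; (n , inj₂ (inj₂ k)) → inj₂ k })
              (Out.outs o , AllP.++⁻ʳ (Out.ys o) (All-resp-↭ (Out.split o) labL)))
          where
          eqv : verts (toSta {U} (y ∷ γ₂)) ≡ y ∷ γ₂
          eqv = verts-toSta (y ∷ γ₂)
          o₂ = scan (sta y nil) (toSta γ₂) {r′} {bb} {Out.hs o} {Out.zs o} (Out.items o) (allU _) (subst Unique (sym eqv) (Unique-++ʳ γ₁ uγ))
                 (ToEq (sym eqv) toY) (Out.hung o) (Out.clean o) (inj₂ refl) (Good-notoks _ (toSta γ₂) _ (toks-toSta γ₂)) (Out.labels o)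
          pin₂ : pin (y ∷ γ₂) (Out.zs o) ≡ pin γ₂ Ls
          pin₂ = trans (sym (pin-split (y ∷ γ₂) (Out.split o) (All.map γ₁# (Out.ins o)))) (trans (pin-∷ y γ₂ Ls) (cong (_xor pin γ₂ Ls) pinY))
          flipxor : ∀ a c → a xor c ≡ false → not a xor c ≡ true
          flipxor true true e = refl
          flipxor false false e = refl
          odd₂ : bb xor pin (verts (toSta {U} (y ∷ γ₂))) (Out.zs o) ≡ true
          odd₂ = trans (cong₂ _xor_ eb (trans (cong (λ w → pin w (Out.zs o)) eqv) pin₂)) (flipxor (pin γ₁ Ls) _ split₁)

    pinrev : ∀ xs → pin (reverse xs) (labs is) ≡ pin xs (labs is)
    pinrev xs = pin-perm (↭-reverse xs) (labs is)

    -- If one side of `z` is odd, one starts at its outer end when the total is odd, and otherwise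
    -- cuts that side off, leaving an odd piece that begins with `z`. If `z` is even and both `γ₁`
    -- and `γ₂` are odd, the cut is made just before `y`. A label-free start at `y` serves when all
    -- is even. There remains `z` odd between even sides: this is easy if `z` is an end of the ear
    -- on the left, and is the case of `dirtyStart` otherwise.
    decideʳ : ∀ α γ₁ y γ₂ → Seat α (γ₁ ++ y ∷ γ₂) → All (_≢ y) (labs is) → Res
    decideʳ α γ₁ y γ₂ st y∉ = go (pin α (labs is)) (pin (z ∷ []) (labs is)) (pin γ₁ (labs is)) (pin γ₂ (labs is)) refl refl refl refl
      where
      γ = γ₁ ++ y ∷ γ₂
      pyγ₂ : pin (y ∷ γ₂) (labs is) ≡ pin γ₂ (labs is)
      pyγ₂ = trans (pin-∷ y γ₂ (labs is)) (xor-f (Normal.notMem {U} {y} tt (labs is) y∉))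
      pγ : ∀ {c d} → pin γ₁ (labs is) ≡ c → pin γ₂ (labs is) ≡ d → pin γ (labs is) ≡ c xor d
      pγ ec ed = trans (pin-app γ₁ (y ∷ γ₂) (labs is)) (cong₂ _xor_ ec (trans pyγ₂ ed))
      three : ∀ α γ {a b c} → pin α (labs is) ≡ a → pin (z ∷ []) (labs is) ≡ b → pin γ (labs is) ≡ c → pin (α ++ z ∷ γ) (labs is) ≡ a xor (b xor c)
      three α γ ea eb ec = trans (pin-app α (z ∷ γ) (labs is)) (cong₂ _xor_ ea (trans (pin-∷ z γ (labs is)) (cong₂ _xor_ eb ec)))
      two′ : ∀ γ {b c} → pin (z ∷ []) (labs is) ≡ b → pin γ (labs is) ≡ c → pin (z ∷ γ) (labs is) ≡ b xor c
      two′ γ eb ec = trans (pin-∷ z γ (labs is)) (cong₂ _xor_ eb ec)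
      fromLeft : ∀ α γ → Seat α γ → ∀ b c → pin α (labs is) ≡ true → pin (z ∷ []) (labs is) ≡ b → pin γ (labs is) ≡ c → Res
      fromLeft α γ st true true ea eb ec = cutLeft [] α γ st (inj₁ refl) (inj₂ ea) (three α γ ea eb ec)
      fromLeft α γ st false false ea eb ec = cutLeft [] α γ st (inj₁ refl) (inj₂ ea) (three α γ ea eb ec)
      fromLeft α γ st true false ea eb ec = cutLeft α [] γ (subst (λ w → Seat w γ) (sym (++-identityʳ α)) st) (inj₂ ea) (inj₁ refl) (two′ γ eb ec)
      fromLeft α γ st false true ea eb ec = cutLeft α [] γ (subst (λ w → Seat w γ) (sym (++-identityʳ α)) st) (inj₂ ea) (inj₁ refl) (two′ γ eb ec)
      go : ∀ a e c d → pin α (labs is) ≡ a → pin (z ∷ []) (labs is) ≡ e → pin γ₁ (labs is) ≡ c → pin γ₂ (labs is) ≡ d → Res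
      go true e c d ea ee ec ed = fromLeft α γ st e (c xor d) ea ee (pγ ec ed)
      go false e true false ea ee ec ed = fromLeft (reverse γ) (reverse α) (flip st) e false (trans (pinrev γ) (pγ ec ed)) ee (trans (pinrev α) ea)
      go false e false true ea ee ec ed = fromLeft (reverse γ) (reverse α) (flip st) e false (trans (pinrev γ) (pγ ec ed)) ee (trans (pinrev α) ea)
      go false false true true ea ee ec ed =
        cutLeft (reverse (y ∷ γ₂)) (reverse γ₁) (reverse α) (subst (λ w → Seat w (reverse α)) (reverse-++ γ₁ (y ∷ γ₂)) (flip st))
          (inj₂ (trans (pinrev (y ∷ γ₂)) (trans pyγ₂ ed))) (inj₂ (trans (pinrev γ₁) ec)) (three (reverse γ₁) (reverse α) (trans (pinrev γ₁) ec) ee (trans (pinrev α) ea))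
      go false false false false ea ee ec ed = yStart α γ₁ y γ₂ st y∉ ea ee ec ed
      go false true c d ea ee ec ed with []? α | c | d
      go false true c d ea ee ec ed | inj₁ refl | true | true = cutLeft [] [] γ st (inj₁ refl) (inj₁ refl) (two′ γ ee (pγ ec ed))
      go false true c d ea ee ec ed | inj₁ refl | false | false = cutLeft [] [] γ st (inj₁ refl) (inj₁ refl) (two′ γ ee (pγ ec ed))
      go false true c d ea ee ec ed | _ | true | false = fromLeft (reverse γ) (reverse α) (flip st) true false (trans (pinrev γ) (pγ ec ed)) ee (trans (pinrev α) ea)
      go false true c d ea ee ec ed | _ | false | true = fromLeft (reverse γ) (reverse α) (flip st) true false (trans (pinrev γ) (pγ ec ed)) ee (trans (pinrev α) ea)
      go false true c d ea ee ec ed | inj₂ n | true | true = dirtyStart α γ₁ y γ₂ st y∉ ea ee (pγ ec ed)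
      go false true c d ea ee ec ed | inj₂ n | false | false = dirtyStart α γ₁ y γ₂ st y∉ ea ee (pγ ec ed)

    decide : ∀ α γ {y} → Seat α γ → y ∈ α ⊎ y ∈ γ → All (_≢ y) (labs is) → Res
    decide α γ st (inj₂ m) y∉ with ∈-∃++ m
    ... | γ₁ , γ₂ , refl = decideʳ α γ₁ _ γ₂ st y∉
    decide α γ {y} st (inj₁ m) y∉ with ∈-∃++ (∈-resp-↭ (↭-sym (↭-reverse α)) m)
    ... | γ₁ , γ₂ , e = decideʳ (reverse γ) γ₁ y γ₂ (subst (Seat (reverse γ)) e (flip st)) y∉

  -- Hamiltonian cycles around a cycle of the graph

  Cyc : List V → Set
  Cyc F = ∃ λ a → ∃ λ xs → ∃ λ b → Ch (Lk U) a xs b × Lk U b a × xs ↭ F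

  Cyc-resp : ∀ {F F′} → F ↭ F′ → Cyc F → Cyc F′
  Cyc-resp p (a , xs , b , c , l , q) = a , xs , b , c , l , (q ∙ p)

  closeUp : ∀ {z w a b} → w ~ z → b ~~ z → a ~~ z → Lk U b a
  closeUp wz (inj₁ refl) (inj₁ refl) = inj₂ (_ , tt , ~sym wz , wz)
  closeUp wz (inj₁ refl) (inj₂ a) = inj₁ (~sym a)
  closeUp wz (inj₂ b) (inj₁ refl) = inj₁ b
  closeUp wz (inj₂ b) (inj₂ a) = lift {U} tt b a

  allLoops : ∀ {z} (is : List (Item U)) → All (_≡ z) (labs is) → ∃ λ L → Loop U z L × flat is ↭ L
  allLoops {z} is al with Normal.norm {U} {z} tt is
  ... | _ , Normal.closed {L} [] l p q e o n = L , l , (p ∙ ↭-reflexive (++-identityʳ L))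
  ... | _ , Normal.closed {ys = ys} (i ∷ rest) l p q e o (ni ∷ n) = ⊥-elim (ni (All.head (AllP.++⁻ʳ ys (All-resp-↭ q al))))
  ... | _ , Normal.half {ys} h rest p q e o (nh ∷ n) = ⊥-elim (nh (All.head (AllP.++⁻ʳ ys (All-resp-↭ q al))))
  ... | _ , Normal.two {ys} h h′ rest p q e o (nh ∷ n) = ⊥-elim (nh (All.head (AllP.++⁻ʳ ys (All-resp-↭ q al))))

  -- `H₁` is traversed into `z`, then `H₂` backwards out of it, then all loops. The first and the
  -- last vertex of the result are equal or adjacent to `z`, hence linked.
  finish : ∀ {z w H₁ H₂} → w ~ z → Hung U z H₁ → Hung U z H₂ → (is : List (Item U)) → All (_≡ z) (labs is) → Cyc (H₁ ++ H₂ ++ z ∷ flat is)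
  finish {z} {w} {H₁} {H₂} wz h₁ h₂ is al with allLoops is al | start {U} {z} tt h₁
  ... | L , l , p | a , c , na with tailH {U} {z} tt c h₂
  ... | b , c₂ , nb with tailL {U} {z} tt c₂ nb l
  ... | b′ , c₃ , nb′ = a , _ , b′ , c₃ , closeUp wz nb′ na
    , (++⁺ (++⁺ˡ (H₁ ++ z ∷ []) (↭-reverse H₂)) (↭-sym p)
       ∙ solve 4 (λ a z b f → ((a ⊕ z) ⊕ b) ⊕ f ⊜ a ⊕ b ⊕ z ⊕ f) refl (H₁ ∷ (z ∷ []) ∷ H₂ ∷ (flat is) ∷ []))

  -- z is the last vertex; the list hanging at it may be added to its own token.
  oneCut : ∀ (s : Sta U) ss (z : Sta U) {w} → w ~ Sta.v z → Unique (verts (s ∷ ss)) → To (verts (s ∷ ss)) (Sta.v z) →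
           (is : List (Item U)) → Good (pin (Sta.v s ∷ []) (labs is)) ss (labs is) →
           All (λ l → l ∈ verts (s ∷ ss) ⊎ l ≡ Sta.v z) (labs is) →
           Cyc (toks (s ∷ ss ++ z ∷ []) ++ verts (s ∷ ss ++ z ∷ []) ++ flat is)
  oneCut s ss z wz u to is g al = Cyc-resp pe (finish wz (Out.hung o) (Sta.tok z) (Out.items o) (OutProps.labelled o (_≡ Sta.v z) refl al))
    where
    o = scan s ss {Sta.v z} {false} {[]} {labs is} is (allU _) u to nil (λ ()) (inj₁ refl) g ↭-refl
    pe : Out.hs o ++ Sta.ts z ++ Sta.v z ∷ flat (Out.items o) ↭ toks (s ∷ ss ++ z ∷ []) ++ verts (s ∷ ss ++ z ∷ []) ++ flat is
    pe = solve 4 (λ h t z f → h ⊕ t ⊕ z ⊕ f ⊜ t ⊕ z ⊕ h ⊕ f) refl ((Out.hs o) ∷ (Sta.ts z) ∷ (Sta.v z ∷ []) ∷ (flat (Out.items o)) ∷ [])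
      ∙ ++⁺ˡ (Sta.ts z) (++⁺ˡ (Sta.v z ∷ []) (Out.perm o))
      ∙ solve 5 (λ t z a b f → t ⊕ z ⊕ (a ⊕ b) ⊕ f ⊜ (a ⊕ t ⊕ id) ⊕ (b ⊕ z) ⊕ f) refl ((Sta.ts z) ∷ (Sta.v z ∷ []) ∷ (toks (s ∷ ss)) ∷ (verts (s ∷ ss)) ∷ (flat is) ∷ [])
      ∙ ++⁺ (↭-reflexive (sym (toks-++ (s ∷ ss) (z ∷ [])))) (++⁺ʳ (flat is) (↭-reflexive (sym (verts-++ (s ∷ ss) (z ∷ [])))))

  -- Adjacency along cyclic lists, and scans around them

  To-++⁻ : ∀ α {β t} → To (α ++ β) t → To α (hd β t) × To β t
  To-++⁻ [] to = tt , to
  To-++⁻ (x ∷ []) {[]} (e , to) = (e , tt) , tt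
  To-++⁻ (x ∷ []) {_ ∷ _} (e , to) = (e , tt) , to
  To-++⁻ (x ∷ y ∷ α) (e , to) with To-++⁻ (y ∷ α) to
  ... | p , q = (e , p) , q

  To-++⁺ : ∀ α {β t} → To α (hd β t) → To β t → To (α ++ β) t
  To-++⁺ [] p q = q
  To-++⁺ (x ∷ []) {[]} (e , _) q = e , tt
  To-++⁺ (x ∷ []) {_ ∷ _} (e , _) q = e , q
  To-++⁺ (x ∷ y ∷ α) (e , p) q = e , To-++⁺ (y ∷ α) p q

  Round : List V → Set
  Round [] = ⊥
  Round (p ∷ ps) = To (p ∷ ps) p

  rotate : ∀ α β → Round (α ++ β) → Round (β ++ α)
  rotate [] β r = subst Round (sym (++-identityʳ β)) r
  rotate (x ∷ α) [] r = subst Round (++-identityʳ (x ∷ α)) r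
  rotate (x ∷ α) (y ∷ β) r with To-++⁻ (x ∷ α) r
  ... | p , q = To-++⁺ (y ∷ β) {x ∷ α} q p

  Good-init : ∀ {S c} (ss : List (Sta S)) {z ls} → Good c (ss ++ z ∷ []) ls → Good c ss ls
  Good-init [] g = tt
  Good-init (s ∷ ss) (g , gs) = g , Good-init ss gs

  unsnoc : ∀ {A : Set} (s : A) ss → ∃ λ ss′ → ∃ λ z → s ∷ ss ≡ ss′ ++ z ∷ []
  unsnoc s [] = [] , s , refl
  unsnoc s (t ∷ ss) with unsnoc t ss
  ... | ss′ , z , e = s ∷ ss′ , z , cong (s ∷_) e

  around : ∀ (s : Sta U) s₂ ss → Unique (verts (s ∷ s₂ ∷ ss)) → Round (verts (s ∷ s₂ ∷ ss)) → (is : List (Item U)) →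
           Good (pin (Sta.v s ∷ []) (labs is)) (s₂ ∷ ss) (labs is) → All (_∈ verts (s ∷ s₂ ∷ ss)) (labs is) →
           Cyc (toks (s ∷ s₂ ∷ ss) ++ verts (s ∷ s₂ ∷ ss) ++ flat is)
  around s s₂ ss u r is g al with unsnoc s₂ ss
  ... | ss′ , z , e = subst P (sym e) aroundL u r is g al
    where
    P : List (Sta U) → Set
    P ks = Unique (verts (s ∷ ks)) → Round (verts (s ∷ ks)) → (is : List (Item U)) → Good (pin (Sta.v s ∷ []) (labs is)) ks (labs is) →
           All (_∈ verts (s ∷ ks)) (labs is) → Cyc (toks (s ∷ ks) ++ verts (s ∷ ks) ++ flat is)
    aroundL : P (ss′ ++ z ∷ [])
    aroundL u r is g al with To-++⁻ (verts (s ∷ ss′)) (ToEq (verts-++ (s ∷ ss′) (z ∷ [])) r)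
    ... | p , (zs , _) = oneCut s ss′ z (~sym zs) (Unique-++ˡ (verts (s ∷ ss′)) (subst Unique (verts-++ (s ∷ ss′) (z ∷ [])) u)) p is (Good-init ss′ g)
        (All.map (λ m → cl (∈-++⁻ (verts (s ∷ ss′)) (∈-subst (verts-++ (s ∷ ss′) (z ∷ [])) m))) al)
      where
      cl : ∀ {l} → l ∈ verts (s ∷ ss′) ⊎ l ∈ Sta.v z ∷ [] → l ∈ verts (s ∷ ss′) ⊎ l ≡ Sta.v z
      cl (inj₁ m) = inj₁ m
      cl (inj₂ (here e)) = inj₂ e

  Even : List (Item U) → V → Set
  Even is p = pin (p ∷ []) (labs is) ≡ false

  -- Evenness at every vertex excludes a single open end. Hence one strand can visit all vertices in
  -- order, taking at each the token and the loops, while two open ends are joined behind its back;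
  -- no token depends on a parity.
  evenGo : ∀ {a X} (s : Sta U) ss {t} → Ch (Lk U) a X (Sta.v s) → Unique (verts (s ∷ ss)) → To (verts (s ∷ ss)) t → (is : List (Item U)) →
           All (Even is) (verts (s ∷ ss)) → All (_∈ verts (s ∷ ss)) (labs is) →
           ∃ λ Y → ∃ λ b → Ch (Lk U) a Y b × Lk U b t × Y ↭ X ++ toks (s ∷ ss) ++ verts ss ++ flat is
  evenGo {a} {X} (sta y {ts} tok) ss {t} c (ny ∷ u) (yr , to) is (ev ∷ evs) al with tailH {U} {y} tt c tok
  ... | b , c₁ , nb = go (Normal.norm {U} {y} tt is)
    where
    Goal : List (Sta U) → Set
    Goal ss = ∃ λ Y → ∃ λ b → Ch (Lk U) a Y b × Lk U b t × Y ↭ X ++ (ts ++ toks ss) ++ verts ss ++ flat is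
    next : ∀ {X₂ b₂ ys} (rest : List (Item U)) → Ch (Lk U) a X₂ b₂ → b₂ ~~ y → X₂ ++ flat rest ↭ X ++ ts ++ flat is →
           labs is ↭ ys ++ labs rest → All (_≡ y) ys → All (_≢ y) (labs rest) →
           ∀ ss → All (y ≢_) (verts ss) → Unique (verts ss) → y ~ hd (verts ss) t → To (verts ss) t → All (Even is) (verts ss) → All (_∈ y ∷ verts ss) (labs is) → Goal ss
    next {X₂} {b₂} [] c₂ nb₂ px q e n [] ny u yr to evs al =
      X₂ , b₂ , c₂ , nearLk {U} {y} tt nb₂ yr , (↭-sym (↭-reflexive (++-identityʳ X₂)) ∙ px ∙ solve 3 (λ x t f → x ⊕ t ⊕ f ⊜ x ⊕ (t ⊕ id) ⊕ f) refl (X ∷ ts ∷ (flat is) ∷ []))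
    next {ys = ys} (i ∷ rest) c₂ nb₂ px q e (ni ∷ n) [] ny u yr to evs al with AllP.++⁻ʳ ys (All-resp-↭ q al)
    ... | here e′ ∷ _ = ⊥-elim (ni e′)
    next {X₂} {b₂} {ys} rest c₂ nb₂ px q e n (s₂ ∷ ss) ny u yr to evs al with evenGo s₂ ss (Ch-++ c₂ (nearLk {U} {y} tt nb₂ yr) one) u to rest
        (All.zipWith (λ { (ne , ev′) → trans (sym (pin-split (_ ∷ []) q (All.map (λ { refl (here e) → ne e ; refl (there ()) }) e))) ev′ }) (ny , evs))
        (All.zipWith (λ { (ne , here e) → ⊥-elim (ne e) ; (ne , there m) → m }) (n , AllP.++⁻ʳ ys (All-resp-↭ q al)))
    ... | Y , b′ , c′ , l′ , pY = Y , b′ , c′ , l′ , (pY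
        ∙ solve 5 (λ x s t v f → (x ⊕ s) ⊕ t ⊕ v ⊕ f ⊜ t ⊕ (s ⊕ v) ⊕ x ⊕ f) refl (X₂ ∷ (Sta.v s₂ ∷ []) ∷ (toks (s₂ ∷ ss)) ∷ (verts ss) ∷ (flat rest) ∷ [])
        ∙ ++⁺ˡ (toks (s₂ ∷ ss)) (++⁺ˡ (verts (s₂ ∷ ss)) px)
        ∙ solve 5 (λ x t t′ v f → t′ ⊕ v ⊕ x ⊕ t ⊕ f ⊜ x ⊕ (t ⊕ t′) ⊕ v ⊕ f) refl (X ∷ ts ∷ (toks (s₂ ∷ ss)) ∷ (verts (s₂ ∷ ss)) ∷ (flat is) ∷ []))
    go : (∃ λ d → Normal.Form {U} {y} tt is d) → Goal ss
    go (_ , f@(Normal.half h rest p q e o n)) with trans (sym ev) (Normal.formParity {U} {y} tt f)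
    ... | ()
    go (_ , Normal.closed {L} rest l p q e o n) with tailL {U} {y} tt c₁ nb l
    ... | b₂ , c₂ , nb₂ = next rest c₂ nb₂
      (++⁺ʳ (flat rest) (++⁺ʳ L (++⁺ˡ X (↭-reverse ts))) ∙ solve 4 (λ x t l f → ((x ⊕ t) ⊕ l) ⊕ f ⊜ (x ⊕ t) ⊕ l ⊕ f) refl (X ∷ ts ∷ L ∷ (flat rest) ∷ [])
        ∙ ++⁺ˡ (X ++ ts) (↭-sym p) ∙ ↭-reflexive (++-assoc X ts (flat is)))
      q e n ss ny u yr to evs al
    go (_ , Normal.two h h′ rest₀ p q e o n) = next (Normal.merge {U} {y} tt h h′ ∷ rest₀) c₁ nb
      (++⁺ (++⁺ˡ X (↭-reverse ts)) (++⁺ʳ (flat rest₀) (++⁺ˡ (Half.xs h) (↭-reverse (Half.xs h′))))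
        ∙ ++⁺ˡ (X ++ ts) (↭-reflexive (++-assoc (Half.xs h) (Half.xs h′) (flat rest₀)) ∙ ↭-sym p) ∙ ↭-reflexive (++-assoc X ts (flat is)))
      q e n ss ny u yr to evs al

  allEven : ∀ (s : Sta U) ss → Unique (verts (s ∷ ss)) → Round (verts (s ∷ ss)) → (is : List (Item U)) →
            All (Even is) (verts (s ∷ ss)) → All (_∈ verts (s ∷ ss)) (labs is) → Cyc (toks (s ∷ ss) ++ verts (s ∷ ss) ++ flat is)
  allEven s ss u r is ev al with evenGo s ss one u r is ev al
  ... | Y , b , c , l , p = Sta.v s , Y , b , c , l , (p ∙ solve 4 (λ s t v f → s ⊕ t ⊕ v ⊕ f ⊜ t ⊕ (s ⊕ v) ⊕ f) refl ((Sta.v s ∷ []) ∷ (toks (s ∷ ss)) ∷ (verts ss) ∷ (flat is) ∷ []))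

  pin-total : ∀ {A} → Unique A → (is : List (Item U)) → All (_∈ A) (labs is) → pin A (labs is) ≡ false
  pin-total u [] [] = refl
  pin-total {A} u (i ∷ is) (m ∷ k ∷ al) rewrite mem-∈ u m | mem-∈ u k = trans (not-not _) (pin-total u is al)

  -- Either there is a place where the parity turns odd, which is where a scan can be cut open, or
  -- the situation is that of `evenGo`.
  oddPrefix : ∀ c a ls → (∃ λ α → ∃ λ β → a ≡ α ++ β × c xor pin α ls ≡ true) ⊎ (c ≡ false × All (λ p → pin (p ∷ []) ls ≡ false) a)
  oddPrefix true a ls = inj₁ ([] , a , refl , cong not (pin-[] ls))
  oddPrefix false [] ls = inj₂ (refl , [])
  oddPrefix false (p ∷ a) ls with oddPrefix (pin (p ∷ []) ls) a ls
  ... | inj₁ (α , β , e , o) = inj₁ (p ∷ α , β , cong (p ∷_) e , trans (pin-∷ p α ls) o)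
  ... | inj₂ (e , al) = inj₂ (refl , e ∷ al)

  Good-plain : ∀ {S} c a (ss : List (Sta S)) ls → Good (c xor pin a ls) ss ls → Good c (toSta a ++ ss) ls
  Good-plain c [] ss ls g = subst (λ w → Good w ss ls) (trans (cong (c xor_) (pin-[] ls)) (xor-false c)) g
  Good-plain c (p ∷ a) ss ls g = inj₁ refl , Good-plain _ a ss ls (subst (λ w → Good w ss ls) (trans (cong (c xor_) (pin-∷ p a ls)) (sym (xor-assoc c _ _))) g)

  blk : Sta U → List V → List (Sta U)
  blk k a = k ∷ toSta a

  verts-blk : ∀ k a → verts (blk k a) ≡ Sta.v k ∷ a
  verts-blk k a = cong (Sta.v k ∷_) (verts-toSta a)

  verts-blk++ : ∀ k a ss → verts (blk k a ++ ss) ≡ Sta.v k ∷ a ++ verts ss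
  verts-blk++ k a ss = trans (verts-++ (blk k a) ss) (cong (_++ verts ss) (verts-blk k a))

  verts-plain++ : ∀ a (ss : List (Sta U)) → verts (toSta a ++ ss) ≡ a ++ verts ss
  verts-plain++ a ss = trans (verts-++ (toSta a) ss) (cong (_++ verts ss) (verts-toSta a))

  toks-plain++ : ∀ a (ss : List (Sta U)) → toks (toSta a ++ ss) ≡ toks ss
  toks-plain++ a ss = trans (toks-++ (toSta a) ss) (cong (_++ toks ss) (toks-toSta a))

  toks-blk++ : ∀ k a (ss : List (Sta U)) → toks (blk k a ++ ss) ≡ Sta.ts k ++ toks ss
  toks-blk++ k a ss = cong (Sta.ts k ++_) (toks-plain++ a ss)

  RoundEq : ∀ {xs ys} → xs ≡ ys → Round xs → Round ys
  RoundEq refl r = r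

  -- Three tokens on a cycle

  module Three (is : List (Item U)) where

    ls = labs is

    F : (k₁ : Sta U) (a₁ : List V) (k₂ : Sta U) (a₂ : List V) (k₃ : Sta U) (a₃ : List V) → List V
    F k₁ a₁ k₂ a₂ k₃ a₃ = Sta.ts k₁ ++ Sta.ts k₂ ++ Sta.ts k₃ ++ (Sta.v k₁ ∷ a₁) ++ (Sta.v k₂ ∷ a₂) ++ (Sta.v k₃ ∷ a₃) ++ flat is

    K : (k₁ : Sta U) (a₁ : List V) (k₂ : Sta U) (a₂ : List V) (k₃ : Sta U) (a₃ : List V) → List V
    K k₁ a₁ k₂ a₂ k₃ a₃ = (Sta.v k₁ ∷ a₁) ++ (Sta.v k₂ ∷ a₂) ++ (Sta.v k₃ ∷ a₃)

    record OK (k₁ : Sta U) (a₁ : List V) (k₂ : Sta U) (a₂ : List V) (k₃ : Sta U) (a₃ : List V) : Set where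
      constructor ok
      field
        uniq : Unique (K k₁ a₁ k₂ a₂ k₃ a₃)
        round : Round (K k₁ a₁ k₂ a₂ k₃ a₃)
        lab : All (_∈ K k₁ a₁ k₂ a₂ k₃ a₃) ls

    turn : ∀ {k₁ a₁ k₂ a₂ k₃ a₃} → OK k₁ a₁ k₂ a₂ k₃ a₃ → OK k₂ a₂ k₃ a₃ k₁ a₁
    turn {k₁} {a₁} {k₂} {a₂} {k₃} {a₃} (ok u r l) = ok (Unique-resp p u) (RoundEq (++-assoc (Sta.v k₂ ∷ a₂) _ _) (rotate (Sta.v k₁ ∷ a₁) _ r)) (All.map (∈-resp-↭ p) l)
      where
      p : K k₁ a₁ k₂ a₂ k₃ a₃ ↭ K k₂ a₂ k₃ a₃ k₁ a₁
      p = solve 3 (λ a b c → a ⊕ b ⊕ c ⊜ b ⊕ c ⊕ a) refl ((Sta.v k₁ ∷ a₁) ∷ (Sta.v k₂ ∷ a₂) ∷ (Sta.v k₃ ∷ a₃) ∷ [])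

    unturn : ∀ k₁ a₁ k₂ a₂ k₃ a₃ → Cyc (F k₂ a₂ k₃ a₃ k₁ a₁) → Cyc (F k₁ a₁ k₂ a₂ k₃ a₃)
    unturn k₁ a₁ k₂ a₂ k₃ a₃ = Cyc-resp (solve 7 (λ t₁ t₂ t₃ a b c f → t₂ ⊕ t₃ ⊕ t₁ ⊕ b ⊕ c ⊕ a ⊕ f ⊜ t₁ ⊕ t₂ ⊕ t₃ ⊕ a ⊕ b ⊕ c ⊕ f) refl ((Sta.ts k₁) ∷ (Sta.ts k₂) ∷ (Sta.ts k₃) ∷ (Sta.v k₁ ∷ a₁) ∷ (Sta.v k₂ ∷ a₂) ∷ (Sta.v k₃ ∷ a₃) ∷ (flat is) ∷ []))

    par : Sta U → List V → Bool
    par k a = pin (Sta.v k ∷ a) ls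

    parSplit : ∀ k a → par k a ≡ pin (Sta.v k ∷ []) ls xor pin a ls
    parSplit k a = pin-∷ (Sta.v k) a ls

    stations : (k₁ : Sta U) (a₁ : List V) (k₂ : Sta U) (a₂ : List V) (k₃ : Sta U) (a₃ : List V) → List (Sta U)
    stations k₁ a₁ k₂ a₂ k₃ a₃ = blk k₁ a₁ ++ blk k₂ a₂ ++ blk k₃ a₃

    verts-st : ∀ k₁ a₁ k₂ a₂ k₃ a₃ → verts (stations k₁ a₁ k₂ a₂ k₃ a₃) ≡ K k₁ a₁ k₂ a₂ k₃ a₃
    verts-st k₁ a₁ k₂ a₂ k₃ a₃ = trans (verts-blk++ k₁ a₁ _) (cong ((Sta.v k₁ ∷ a₁) ++_) (trans (verts-blk++ k₂ a₂ _) (cong ((Sta.v k₂ ∷ a₂) ++_) (verts-blk k₃ a₃))))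

    toks-st : ∀ k₁ a₁ k₂ a₂ k₃ a₃ → toks (stations k₁ a₁ k₂ a₂ k₃ a₃) ↭ Sta.ts k₁ ++ Sta.ts k₂ ++ Sta.ts k₃
    toks-st k₁ a₁ k₂ a₂ k₃ a₃ = ↭-reflexive (trans (toks-blk++ k₁ a₁ _) (cong (Sta.ts k₁ ++_) (trans (toks-blk++ k₂ a₂ _) (cong (Sta.ts k₂ ++_)
      (trans (cong (Sta.ts k₃ ++_) (toks-toSta {U} a₃)) (++-identityʳ (Sta.ts k₃)))))))

    toF : ∀ k₁ a₁ k₂ a₂ k₃ a₃ (ss : List (Sta U)) → verts ss ↭ K k₁ a₁ k₂ a₂ k₃ a₃ → toks ss ↭ Sta.ts k₁ ++ Sta.ts k₂ ++ Sta.ts k₃ →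
          Cyc (toks ss ++ verts ss ++ flat is) → Cyc (F k₁ a₁ k₂ a₂ k₃ a₃)
    toF k₁ a₁ k₂ a₂ k₃ a₃ ss pv pt = Cyc-resp (++⁺ pt (++⁺ʳ (flat is) pv) ∙
      solve 7 (λ t₁ t₂ t₃ a b c f → (t₁ ⊕ t₂ ⊕ t₃) ⊕ (a ⊕ b ⊕ c) ⊕ f ⊜ t₁ ⊕ t₂ ⊕ t₃ ⊕ a ⊕ b ⊕ c ⊕ f) refl ((Sta.ts k₁) ∷ (Sta.ts k₂) ∷ (Sta.ts k₃) ∷ (Sta.v k₁ ∷ a₁) ∷ (Sta.v k₂ ∷ a₂) ∷ (Sta.v k₃ ∷ a₃) ∷ (flat is) ∷ []))

    -- The scan starts at the first foot, where nothing hangs yet. After its odd block the parity is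
    -- odd, and after the even second block it still is, so the other two tokens meet a strand.
    atToken : ∀ {k₁ a₁ k₂ a₂ k₃ a₃} → OK k₁ a₁ k₂ a₂ k₃ a₃ → par k₁ a₁ ≡ true → par k₂ a₂ ≡ false → Cyc (F k₁ a₁ k₂ a₂ k₃ a₃)
    atToken {k₁} {a₁} {k₂} {a₂} {k₃} {a₃} (ok u r l) e₁ e₂ = go a₁ refl
      where
      vs = verts-st k₁ a₁ k₂ a₂ k₃ a₃
      good : Good (pin (Sta.v k₁ ∷ []) ls) (toSta a₁ ++ blk k₂ a₂ ++ blk k₃ a₃) ls
      good = Good-plain _ a₁ _ ls (inj₂ c₂ , Good-plain _ a₂ _ ls (inj₂ c₃ , Good-notoks _ (toSta a₃) ls (toks-toSta {U} a₃)))
        where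
        c₂ : pin (Sta.v k₁ ∷ []) ls xor pin a₁ ls ≡ true
        c₂ = trans (sym (parSplit k₁ a₁)) e₁
        c₃ : ((pin (Sta.v k₁ ∷ []) ls xor pin a₁ ls) xor pin (Sta.v k₂ ∷ []) ls) xor pin a₂ ls ≡ true
        c₃ = trans (xor-assoc (pin (Sta.v k₁ ∷ []) ls xor pin a₁ ls) (pin (Sta.v k₂ ∷ []) ls) (pin a₂ ls)) (cong₂ _xor_ c₂ (trans (sym (parSplit k₂ a₂)) e₂))
      go : ∀ a → a ≡ a₁ → Cyc (F k₁ a₁ k₂ a₂ k₃ a₃)
      go [] refl = toF k₁ [] k₂ a₂ k₃ a₃ (stations k₁ [] k₂ a₂ k₃ a₃) (↭-reflexive vs) (toks-st k₁ [] k₂ a₂ k₃ a₃)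
        (around k₁ k₂ (toSta a₂ ++ blk k₃ a₃) (subst Unique (sym vs) u) (RoundEq (sym vs) r) is good (All.map (∈-subst (sym vs)) l))
      go (p ∷ a) refl = toF k₁ (p ∷ a) k₂ a₂ k₃ a₃ (stations k₁ (p ∷ a) k₂ a₂ k₃ a₃) (↭-reflexive vs) (toks-st k₁ (p ∷ a) k₂ a₂ k₃ a₃)
        (around k₁ (sta p nil) (toSta a ++ blk k₂ a₂ ++ blk k₃ a₃) (subst Unique (sym vs) u) (RoundEq (sym vs) r) is good (All.map (∈-subst (sym vs)) l))

    -- The scan starts inside the first block, behind an odd prefix. The remainder of that block is
    -- then odd too, and the even blocks that follow preserve odd parity at all three feet, the
    -- first foot being met last.
    atArc : ∀ {k₁} α p β {k₂ a₂ k₃ a₃} → OK k₁ (α ++ p ∷ β) k₂ a₂ k₃ a₃ → par k₁ α ≡ true → par k₁ (α ++ p ∷ β) ≡ false → par k₂ a₂ ≡ false → par k₃ a₃ ≡ false →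
            Cyc (F k₁ (α ++ p ∷ β) k₂ a₂ k₃ a₃)
    atArc {k₁} α p β {k₂} {a₂} {k₃} {a₃} (ok u r l) eα e₁ e₂ e₃ =
      toF k₁ (α ++ p ∷ β) k₂ a₂ k₃ a₃ ks pv pt (fin β refl)
      where
      tail = blk k₂ a₂ ++ blk k₃ a₃ ++ blk k₁ α
      ks = toSta (p ∷ β) ++ tail
      L : List V
      L = (p ∷ β) ++ (Sta.v k₂ ∷ a₂) ++ (Sta.v k₃ ∷ a₃) ++ (Sta.v k₁ ∷ α)
      vs : verts ks ≡ L
      vs = trans (verts-plain++ (p ∷ β) tail) (cong ((p ∷ β) ++_) (trans (verts-blk++ k₂ a₂ _) (cong ((Sta.v k₂ ∷ a₂) ++_) (trans (verts-blk++ k₃ a₃ _) (cong ((Sta.v k₃ ∷ a₃) ++_) (verts-blk k₁ α))))))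
      pL : L ↭ K k₁ (α ++ p ∷ β) k₂ a₂ k₃ a₃
      pL = solve 5 (λ pb a b k α → pb ⊕ a ⊕ b ⊕ k ⊕ α ⊜ (k ⊕ α ⊕ pb) ⊕ a ⊕ b) refl ((p ∷ β) ∷ (Sta.v k₂ ∷ a₂) ∷ (Sta.v k₃ ∷ a₃) ∷ (Sta.v k₁ ∷ []) ∷ α ∷ [])
      pv : verts ks ↭ K k₁ (α ++ p ∷ β) k₂ a₂ k₃ a₃
      pv = ↭-reflexive vs ∙ pL
      pt : toks ks ↭ Sta.ts k₁ ++ Sta.ts k₂ ++ Sta.ts k₃
      pt = ↭-reflexive (trans (toks-plain++ (p ∷ β) tail) (trans (toks-blk++ k₂ a₂ _) (cong (Sta.ts k₂ ++_) (trans (toks-blk++ k₃ a₃ _) (cong (Sta.ts k₃ ++_) (cong (Sta.ts k₁ ++_) (toks-toSta {U} α)))))))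
        ∙ solve 3 (λ a b c → b ⊕ c ⊕ a ⊕ id ⊜ a ⊕ b ⊕ c) refl ((Sta.ts k₁) ∷ (Sta.ts k₂) ∷ (Sta.ts k₃) ∷ [])
      rL : Round L
      rL = RoundEq (trans (++-assoc (p ∷ β) _ _) (cong ((p ∷ β) ++_) (++-assoc (Sta.v k₂ ∷ a₂) (Sta.v k₃ ∷ a₃) (Sta.v k₁ ∷ α))))
             (rotate (Sta.v k₁ ∷ α) ((p ∷ β) ++ (Sta.v k₂ ∷ a₂) ++ (Sta.v k₃ ∷ a₃)) (RoundEq (++-assoc (Sta.v k₁ ∷ α) (p ∷ β) _) r))
      cβ : pin (p ∷ β) ls ≡ true
      cβ = flipx (trans (sym (cong (_xor pin (p ∷ β) ls) eα)) (trans (sym (pin-app (Sta.v k₁ ∷ α) (p ∷ β) ls)) e₁))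
        where
        flipx : ∀ {b} → true xor b ≡ false → b ≡ true
        flipx {true} e = refl
      good : Good (pin (p ∷ []) ls) (toSta β ++ tail) ls
      good = Good-plain _ β _ ls (inj₂ c₂ , Good-plain _ a₂ _ ls (inj₂ c₃ , Good-plain _ a₃ _ ls (inj₂ c₄ , Good-notoks _ (toSta α) ls (toks-toSta {U} α))))
        where
        x₂ = pin (p ∷ []) ls xor pin β ls
        c₂ : x₂ ≡ true
        c₂ = trans (sym (pin-∷ p β ls)) cβ
        x₃ = (x₂ xor pin (Sta.v k₂ ∷ []) ls) xor pin a₂ ls
        c₃ : x₃ ≡ true
        c₃ = trans (xor-assoc x₂ (pin (Sta.v k₂ ∷ []) ls) (pin a₂ ls)) (cong₂ _xor_ c₂ (trans (sym (parSplit k₂ a₂)) e₂))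
        c₄ : (x₃ xor pin (Sta.v k₃ ∷ []) ls) xor pin a₃ ls ≡ true
        c₄ = trans (xor-assoc x₃ (pin (Sta.v k₃ ∷ []) ls) (pin a₃ ls)) (cong₂ _xor_ c₃ (trans (sym (parSplit k₃ a₃)) e₃))
      fin : ∀ β′ → β′ ≡ β → Cyc (toks ks ++ verts ks ++ flat is)
      fin [] refl = around (sta p nil) k₂ (toSta a₂ ++ blk k₃ a₃ ++ blk k₁ α) (subst Unique (sym vs) (Unique-resp (↭-sym pL) u)) (RoundEq (sym vs) rL) is good (All.map (λ m → ∈-subst (sym vs) (∈-resp-↭ (↭-sym pL) m)) l)
      fin (q ∷ β′) refl = around (sta p nil) (sta q nil) (toSta β′ ++ tail) (subst Unique (sym vs) (Unique-resp (↭-sym pL) u)) (RoundEq (sym vs) rL) is good (All.map (λ m → ∈-subst (sym vs) (∈-resp-↭ (↭-sym pL) m)) l)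

    -- Every item contributes two labels, so the three block parities add up to zero. Hence two are
    -- odd, and cyclically one of these is followed by the even one, or all three are even.
    three : ∀ k₁ a₁ k₂ a₂ k₃ a₃ → OK k₁ a₁ k₂ a₂ k₃ a₃ → Cyc (F k₁ a₁ k₂ a₂ k₃ a₃)
    three k₁ a₁ k₂ a₂ k₃ a₃ o@(ok u r l) = go (par k₁ a₁) (par k₂ a₂) (par k₃ a₃) refl refl refl
      where
      total : par k₁ a₁ xor (par k₂ a₂ xor par k₃ a₃) ≡ false
      total = trans (cong (par k₁ a₁ xor_) (sym (pin-app (Sta.v k₂ ∷ a₂) _ ls))) (trans (sym (pin-app (Sta.v k₁ ∷ a₁) _ ls)) (pin-total u is l))
      arc : ∀ {k₁ a₁ k₂ a₂ k₃ a₃} → OK k₁ a₁ k₂ a₂ k₃ a₃ → par k₁ a₁ ≡ false → par k₂ a₂ ≡ false → par k₃ a₃ ≡ false →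
            (∃ λ α → ∃ λ β → a₁ ≡ α ++ β × pin (Sta.v k₁ ∷ []) ls xor pin α ls ≡ true) → Cyc (F k₁ a₁ k₂ a₂ k₃ a₃)
      arc {k₁} o e₁ e₂ e₃ (α , p ∷ β , refl , od) = atArc α p β o (trans (parSplit k₁ α) od) e₁ e₂ e₃
      arc {k₁} o e₁ e₂ e₃ (α , [] , refl , od) with trans (sym (subst (λ w → par k₁ w ≡ false) (++-identityʳ α) e₁)) (trans (parSplit k₁ α) od)
      ... | ()
      sum : ∀ {a b c} → par k₁ a₁ ≡ a → par k₂ a₂ ≡ b → par k₃ a₃ ≡ c → a xor (b xor c) ≡ false
      sum ea eb ec = trans (sym (cong₂ _xor_ ea (cong₂ _xor_ eb ec))) total
      go : ∀ b₁ b₂ b₃ → par k₁ a₁ ≡ b₁ → par k₂ a₂ ≡ b₂ → par k₃ a₃ ≡ b₃ → Cyc (F k₁ a₁ k₂ a₂ k₃ a₃)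
      go true false true e₁ e₂ e₃ = atToken o e₁ e₂
      go true true false e₁ e₂ e₃ = unturn k₁ a₁ k₂ a₂ k₃ a₃ (atToken (turn o) e₂ e₃)
      go false true true e₁ e₂ e₃ = unturn k₁ a₁ k₂ a₂ k₃ a₃ (unturn k₂ a₂ k₃ a₃ k₁ a₁ (atToken (turn (turn o)) e₃ e₁))
      go true true true e₁ e₂ e₃ with sum e₁ e₂ e₃
      ... | ()
      go true false false e₁ e₂ e₃ with sum e₁ e₂ e₃
      ... | ()
      go false true false e₁ e₂ e₃ with sum e₁ e₂ e₃
      ... | ()
      go false false true e₁ e₂ e₃ with sum e₁ e₂ e₃
      ... | ()
      go false false false e₁ e₂ e₃ with oddPrefix (pin (Sta.v k₁ ∷ []) ls) a₁ ls | oddPrefix (pin (Sta.v k₂ ∷ []) ls) a₂ ls | oddPrefix (pin (Sta.v k₃ ∷ []) ls) a₃ ls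
      ... | inj₁ x | _ | _ = arc o e₁ e₂ e₃ x
      ... | inj₂ _ | inj₁ x | _ = unturn k₁ a₁ k₂ a₂ k₃ a₃ (arc (turn o) e₂ e₃ e₁ x)
      ... | inj₂ _ | inj₂ _ | inj₁ x = unturn k₁ a₁ k₂ a₂ k₃ a₃ (unturn k₂ a₂ k₃ a₃ k₁ a₁ (arc (turn (turn o)) e₃ e₁ e₂ x))
      ... | inj₂ (x₁ , y₁) | inj₂ (x₂ , y₂) | inj₂ (x₃ , y₃) = toF k₁ a₁ k₂ a₂ k₃ a₃ (stations k₁ a₁ k₂ a₂ k₃ a₃) (↭-reflexive vs) (toks-st k₁ a₁ k₂ a₂ k₃ a₃)
          (allEven k₁ (toSta a₁ ++ blk k₂ a₂ ++ blk k₃ a₃) (subst Unique (sym vs) u) (RoundEq (sym vs) r) is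
            (subst (All (Even is)) (sym vs) (AllP.++⁺ (x₁ ∷ y₁) (AllP.++⁺ (x₂ ∷ y₂) (x₃ ∷ y₃)))) (All.map (∈-subst (sym vs)) l))
        where vs = verts-st k₁ a₁ k₂ a₂ k₃ a₃

  -- Four tokens and a single strand

  data Str (z p : V) : List V → Set where
    nil : z ~ p → Str z p []
    str : ∀ {a X b} → Ch (Lk U) a X b → z ~ a → Lk U b p → Str z p X

  -- The strand leaving z either reaches p, or waits next to a later vertex t.
  data St (z p : V) (A : V → Set) : List V → Set where
    stA : ∀ {X} → Str z p X → St z p A X
    stB : ∀ {a X b t hs} → Ch (Lk U) a X b → z ~ a → b ~ t → A t → Hung U p hs → St z p A (X ++ hs)

  arriveA : ∀ {z p X} → Str z p X → ∃ λ a → Ch (Lk U) a (X ++ p ∷ []) p × z ~ a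
  arriveA (nil e) = _ , one , e
  arriveA (str c za l) = _ , Ch-++ c l one , za

  arrive : ∀ {z p W} → St z p (_≡ p) W → ∃ λ a → Ch (Lk U) a (W ++ p ∷ []) p × z ~ a
  arrive (stA s) = arriveA s
  arrive {p = p} (stB {X = X} {hs = hs} c za bt refl h) = _ , subst (λ w → Ch (Lk U) _ w p) (sym (++-assoc X hs (p ∷ []))) (attach {U} {p} tt c bt h) , za

  -- A single open end at `p` carries the strand along its item to the other label, where it waits;
  -- with none or two it goes on to the next vertex, the two being joined to each other.
  depart : ∀ {z a Y b p r} (A : V → Set) → Ch (Lk U) a Y b → z ~ a → b ~~ p → p ~ r → (J : List (Item U)) → All (λ l → l ≡ p ⊎ A l) (labs J) →
           ∃ λ W → ∃ λ (J′ : List (Item U)) → St z r A W × W ++ flat J′ ↭ Y ++ flat J × All A (labs J′)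
  depart {z} {a} {Y} {b} {p} {r} A c za np pr J al = go (Normal.norm {U} {p} tt J)
    where
    rest-A : ∀ ys {zs} → labs J ↭ ys ++ zs → All (_≢ p) zs → All A zs
    rest-A ys q n = All.zipWith (λ { (inj₁ e , ne) → ⊥-elim (ne e) ; (inj₂ k , _) → k }) (AllP.++⁻ʳ ys (All-resp-↭ q al) , n)
    go : (∃ λ d → Normal.Form {U} {p} tt J d) → ∃ λ W → ∃ λ (J′ : List (Item U)) → St z r A W × W ++ flat J′ ↭ Y ++ flat J × All A (labs J′)
    go (_ , Normal.closed {L} {ys} rest l pe q e o n) with tailL {U} {p} tt c np l
    ... | b′ , c′ , n′ = _ , rest , stA (str c′ za (nearLk {U} {p} tt n′ pr)) , (↭-reflexive (++-assoc Y L (flat rest)) ∙ ++⁺ˡ Y (↭-sym pe)) , rest-A ys q n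
    go (_ , Normal.half {ys} h rest pe q e o n) with rest-A ys q n
    ... | as ∷ ar = _ , rest , stB {hs = []} (Ch-++ c (nearLk {U} {p} tt np (~sym (Half.by h))) (Ch-reverse (Half.ch h))) za (~sym (Half.sa h)) as nil
        , (solve 3 (λ y h f → ((y ⊕ h) ⊕ id) ⊕ f ⊜ y ⊕ h ⊕ f) refl (Y ∷ (reverse (Half.xs h)) ∷ (flat rest) ∷ []) ∙ ++⁺ˡ Y (++⁺ʳ (flat rest) (↭-reverse (Half.xs h)) ∙ ↭-sym pe)) , ar
    go (_ , Normal.two {ys} h h′ rest pe q e o n) = _ , Normal.merge {U} {p} tt h h′ ∷ rest , stA (str c za (nearLk {U} {p} tt np pr))
        , ++⁺ˡ Y (++⁺ʳ (flat rest) (++⁺ˡ (Half.xs h) (↭-reverse (Half.xs h′))) ∙ ↭-reflexive (++-assoc (Half.xs h) (Half.xs h′) (flat rest)) ∙ ↭-sym pe) , rest-A ys q n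

  St-map : ∀ {z p A B W} → (∀ {t} → A t → B t) → St z p A W → St z p B W
  St-map f (stA s) = stA s
  St-map f (stB c za bt at h) = stB c za bt (f at) h

  -- While the strand waits further ahead, the vertices in between are treated by `Normal.step`.
  -- Since no label lies beyond `f`, the strand is at `f` at the latest; this is how it can take the
  -- token of every foot regardless of parities.
  segScan : ∀ ps {z f W} → St z (hd ps f) (λ t → t ∈ ps ⊎ t ≡ f) W → Unique ps → f ∉ ps → To ps f → (J : List (Item U)) →
            All (λ l → l ∈ ps ⊎ l ≡ f) (labs J) →
            ∃ λ W′ → ∃ λ (J′ : List (Item U)) → St z f (_≡ f) W′ × W′ ++ flat J′ ↭ W ++ ps ++ flat J × All (_≡ f) (labs J′)
  segScan [] {f = f} s u nf to J al = _ , J , St-map emp s , ↭-refl , All.map emp al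
    where
    emp : ∀ {t} → t ∈ [] ⊎ t ≡ f → t ≡ f
    emp (inj₂ k) = k
  segScan (p ∷ ps) {z} {f} {W} s (np ∷ u) nf (pr , to) J al = visit s refl
    where
    Goal : Set
    Goal = ∃ λ W′ → ∃ λ (J′ : List (Item U)) → St z f (_≡ f) W′ × W′ ++ flat J′ ↭ W ++ (p ∷ ps) ++ flat J × All (_≡ f) (labs J′)
    cl : ∀ {l} → l ∈ p ∷ ps ⊎ l ≡ f → l ≡ p ⊎ (l ∈ ps ⊎ l ≡ f)
    cl (inj₁ (here e)) = inj₁ e
    cl (inj₁ (there m)) = inj₂ (inj₁ m)
    cl (inj₂ e) = inj₂ (inj₂ e)
    cont : ∀ {W₁ J₁} → St z (hd ps f) (λ t → t ∈ ps ⊎ t ≡ f) W₁ → W₁ ++ flat J₁ ↭ (W ++ p ∷ []) ++ flat J → All (λ l → l ∈ ps ⊎ l ≡ f) (labs J₁) → Goal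
    cont {W₁} {J₁} s₁ pe al₁ with segScan ps s₁ u (λ m → nf (there m)) to J₁ al₁
    ... | W′ , J′ , s′ , pe′ , al′ = W′ , J′ , s′ , (pe′ ∙ solve 3 (λ w q f → w ⊕ q ⊕ f ⊜ q ⊕ w ⊕ f) refl (W₁ ∷ ps ∷ (flat J₁) ∷ []) ∙ ++⁺ˡ ps pe
        ∙ solve 4 (λ q w p f → q ⊕ (w ⊕ p) ⊕ f ⊜ w ⊕ (p ⊕ q) ⊕ f) refl (ps ∷ W ∷ (p ∷ []) ∷ (flat J) ∷ [])) , al′
    at : (∃ λ a → Ch (Lk U) a (W ++ p ∷ []) p × z ~ a) → Goal
    at (a , c , za) with depart (λ t → t ∈ ps ⊎ t ≡ f) c za (inj₁ refl) pr J (All.map cl al)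
    ... | W₁ , J₁ , s₁ , pe , al₁ = cont s₁ pe al₁
    visit : ∀ {W₀} → St z p (λ t → t ∈ p ∷ ps ⊎ t ≡ f) W₀ → W₀ ≡ W → Goal
    visit (stA s) refl = at (arriveA s)
    visit (stB {X = X} {t = t} {hs} c za bt at′ h) refl with t ≟ p
    ... | yes refl = at (arrive {p = t} (stB c za bt refl h))
    ... | no ne with Normal.step {U} {p} tt pr h J
    ... | o@(mkOut {hs′} is′ h′ cln pe sp inn outs lb) = cont (stB c za bt (later (cl at′)) h′)
          (↭-reflexive (++-assoc X hs′ (flat is′)) ∙ ++⁺ˡ X pe ∙ solve 4 (λ x h p f → x ⊕ (h ⊕ p) ⊕ f ⊜ ((x ⊕ h) ⊕ p) ⊕ f) refl (X ∷ hs ∷ (p ∷ []) ∷ (flat J) ∷ []))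
          (OutProps.labelled o _ (nxt ps) (All.map (λ m → cl′ (cl m)) al))
      where
      later : t ≡ p ⊎ (t ∈ ps ⊎ t ≡ f) → t ∈ ps ⊎ t ≡ f
      later (inj₁ e) = ⊥-elim (ne e)
      later (inj₂ k) = k
      cl′ : ∀ {l} → l ≡ p ⊎ (l ∈ ps ⊎ l ≡ f) → l ∈ p ∷ [] ⊎ (l ∈ ps ⊎ l ≡ f)
      cl′ (inj₁ e) = inj₁ (here e)
      cl′ (inj₂ k) = inj₂ k
      nxt : ∀ ps → hd ps f ∈ ps ⊎ hd ps f ≡ f
      nxt [] = inj₂ refl
      nxt (_ ∷ _) = inj₁ (here refl)

  InSeg : V → List V → V → V → Set
  InSeg u a u′ l = l ≡ u ⊎ (l ∈ a ⊎ l ≡ u′)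

  -- The items left over from the previous segment have the foot as their only label, so they are
  -- loops there and are taken together with the token before the items of the new segment are
  -- touched.
  segment : ∀ {z W} (k : Sta U) a {f} → St z (Sta.v k) (_≡ Sta.v k) W → (J₀ : List (Item U)) → All (_≡ Sta.v k) (labs J₀) →
            Unique a → f ∉ a → To (Sta.v k ∷ a) f → (J : List (Item U)) → All (InSeg (Sta.v k) a f) (labs J) →
            ∃ λ W′ → ∃ λ (J′ : List (Item U)) → St z f (_≡ f) W′ ×
              W′ ++ flat J′ ↭ (W ++ flat J₀) ++ (Sta.ts k ++ Sta.v k ∷ a) ++ flat J × All (_≡ f) (labs J′)
  segment {z} {W} (sta v {ts} tok) a {f} s J₀ al₀ u nf (vr , to) J al with arrive s | allLoops J₀ al₀
  ... | a₀ , c₀ , za | L , l , pL with tailH {U} {v} tt c₀ tok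
  ... | b₁ , c₁ , n₁ with tailL {U} {v} tt c₁ n₁ l
  ... | b₂ , c₂ , n₂ with depart _ c₂ za n₂ vr J al
  ... | W₁ , J₁ , s₁ , p₁ , al₁ with segScan a s₁ u nf to J₁ al₁
  ... | W′ , J′ , s′ , p′ , al′ = W′ , J′ , s′ , (p′ ∙ solve 3 (λ w q f → w ⊕ q ⊕ f ⊜ q ⊕ w ⊕ f) refl (W₁ ∷ a ∷ (flat J₁) ∷ []) ∙ ++⁺ˡ a p₁
       ∙ ++⁺ˡ a (++⁺ʳ (flat J) (++⁺ (++⁺ˡ (W ++ v ∷ []) (↭-reverse ts)) (↭-sym pL)))
       ∙ solve 6 (λ a w v t l f → a ⊕ (((w ⊕ v) ⊕ t) ⊕ l) ⊕ f ⊜ (w ⊕ l) ⊕ (t ⊕ v ⊕ a) ⊕ f) refl (a ∷ W ∷ (v ∷ []) ∷ ts ∷ (flat J₀) ∷ (flat J) ∷ [])) , al′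

  Reached : V → V → List V → Set
  Reached z f F = ∃ λ W → ∃ λ (J : List (Item U)) → St z f (_≡ f) W × W ++ flat J ↭ F × All (_≡ f) (labs J)

  advance : ∀ {z F} (k : Sta U) a {f} → Reached z (Sta.v k) F → Unique a → f ∉ a → To (Sta.v k ∷ a) f → (J : List (Item U)) →
         All (InSeg (Sta.v k) a f) (labs J) → Reached z f (F ++ (Sta.ts k ++ Sta.v k ∷ a) ++ flat J)
  advance k a (W , J₀ , s , p , al₀) u nf to J al with segment k a s J₀ al₀ u nf to J al
  ... | W′ , J′ , s′ , p′ , al′ = W′ , J′ , s′ , (p′ ∙ ++⁺ʳ ((Sta.ts k ++ Sta.v k ∷ a) ++ flat J) p) , al′

  returned : ∀ {z ts L F} → Hung U z ts → Loop U z L → Reached z z F → Cyc (z ∷ ts ++ L ++ F)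
  returned {z} {ts} {L} tok l (W , J , s , p , al) with allLoops J al | arrive s
  ... | M , lm , pM | a , c , za with tailH {U} {z} tt c tok
  ... | _ , c′ , n′ with tailL {U} {z} tt c′ n′ (joinLL {U} {z} tt lm l)
  ... | b , c″ , n″ = a , _ , b , c″ , nearLk {U} {z} tt n″ za
      , (++⁺ (++⁺ˡ (W ++ z ∷ []) (↭-reverse ts)) (++⁺ʳ L (↭-sym pM))
        ∙ solve 5 (λ w z t m l → ((w ⊕ z) ⊕ t) ⊕ m ⊕ l ⊜ (z ⊕ t ⊕ l) ⊕ w ⊕ m) refl (W ∷ [ z ] ∷ ts ∷ flat J ∷ L ∷ [])
        ∙ ++⁺ˡ (z ∷ ts ++ L) p ∙ ↭-reflexive (cong (z ∷_) (++-assoc ts L _)))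

  -- The strand starts right behind `z`, and `z` with its token is placed when it comes back. The
  -- item ends of the first segment at `z` are therefore treated in advance: a single one provides
  -- the beginning of the strand, two are joined, and loops are kept for the return.
  worldA : ∀ (k₁ : Sta U) a₁ (k₂ : Sta U) a₂ (k₃ : Sta U) a₃ (k₄ : Sta U) a₄ (J₁ J₂ J₃ J₄ : List (Item U)) →
           let K = (Sta.v k₁ ∷ a₁) ++ (Sta.v k₂ ∷ a₂) ++ (Sta.v k₃ ∷ a₃) ++ (Sta.v k₄ ∷ a₄) in
           Unique K → Round K →
           All (InSeg (Sta.v k₁) a₁ (Sta.v k₂)) (labs J₁) → All (InSeg (Sta.v k₂) a₂ (Sta.v k₃)) (labs J₂) →
           All (InSeg (Sta.v k₃) a₃ (Sta.v k₄)) (labs J₃) → All (InSeg (Sta.v k₄) a₄ (Sta.v k₁)) (labs J₄) →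
           Cyc ((Sta.ts k₁ ++ Sta.ts k₂ ++ Sta.ts k₃ ++ Sta.ts k₄) ++ K ++ flat J₁ ++ flat J₂ ++ flat J₃ ++ flat J₄)
  worldA k₁@(sta z {ts} tok) a₁ k₂ a₂ k₃ a₃ k₄ a₄ J₁ J₂ J₃ J₄ u r l₁ l₂ l₃ l₄ = go (Normal.norm {U} {z} tt J₁)
    where
    B₂ = Sta.v k₂ ∷ a₂
    B₃ = Sta.v k₃ ∷ a₃
    B₄ = Sta.v k₄ ∷ a₄
    K = (z ∷ a₁) ++ B₂ ++ B₃ ++ B₄
    Goal : Set
    Goal = Cyc ((ts ++ Sta.ts k₂ ++ Sta.ts k₃ ++ Sta.ts k₄) ++ K ++ flat J₁ ++ flat J₂ ++ flat J₃ ++ flat J₄)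
    T₁ = To-++⁻ (z ∷ a₁) {B₂ ++ B₃ ++ B₄} {z} r
    T₂ = To-++⁻ B₂ {B₃ ++ B₄} {z} (proj₂ T₁)
    T₃ = To-++⁻ B₃ {B₄} {z} (proj₂ T₂)
    u₁ = Unique-++ʳ (z ∷ a₁) u
    u₂ = Unique-++ʳ B₂ u₁
    u₃ = Unique-++ʳ B₃ u₂
    arc : ∀ v a {X} → Unique ((v ∷ a) ++ X) → Unique a
    arc v a u = Unique-++ʳ (v ∷ []) (Unique-++ˡ (v ∷ a) u)
    out : ∀ v a {f X} → Unique ((v ∷ a) ++ f ∷ X) → f ∉ a
    out v a u m = Unique-disj (v ∷ a) u (there m) (here refl)
    z∉a₄ : z ∉ a₄
    z∉a₄ m = Unique-disj (z ∷ []) u (here refl) (∈-++⁺ʳ a₁ (∈-++⁺ʳ B₂ (∈-++⁺ʳ B₃ (there m))))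
    round : ∀ {L W} → Loop U z L → St z (hd a₁ (Sta.v k₂)) (λ t → t ∈ a₁ ⊎ t ≡ Sta.v k₂) W → (J : List (Item U)) →
            All (λ l → l ∈ a₁ ⊎ l ≡ Sta.v k₂) (labs J) → L ++ W ++ flat J ↭ flat J₁ → Goal
    round {L} {W} ℓ₀ s J al pe = Cyc-resp collect (returned tok ℓ₀
      (advance k₄ a₄ (advance k₃ a₃ (advance k₂ a₂ (segScan a₁ s (arc z a₁ u) (out z a₁ u) (proj₂ (proj₁ T₁)) J al)
        (arc _ a₂ u₁) (out _ a₂ u₁) (proj₁ T₂) J₂ l₂) (arc _ a₃ u₂) (out _ a₃ u₂) (proj₁ T₃) J₃ l₃) (Unique-++ʳ (_ ∷ []) u₃) z∉a₄ (proj₂ T₃) J₄ l₄))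
      where
      X₂ = Sta.ts k₂ ++ B₂
      X₃ = Sta.ts k₃ ++ B₃
      X₄ = Sta.ts k₄ ++ B₄
      R = flat J₂ ++ flat J₃ ++ flat J₄
      collect : z ∷ ts ++ L ++ (((W ++ a₁ ++ flat J) ++ X₂ ++ flat J₂) ++ X₃ ++ flat J₃) ++ X₄ ++ flat J₄ ↭
                (ts ++ Sta.ts k₂ ++ Sta.ts k₃ ++ Sta.ts k₄) ++ K ++ flat J₁ ++ R
      collect = ++⁺ˡ (z ∷ ts) (++⁺ˡ L (solve 7 (λ w x₂ j₂ x₃ j₃ x₄ j₄ → ((w ⊕ x₂ ⊕ j₂) ⊕ x₃ ⊕ j₃) ⊕ x₄ ⊕ j₄ ⊜ w ⊕ (x₂ ⊕ x₃ ⊕ x₄) ⊕ j₂ ⊕ j₃ ⊕ j₄) refl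
          ((W ++ a₁ ++ flat J) ∷ X₂ ∷ flat J₂ ∷ X₃ ∷ flat J₃ ∷ X₄ ∷ flat J₄ ∷ [])))
        ∙ solve 8 (λ z t l w a j x r → (z ⊕ t) ⊕ l ⊕ (w ⊕ a ⊕ j) ⊕ x ⊕ r ⊜ (l ⊕ w ⊕ j) ⊕ (t ⊕ z ⊕ a) ⊕ x ⊕ r) refl
          ([ z ] ∷ ts ∷ L ∷ W ∷ a₁ ∷ flat J ∷ (X₂ ++ X₃ ++ X₄) ∷ R ∷ [])
        ∙ ++⁺ pe ↭-refl
        ∙ solve 4 (λ j y x r → j ⊕ y ⊕ x ⊕ r ⊜ (y ⊕ x) ⊕ j ⊕ r) refl (flat J₁ ∷ (ts ++ z ∷ a₁) ∷ (X₂ ++ X₃ ++ X₄) ∷ R ∷ [])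
        ∙ ++⁺ʳ (flat J₁ ++ R) (solve 8 (λ t y t₂ b₂ t₃ b₃ t₄ b₄ → (t ⊕ y) ⊕ (t₂ ⊕ b₂) ⊕ (t₃ ⊕ b₃) ⊕ t₄ ⊕ b₄ ⊜ (t ⊕ t₂ ⊕ t₃ ⊕ t₄) ⊕ y ⊕ b₂ ⊕ b₃ ⊕ b₄) refl
          (ts ∷ (z ∷ a₁) ∷ Sta.ts k₂ ∷ B₂ ∷ Sta.ts k₃ ∷ B₃ ∷ Sta.ts k₄ ∷ B₄ ∷ []))
        ∙ ↭-reflexive (++-assoc (ts ++ Sta.ts k₂ ++ Sta.ts k₃ ++ Sta.ts k₄) K (flat J₁ ++ R))
    rest-A : ∀ ys {zs} → labs J₁ ↭ ys ++ zs → All (_≢ z) zs → All (λ l → l ∈ a₁ ⊎ l ≡ Sta.v k₂) zs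
    rest-A ys q n = All.zipWith (λ { (inj₁ e , ne) → ⊥-elim (ne e) ; (inj₂ k , _) → k }) (AllP.++⁻ʳ ys (All-resp-↭ q l₁) , n)
    zr : z ~ hd a₁ (Sta.v k₂)
    zr = subst (z ~_) refl (proj₁ (proj₁ T₁))
    go : (∃ λ d → Normal.Form {U} {z} tt J₁ d) → Goal
    go (_ , Normal.closed {L} {ys} rest l pe q e o n) = round l (stA (nil zr)) rest (rest-A ys q n) (↭-sym pe)
    go (_ , Normal.half {ys} h rest pe q e o n) with rest-A ys q n
    ... | as ∷ ar = round nil (stB {hs = []} (Ch-reverse (Half.ch h)) (~sym (Half.by h)) (~sym (Half.sa h)) as nil) rest ar
        (++⁺ʳ (flat rest) (↭-reflexive (++-identityʳ _) ∙ ↭-reverse (Half.xs h)) ∙ ↭-sym pe)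
    go (_ , Normal.two {ys} h h′ rest pe q e o n) = round nil (stA (nil zr)) (Normal.merge {U} {z} tt h h′ ∷ rest) (rest-A ys q n)
        (++⁺ʳ (flat rest) (++⁺ˡ (Half.xs h) (↭-reverse (Half.xs h′))) ∙ ↭-reflexive (++-assoc (Half.xs h) (Half.xs h′) (flat rest)) ∙ ↭-sym pe)

  -- As one foot is even, either all are, or going around some odd foot is followed by an even one.
  -- A scan starting at this odd foot meets the second and the third token with odd parity and stops
  -- at the fourth foot, which takes its token in any case. Four odd feet would offer no such start.
  four : ∀ (s₁ s₂ s₃ s₄ : Sta U) (is : List (Item U)) → let ss = s₁ ∷ s₂ ∷ s₃ ∷ s₄ ∷ [] in Unique (verts ss) → Round (verts ss) →
         All (_∈ verts ss) (labs is) → Even is (Sta.v s₁) → Cyc (toks ss ++ verts ss ++ flat is)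
  four s₁ s₂ s₃ s₄ is u r al e₁ = go (e s₂) (e s₃) (e s₄) refl refl refl
    where
    e : Sta U → Bool
    e s = pin (Sta.v s ∷ []) (labs is)
    ss = s₁ ∷ s₂ ∷ s₃ ∷ s₄ ∷ []
    Goal : Set
    Goal = Cyc (toks ss ++ verts ss ++ flat is)
    cut : ∀ s₁ s₂ s₃ s₄ → let ss = s₁ ∷ s₂ ∷ s₃ ∷ s₄ ∷ [] in Unique (verts ss) → Round (verts ss) → All (_∈ verts ss) (labs is) →
          e s₁ ≡ true → e s₂ ≡ false → Cyc (toks ss ++ verts ss ++ flat is)
    cut s₁ s₂ s₃ s₄ u (r₁ , r₂ , r₃ , r₄ , _) al e₁ e₂ =
      oneCut s₁ (s₂ ∷ s₃ ∷ []) s₄ (~sym r₄) (Unique-++ˡ (Sta.v s₁ ∷ Sta.v s₂ ∷ Sta.v s₃ ∷ []) u) (r₁ , r₂ , r₃ , tt) is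
        (inj₂ e₁ , inj₂ (cong₂ _xor_ e₁ e₂) , tt) (All.map (λ m → last (∈-++⁻ (Sta.v s₁ ∷ Sta.v s₂ ∷ Sta.v s₃ ∷ []) m)) al)
      where
      last : ∀ {l A} → l ∈ A ⊎ l ∈ Sta.v s₄ ∷ [] → l ∈ A ⊎ l ≡ Sta.v s₄
      last (inj₁ m) = inj₁ m
      last (inj₂ (here e)) = inj₂ e
    turn4 : ∀ s₁ s₂ s₃ s₄ → let ss = s₂ ∷ s₃ ∷ s₄ ∷ s₁ ∷ [] in Cyc (toks ss ++ verts ss ++ flat is) → Cyc (toks (s₁ ∷ s₂ ∷ s₃ ∷ s₄ ∷ []) ++ verts (s₁ ∷ s₂ ∷ s₃ ∷ s₄ ∷ []) ++ flat is)
    turn4 s₁ s₂ s₃ s₄ = Cyc-resp (solve 9 (λ t₁ t₂ t₃ t₄ v₁ v₂ v₃ v₄ f → (t₂ ⊕ t₃ ⊕ t₄ ⊕ t₁ ⊕ id) ⊕ (v₂ ⊕ v₃ ⊕ v₄ ⊕ v₁) ⊕ f ⊜ (t₁ ⊕ t₂ ⊕ t₃ ⊕ t₄ ⊕ id) ⊕ (v₁ ⊕ v₂ ⊕ v₃ ⊕ v₄) ⊕ f) refl ((Sta.ts s₁) ∷ (Sta.ts s₂) ∷ (Sta.ts s₃) ∷ (Sta.ts s₄) ∷ [ Sta.v s₁ ] ∷ [ Sta.v s₂ ] ∷ [ Sta.v s₃ ] ∷ [ Sta.v s₄ ] ∷ (flat is) ∷ []))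
    p₁ : ∀ a b c d → (a ∷ b ∷ c ∷ d ∷ []) ↭ (b ∷ c ∷ d ∷ a ∷ [])
    p₁ a b c d = solve 4 (λ a b c d → a ⊕ b ⊕ c ⊕ d ⊜ b ⊕ c ⊕ d ⊕ a) refl ([ a ] ∷ [ b ] ∷ [ c ] ∷ [ d ] ∷ [])
    total : e s₁ xor (e s₂ xor (e s₃ xor e s₄)) ≡ false
    total = trans (sym (trans (pin-∷ v₁ (v₂ ∷ v₃ ∷ v₄ ∷ []) (labs is)) (cong (e s₁ xor_) (trans (pin-∷ v₂ (v₃ ∷ v₄ ∷ []) (labs is)) (cong (e s₂ xor_) (pin-∷ v₃ (v₄ ∷ []) (labs is))))))) (pin-total u is al)
      where
      v₁ = Sta.v s₁
      v₂ = Sta.v s₂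
      v₃ = Sta.v s₃
      v₄ = Sta.v s₄
    u₂ = Unique-resp (p₁ _ _ _ _) u
    u₃ = Unique-resp (p₁ _ _ _ _) u₂
    u₄ = Unique-resp (p₁ _ _ _ _) u₃
    r₂ = rotate [ Sta.v s₁ ] (Sta.v s₂ ∷ Sta.v s₃ ∷ Sta.v s₄ ∷ []) r
    r₃ = rotate [ Sta.v s₂ ] (Sta.v s₃ ∷ Sta.v s₄ ∷ Sta.v s₁ ∷ []) r₂
    r₄ = rotate [ Sta.v s₃ ] (Sta.v s₄ ∷ Sta.v s₁ ∷ Sta.v s₂ ∷ []) r₃
    m₂ = All.map (∈-resp-↭ (p₁ (Sta.v s₁) (Sta.v s₂) (Sta.v s₃) (Sta.v s₄))) al
    m₃ = All.map (∈-resp-↭ (p₁ (Sta.v s₂) (Sta.v s₃) (Sta.v s₄) (Sta.v s₁))) m₂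
    m₄ = All.map (∈-resp-↭ (p₁ (Sta.v s₃) (Sta.v s₄) (Sta.v s₁) (Sta.v s₂))) m₃
    absurd : ∀ {a b c} → e s₂ ≡ a → e s₃ ≡ b → e s₄ ≡ c → a xor (b xor c) ≡ true → Goal
    absurd ea eb ec f with trans (sym f) (trans (sym (cong₂ _xor_ e₁ (cong₂ _xor_ ea (cong₂ _xor_ eb ec)))) total)
    ... | ()
    go : ∀ b₂ b₃ b₄ → e s₂ ≡ b₂ → e s₃ ≡ b₃ → e s₄ ≡ b₄ → Goal
    go false false false x y z = allEven s₁ (s₂ ∷ s₃ ∷ s₄ ∷ []) u r is (e₁ ∷ x ∷ y ∷ z ∷ []) al
    go true false b₄ x y z = turn4 s₁ s₂ s₃ s₄ (cut s₂ s₃ s₄ s₁ u₂ r₂ m₂ x y)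
    go b₂ true false x y z = turn4 s₁ s₂ s₃ s₄ (turn4 s₂ s₃ s₄ s₁ (cut s₃ s₄ s₁ s₂ u₃ r₃ m₃ y z))
    go b₂ b₃ true x y z = turn4 s₁ s₂ s₃ s₄ (turn4 s₂ s₃ s₄ s₁ (turn4 s₃ s₄ s₁ s₂ (cut s₄ s₁ s₂ s₃ u₄ r₄ m₄ z e₁)))

  lastTo : ∀ {p} ps {t} → To (p ∷ ps) t → ps ≡ [] ⊎ ∃ λ q → q ∈ ps × q ~ t
  lastTo [] to = inj₁ refl
  lastTo (q ∷ []) (_ , e , _) = inj₂ (q , here refl , e)
  lastTo (q ∷ q′ ∷ ps) (_ , to) with lastTo (q′ ∷ ps) to
  ... | inj₂ (r , m , e) = inj₂ (r , there m , e)

  ToOnto : ∀ p ps {t ys b} → To (p ∷ ps) t → Ch _~_ t ys b → Ch _~_ p ((p ∷ ps) ++ ys) b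
  ToOnto p [] (e , _) c = e ◅ c
  ToOnto p (q ∷ ps) (e , to) c = e ◅ ToOnto q ps to c

  revOnto : ∀ σ {p w ys b} → Ch _~_ p (p ∷ ys) b → To (p ∷ σ) w → Ch _~_ w (w ∷ reverse σ ++ p ∷ ys) b
  revOnto [] c (e , _) = ~sym e ◅ c
  revOnto (q ∷ σ) {p} {w} {ys} {b} c (e , to) =
    subst (λ z → Ch _~_ w (w ∷ z) b) (trans (sym (++-assoc (reverse σ) (q ∷ []) (p ∷ ys))) (cong (_++ p ∷ ys) (sym (unfold-reverse q σ)))) (revOnto σ (~sym e ◅ c) to)

  round3 : ∀ {u₁ a₁ u₂ a₂ u₃ a₃} → To (u₁ ∷ a₁) u₂ → To (u₂ ∷ a₂) u₃ → To (u₃ ∷ a₃) u₁ → Round ((u₁ ∷ a₁) ++ (u₂ ∷ a₂) ++ (u₃ ∷ a₃))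
  round3 {u₁} {a₁} {u₂} {a₂} p q r = To-++⁺ (u₁ ∷ a₁) p (To-++⁺ (u₂ ∷ a₂) q r)

  round4 : ∀ {u₁ a₁ u₂ a₂ u₃ a₃ u₄ a₄} → To (u₁ ∷ a₁) u₂ → To (u₂ ∷ a₂) u₃ → To (u₃ ∷ a₃) u₄ → To (u₄ ∷ a₄) u₁ →
           Round ((u₁ ∷ a₁) ++ (u₂ ∷ a₂) ++ (u₃ ∷ a₃) ++ (u₄ ∷ a₄))
  round4 {u₁} {a₁} {u₂} {a₂} {u₃} {a₃} p q r s = To-++⁺ (u₁ ∷ a₁) p (To-++⁺ (u₂ ∷ a₂) q (To-++⁺ (u₃ ∷ a₃) r s))

  abstract
    through : ∀ {D xs : List V} {a b} → Ch (Lk (_∈ D)) a xs b → All (_∈ D) xs → ∃ λ ys → Ch _~_ a ys b × All (_∈ D) ys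
    through one (m ∷ _) = _ , one , m ∷ []
    through (inj₁ e ◅ c) (m ∷ al) with through c al
    ... | ys , d , al′ = _ , e ◅ d , m ∷ al′
    through (inj₂ (w , w∈ , e , f) ◅ c) (m ∷ al) with through c al
    ... | ys , d , al′ = _ , e ◅ (f ◅ d) , m ∷ w∈ ∷ al′

  chGlue : ∀ {R : V → V → Set} {a b p β} α → Ch R a (α ++ p ∷ []) p → Ch R p (p ∷ β) b → Ch R a (α ++ p ∷ β) b
  chGlue [] one d = d
  chGlue [] (l ◅ ()) d
  chGlue (x ∷ []) (l ◅ c) d = l ◅ chGlue [] c d
  chGlue (x ∷ y ∷ α) (l ◅ c) d = l ◅ chGlue (y ∷ α) c d

  ChTo′ : ∀ {a p} α → Ch _~_ a (α ++ p ∷ []) p → To α p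
  ChTo′ α c with chInit α c
  ... | inj₁ refl = tt
  ... | inj₂ (d , c′ , e) = ToCh c′ e

  revTo : ∀ {p t} ps → To (p ∷ ps) t → To (t ∷ reverse ps) p
  revTo {p} {t} ps to = ChTo′ (t ∷ reverse ps) (revOnto ps one to)

  Unique-add : ∀ (xs : List V) {ys} → Unique xs → Unique ys → (∀ {v} → v ∈ ys → v ∉ xs) → Unique (xs ++ ys)
  Unique-add [] ux uy d = uy
  Unique-add (x ∷ xs) (n ∷ ux) uy d = AllP.++⁺ n (All.tabulate (λ m e → d m (here (sym e)))) ∷ Unique-add xs ux uy (λ m k → d m (there k))

  -- Ears with a saturated vertex, and coverings by items

  record Biconnection : Set where
    field
      VS : List V
      uVS : Unique VS
      conn₀ : ∀ {u w} → u ∈ VS → w ∈ VS → ∃ λ xs → Ch _~_ u xs w × All (_∈ VS) xs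
      conn : ∀ {z u w} → z ∈ VS → u ∈ VS → w ∈ VS → u ≢ z → w ≢ z →
             ∃ λ xs → Ch _~_ u xs w × All (λ v → v ∈ VS × v ≢ z) xs

  module Biconnected (biconnection : Biconnection) where

    open Biconnection biconnection

    -- No neighbour of y lies in D off the path, so later no item is labelled y: there both halves of the path may start.
    record Ear (R D : List V) : Set where
      constructor mkEar
      field
        {a b r r′ y} : V
        {P D′} : List V
        path : Ch _~_ a P b
        ar : a ~ r
        r∈ : r ∈ R
        br : b ~ r′
        r′∈ : r′ ∈ R
        y∈ : y ∈ P
        perm : P ++ D′ ↭ D
        sat : ∀ {d} → d ∈ D′ → ¬ (y ~ d)

    -- H is a component of D minus the path P, adjacent to the vertex y of P.  Replacing by a path through H the
    -- part of P strictly between two consecutive attachments of H leaves a smaller component to deal with.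
    reroute : ∀ n {R D a b r r′ y P} H O → length H ≤ n → Ch _~_ a P b → a ~ r → r ∈ R → b ~ r′ → r′ ∈ R → y ∈ P →
              P ++ H ++ O ↭ D → R ++ D ↭ VS →
              ∀ {h} → h ∈ H → (∀ {c} → c ∈ H → ∃ λ xs → Ch _~_ h xs c × All (_∈ H) xs) →
              (∀ {c s} → c ∈ H → s ∈ O → ¬ (c ~ s)) → y ~ h → ∃ λ (E : Ear R D) → Ear.y E ∈ H

    -- The dropped vertices `dr` are not attached to `H`, so a neighbour of `q` off the new path
    -- lies in what `Q` leaves of `H`. If there is one, its component is strictly smaller than `H`,
    -- because `Q` is not empty, and it is still separated from all else off the path.
    splice : ∀ n {R D a b r r′ q P′} {H O} dr Q → length H ≤ n → Ch _~_ a P′ b → a ~ r → r ∈ R → b ~ r′ → r′ ∈ R → q ∈ P′ → q ∈ Q →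
             Unique Q → All (_∈ H) Q → P′ ++ dr ++ O ++ H ↭ Q ++ D → R ++ D ↭ VS →
             (∀ {c s} → c ∈ H → s ∈ O → ¬ (c ~ s)) → All (λ v → ¬ Att v H) dr → ∃ λ (E : Ear R D) → Ear.y E ∈ H
    splice n {R} {D} {q = q} {P′} {H} {O} dr Q le pa ar r∈ br r′∈ q∈ q∈Q uQ aQ p pR sep nd with takeOut Q uQ aQ
    ... | H₂ , pH with drop-++ Q p′
      where
      drop-++ : ∀ (xs : List V) {ys zs} → xs ++ ys ↭ xs ++ zs → ys ↭ zs
      drop-++ [] e = e
      drop-++ (x ∷ xs) e = drop-++ xs (drop-∷ e)
      p′ : Q ++ (P′ ++ H₂ ++ dr ++ O) ↭ Q ++ D
      p′ = solve 5 (λ q p h d o → q ⊕ (p ⊕ h ⊕ d ⊕ o) ⊜ p ⊕ d ⊕ o ⊕ q ⊕ h) refl (Q ∷ P′ ∷ H₂ ∷ dr ∷ O ∷ [])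
           ∙ ++⁺ˡ P′ (++⁺ˡ dr (++⁺ˡ O pH)) ∙ p
    ... | pD with Any.any? (q ~?_) H₂
    ... | no ne = mkEar pa ar r∈ br r′∈ q∈ pD
          (λ m e → [ (λ k → ne (lose k e)) , [ (λ k → All.lookup nd k (lose (All.lookup aQ q∈Q) (~sym e))) , (λ k → sep (All.lookup aQ q∈Q) k e) ]′ ∘₁ ∈-++⁻ dr ]′ (∈-++⁻ H₂ m)) , All.lookup aQ q∈Q
      where
      _∘₁_ : ∀ {A B C : Set} → (B → C) → (A → B) → A → C
      (f ∘₁ g) x = f (g x)
    ... | yes an with find an
    ... | h₂ , h₂∈ , e with comp h₂∈ | n | le
    ... | cp | zero | le′ = ⊥-elim (absurd Q q∈Q (trans (↭-length pH) (ℕP.n≤0⇒n≡0 le′)))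
      where
      absurd : ∀ Q → q ∈ Q → length (Q ++ H₂) ≢ 0
      absurd (_ ∷ _) _ ()
    ... | cp | suc n′ | le′ = in-H (reroute n′ (Comp.C cp) (Comp.S′ cp ++ dr ++ O) smaller pa ar r∈ br r′∈ q∈
          (++⁺ˡ P′ (solve 4 (λ c s d o → c ⊕ s ⊕ d ⊕ o ⊜ (c ⊕ s) ⊕ d ⊕ o) refl ((Comp.C cp) ∷ (Comp.S′ cp) ∷ dr ∷ O ∷ []) ∙ ++⁺ʳ (dr ++ O) (Comp.perm cp)) ∙ pD)
          pR (Comp.h∈ cp) (λ m → All.lookup (Comp.conn cp) m) sep′ e)
      where
      in-H : (∃ λ (E : Ear R D) → Ear.y E ∈ Comp.C cp) → ∃ λ (E : Ear R D) → Ear.y E ∈ H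
      in-H (E , m) = E , ∈-resp-↭ pH (∈-++⁺ʳ Q (∈-resp-↭ (Comp.perm cp) (∈-++⁺ˡ m)))
      C⊆H : ∀ {c} → c ∈ Comp.C cp → c ∈ H
      C⊆H m = ∈-resp-↭ pH (∈-++⁺ʳ Q (∈-resp-↭ (Comp.perm cp) (∈-++⁺ˡ m)))
      sep′ : ∀ {c s} → c ∈ Comp.C cp → s ∈ Comp.S′ cp ++ dr ++ O → ¬ (c ~ s)
      sep′ m k e with ∈-++⁻ (Comp.S′ cp) k
      ... | inj₁ k′ = Comp.sep cp m k′ e
      ... | inj₂ k′ with ∈-++⁻ dr k′
      ... | inj₁ k″ = All.lookup nd k″ (lose (C⊆H m) (~sym e))
      ... | inj₂ k″ = sep (C⊆H m) k″ e
      smaller : length (Comp.C cp) ≤ n′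
      smaller = ℕP.≤-pred (ℕP.≤-trans (s≤s (ℕP.≤-trans (subst (length (Comp.C cp) ≤_) (trans (sym (length-++ (Comp.C cp))) (↭-length (Comp.perm cp))) (ℕP.m≤m+n _ _)) ℕP.≤-refl))
        (ℕP.≤-trans (grow< Q q∈Q) (subst (_≤ suc n′) (sym (↭-length pH)) le′)))
        where
        grow< : ∀ Q → q ∈ Q → suc (length H₂) ≤ length (Q ++ H₂)
        grow< (x ∷ Q) _ = s≤s (subst (length H₂ ≤_) (sym (length-++ Q)) (ℕP.m≤n+m _ _))

    connH : ∀ {H h} → (∀ {c} → c ∈ H → ∃ λ xs → Ch _~_ h xs c × All (_∈ H) xs) → ∀ {c d} → c ∈ H → d ∈ H →
            ∃ λ xs → Ch _~_ c xs d × Unique xs × All (_∈ H) xs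
    connH con m k with con m | con k
    ... | xs , c , a | ys , d , a′ with Ch-++′ (Ch-rev ~sym c) d
      where
      Ch-++′ : ∀ {u xs w ys v} → Ch _~_ u xs w → Ch _~_ w ys v → ∃ λ zs → Ch _~_ u zs v × (∀ {x} → x ∈ zs → x ∈ xs ⊎ x ∈ ys)
      Ch-++′ {ys = ys} one d = ys , d , inj₂
      Ch-++′ (l ◅ c) d with Ch-++′ c d
      ... | zs , e , f = _ , l ◅ e , λ { (here refl) → inj₁ (here refl) ; (there m) → [ (λ k → inj₁ (there k)) , inj₂ ]′ (f m) }
    ... | zs , e , f with simple e
    ... | ws , g , u , s = ws , g , u , All.map (λ m → [ (λ k → All.lookup a (∈-resp-↭ (↭-reverse xs) k)) , All.lookup a′ ]′ (f m)) s

    reroute n {R} {D} {a} {b} {r} {r′} {y} {P} H O le pa ar r∈ br r′∈ y∈ pD pR {h} h∈ con sep yh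
      with Any.any? (att? H) R
    -- If `H` is adjacent to `R`, the path can begin there: the piece in front of its first
    -- attachment is replaced.
    ... | yes an with find an
    ... | r₀ , r₀∈ , at₀ with first (att? H) P (lose y∈ (lose h∈ yh))
    ... | α , p , β , refl , nα , atp with find at₀ | find atp
    ... | q₁ , q₁∈ , e₁ | q₂ , q₂∈ , e₂ with connH con q₁∈ q₂∈
    ... | Q , cQ , uQ , aQ =
      splice n α Q le (Ch-++ cQ (~sym e₂) (chFrom α pa)) (~sym e₁) r₀∈ br r′∈ (∈-++⁺ˡ (ch-head cQ)) (ch-head cQ) uQ aQ
        (solve 5 (λ q p α o h → (q ⊕ p) ⊕ α ⊕ o ⊕ h ⊜ q ⊕ (α ⊕ p) ⊕ h ⊕ o) refl (Q ∷ (p ∷ β) ∷ α ∷ O ∷ H ∷ []) ∙ ++⁺ˡ Q pD) pR sep nα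
    reroute n {R} {D} {a} {b} {r} {r′} {y} {P} H O le pa ar r∈ br r′∈ y∈ pD pR {h} h∈ con sep yh
      | no nR with first (att? H) P (lose y∈ (lose h∈ yh))
    ... | α , p , β , refl , nα , atp with second
      where
      ∈VS : ∀ {v} → v ∈ (α ++ p ∷ β) ++ H ++ O → v ∈ VS
      ∈VS m = ∈-resp-↭ pR (∈-++⁺ʳ R (∈-resp-↭ pD m))
      P≢H : ∀ {v w} → v ∈ α ++ p ∷ β → w ∈ H → w ≢ v
      P≢H m k refl = Unique-disj (α ++ p ∷ β) (Unique-resp (↭-sym pD) (Unique-++ʳ R (Unique-resp (↭-sym pR) uVS))) m (∈-++⁺ˡ k)
      R≢y : ∀ {v} → v ∈ α ++ p ∷ β → r ≢ v
      R≢y m refl = Unique-disj R (Unique-resp (↭-sym pR) uVS) r∈ (∈-resp-↭ pD (∈-++⁺ˡ m))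
      r∉H : r ∉ H
      r∉H m = Unique-disj R (Unique-resp (↭-sym pR) uVS) r∈ (∈-resp-↭ pD (∈-++⁺ʳ (α ++ p ∷ β) (∈-++⁺ˡ m)))
      after : ∀ {v} → v ∈ α ++ p ∷ β → Att v H → v ≢ p → Any (λ v → Att v H) β
      after m at ne with ∈-++⁻ α m
      ... | inj₁ k = ⊥-elim (All.lookup nα k at)
      ... | inj₂ (here e) = ⊥-elim (ne e)
      ... | inj₂ (there k) = lose k at
      -- A second attachment on the path. If `y` is not one, it is the first attachment itself, and
      -- a way from `H` to `R` avoiding `y` must leave `H` through another vertex of the path, `R`
      -- being out of reach.
      second : Any (λ v → Att v H) β
      second with y ≟ p
      ... | no ne = after y∈ (lose h∈ yh) ne
      ... | yes refl with conn (∈VS (∈-++⁺ˡ y∈)) (∈VS (∈-++⁺ʳ (α ++ p ∷ β) (∈-++⁺ˡ h∈))) (∈-resp-↭ pR (∈-++⁺ˡ r∈)) (P≢H y∈ h∈) (R≢y y∈)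
      ... | xs , c , al with exit H c h∈ r∉H
      ... | u , w , e , u∈ , w∉ , w∈ with All.lookup al w∈
      ... | w∈VS , w≢ with ∈-++⁻ R (∈-resp-↭ (↭-sym pR) w∈VS)
      ... | inj₁ k = ⊥-elim (nR (lose k (lose u∈ (~sym e))))
      ... | inj₂ k with ∈-++⁻ (α ++ p ∷ β) (∈-resp-↭ (↭-sym pD) k)
      ... | inj₁ k′ = after k′ (lose u∈ (~sym e)) w≢
      ... | inj₂ k′ with ∈-++⁻ H k′
      ... | inj₁ k″ = ⊥-elim (w∉ k″)
      ... | inj₂ k″ = ⊥-elim (sep u∈ k″ e)
    ... | an₂ with first (att? H) β an₂
    ... | γ , p′ , δ , refl , nγ , atp′ with find atp | find atp′
    ... | q₁ , q₁∈ , e₁ | q₂ , q₂∈ , e₂ with connH con q₁∈ q₂∈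
    ... | Q , cQ , uQ , aQ =
      splice n γ Q le
        (Ch-++ (chTo α pa) e₁ (Ch-++ cQ (~sym e₂) (chFrom (α ++ p ∷ γ) (subst (λ z → Ch _~_ a z b) (sym (++-assoc α (p ∷ γ) (p′ ∷ δ))) pa))))
        ar r∈ br r′∈ (∈-++⁺ʳ (α ++ p ∷ []) (∈-++⁺ˡ (ch-head cQ))) (ch-head cQ) uQ aQ
        (solve 7 (λ α p q d γ o h → ((α ⊕ p) ⊕ q ⊕ d) ⊕ γ ⊕ o ⊕ h ⊜ q ⊕ (α ⊕ p ⊕ γ ⊕ d) ⊕ h ⊕ o) refl (α ∷ (p ∷ []) ∷ Q ∷ (p′ ∷ δ) ∷ γ ∷ O ∷ H ∷ []) ∙ ++⁺ˡ Q pD)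
        pR sep nγ

    -- A single vertex of `D` adjacent to `R`, with both ends attached to the same vertex of `R`, is
    -- enough to start from; rerouting saturates it.
    ear : ∀ {R D r d} → R ++ D ↭ VS → r ∈ R → d ∈ D → Ear R D
    ear {R} {D} {r} {d} pR r∈ d∈ with conn₀ (∈-resp-↭ pR (∈-++⁺ʳ R d∈)) (∈-resp-↭ pR (∈-++⁺ˡ r∈))
    ... | xs , c , al with exit D c d∈ (λ m → Unique-disj R (Unique-resp (↭-sym pR) uVS) r∈ m)
    ... | u , w , e , u∈ , w∉ , w∈ with ∈-++⁻ R (∈-resp-↭ (↭-sym pR) (All.lookup al w∈)) | remove u∈
    ... | inj₂ k | _ = ⊥-elim (w∉ k)
    ... | inj₁ k | D′ , p with Any.any? (u ~?_) D′
    ... | no ne = mkEar one e k e k (here refl) p (λ m e → ne (lose m e))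
    ... | yes an with find an
    ... | h , h∈ , uh = proj₁ (reroute (length (Comp.C cp)) (Comp.C cp) (Comp.S′ cp) ℕP.≤-refl one e k e k (here refl)
            (↭-prep u (Comp.perm cp) ∙ p) pR (Comp.h∈ cp) (λ m → All.lookup (Comp.conn cp) m) (Comp.sep cp) uh)
      where
      cp = comp h∈

    -- The ear is scanned towards R from a place before which the number of labels is odd (if there is one), or
    -- else from its saturated vertex y in both directions.
    coverEar : ∀ {S : V → Set} {R P a b r r′ y} → (∀ {v} → v ∈ P → S v) → Unique P → (∀ {v} → v ∈ R → v ∉ P) →
               Ch _~_ a P b → a ~ r → r ∈ R → b ~ r′ → r′ ∈ R → y ∈ P → (is : List (Item S)) → All (_≢ y) (labs is) →
               All (_∈ P ++ R) (labs is) → ∃ λ (is′ : List (Item S)) → flat is′ ↭ P ++ flat is × All (_∈ R) (labs is′)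
    coverEar {S} {R} {P} {a} {b} {r} {r′} {y} PS uP R∉P path ar r∈ br r′∈ y∈ is y∉ lb
      with ∈-∃++ y∈
    ... | α , β , refl = go (pin P (labs is)) (pin α (labs is)) refl refl
      where
      lab0 : All (λ l → l ∈ P ⊎ l ∈ R) (labs is)
      lab0 = All.map (∈-++⁻ P) lb
      y-free : pin (y ∷ []) (labs is) ≡ false
      y-free = pin-∉ _ _ (All.map ≢⇒∉ y∉)
      total : pin P (labs is) ≡ pin α (labs is) xor pin β (labs is)
      total = trans (pin-app α (y ∷ β) (labs is)) (cong (pin α (labs is) xor_)
                (trans (pin-app (y ∷ []) β (labs is)) (cong (_xor pin β (labs is)) y-free)))
      pathL : α ≡ [] ⊎ ∃ λ c → Ch _~_ a α c × c ~ y
      pathL = chInit α (chTo α path)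
      pathR : β ≡ [] ⊎ ∃ λ c → Ch _~_ c β b × y ~ c
      pathR = chTail (chFrom α path)
      b≡y : β ≡ [] → y ≡ b
      b≡y e with chFrom α path
      ... | c rewrite e with c
      ... | one = refl
      a≡y : α ≡ [] → a ≡ y
      a≡y e with chTo α path
      ... | c rewrite e with c
      ... | one = refl
      l₁ = hd (reverse α) r
      l₂ = hd β r′
      ToL : To (reverse α) r
      ToL with pathL
      ... | inj₁ e rewrite e = tt
      ... | inj₂ (c , p , _) = ToCh (Ch-rev ~sym p) ar
      ToR : To β r′
      ToR with pathR
      ... | inj₁ e rewrite e = tt
      ... | inj₂ (c , p , _) = ToCh p br
      l₁y : l₁ ~ y
      l₁y with pathL
      ... | inj₁ e = subst (λ z → hd (reverse z) r ~ y) (sym e) (subst (r ~_) (a≡y e) (~sym ar))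
      ... | inj₂ (c , p , e) = subst (_~ y) (sym (hdCh r (Ch-rev ~sym p))) e
      yl₂ : y ~ l₂
      yl₂ with pathR
      ... | inj₁ e = subst (λ z → y ~ hd z r′) (sym e) (subst (_~ r′) (sym (b≡y e)) br)
      ... | inj₂ (c , p , e) = subst (y ~_) (sym (hdCh r′ p)) e
      rev⊆ : ∀ {v} → v ∈ reverse α → v ∈ α
      rev⊆ = ∈-resp-↭ (↭-reverse α)
      α⊆ : ∀ {v} → v ∈ α → v ∈ P
      α⊆ = ∈-++⁺ˡ
      β⊆ : ∀ {v} → v ∈ y ∷ β → v ∈ P
      β⊆ = ∈-++⁺ʳ α
      αβ : ∀ {v} → v ∈ reverse α → v ∉ y ∷ β
      αβ m = Unique-disj α uP (rev⊆ m)
      uα : Unique (reverse α)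
      uα = Unique-resp (↭-sym (↭-reverse α)) (Unique-++ˡ α uP)
      uyβ : Unique (y ∷ β)
      uyβ = Unique-++ʳ α uP
      A : V → Set
      A v = v ∈ R
      Sα : All S (reverse α)
      Sα = All.tabulate (λ m → PS (α⊆ (rev⊆ m)))
      rear : ∀ Q → α ++ y ∷ β ↭ Q → Q ++ flat is ↭ P ++ flat is
      rear Q e = ++⁺ʳ (flat is) (↭-sym e)
      fin : ∀ {is₀ : List (Item S)} {Q} {xs} → ∀ (r₁ : Run S r (reverse α) (reverse α) is₀) → (r₂ : Run S r′ Q Q (Run.items r₁)) →
            flat is₀ ≡ xs ++ flat is → P ↭ Q ++ reverse α ++ xs → All (λ l → l ∈ reverse α ⊎ l ∈ Q ⊎ l ∈ R) (labs is₀) →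
            ∃ λ (is′ : List (Item S)) → flat is′ ↭ P ++ flat is × All (_∈ R) (labs is′)
      fin {is₀} {Q} {xs} r₁ r₂ f q l = Run.items r₂
        , (Run.perm r₂ ∙ ++⁺ˡ Q (Run.perm r₁) ∙ ↭-reflexive (cong (λ z → Q ++ reverse α ++ z) f)
           ∙ solve 4 (λ q a x i → q ⊕ a ⊕ x ⊕ i ⊜ (q ⊕ a ⊕ x) ⊕ i) refl (Q ∷ (reverse α) ∷ xs ∷ (flat is) ∷ []) ∙ rear _ q)
        , Run.labelled r₂ A r′∈ (Run.labelled r₁ (λ v → v ∈ Q ⊎ v ∈ R) (inj₂ r∈) l)
      xor-true : ∀ u v → false ≡ true xor v → v ≡ true
      xor-true u true e = refl
      xor-false′ : ∀ v → false ≡ false xor v → v ≡ false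
      xor-false′ false e = refl
      go : ∀ t u → pin P (labs is) ≡ t → pin α (labs is) ≡ u → ∃ λ (is′ : List (Item S)) → flat is′ ↭ P ++ flat is × All (_∈ R) (labs is′)
      go true u et eu = Run.items r₁ , (Run.perm r₁ ∙ rear P ↭-refl) , Run.labelled r₁ A r′∈ lab0
        where r₁ = run P (All.tabulate PS) uP (ToCh path br) is (inj₂ et)
      go false true et eu = fin {xs = []} r₁ r₂ refl
          (solve 2 (λ a b → a ⊕ b ⊜ b ⊕ a ⊕ id) refl (α ∷ (y ∷ β) ∷ []) ∙ ++⁺ˡ (y ∷ β) (++⁺ʳ [] (↭-sym (↭-reverse α))))
          (All.map (λ { (inj₂ k) → inj₂ (inj₂ k) ; (inj₁ k) → [ (λ m → inj₁ (∈-resp-↭ (↭-sym (↭-reverse α)) m)) , (λ m → inj₂ (inj₁ m)) ]′ (∈-++⁻ α k) }) lab0)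
        where
        r₁ = run (reverse α) Sα uα ToL is (inj₂ (trans (pin-perm (↭-reverse α) (labs is)) eu))
        ToR′ : To (y ∷ β) r′
        ToR′ = yl₂ , ToR
        odd₂ : pin (y ∷ β) (labs (Run.items r₁)) ≡ true
        odd₂ = trans (Run.pins r₁ (y ∷ β) (λ m → R∉P r∈ (β⊆ m)) αβ)
          (xor-true true _ (trans (sym et) (trans (pin-app α (y ∷ β) (labs is)) (cong (_xor pin (y ∷ β) (labs is)) eu))))
        r₂ = run (y ∷ β) (All.tabulate (λ m → PS (β⊆ m))) uyβ ToR′ (Run.items r₁) (inj₂ odd₂)
      go false false et eu = fin {xs = y ∷ []} r₁ r₂ refl
          (solve 3 (λ a y b → a ⊕ y ⊕ b ⊜ b ⊕ a ⊕ y) refl (α ∷ (y ∷ []) ∷ β ∷ []) ∙ ++⁺ˡ β (++⁺ʳ (y ∷ []) (↭-sym (↭-reverse α))))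
          lab1
        where
        is₀ : List (Item S)
        is₀ = mkItem one l₁y yl₂ ∷ is
        evenβ : pin β (labs is) ≡ false
        evenβ = xor-false′ _ (trans (sym et) (trans total (cong (_xor pin β (labs is)) eu)))
        l₂∉ : l₂ ∉ reverse α
        l₂∉ m with []? β
        ... | inj₂ n = αβ m (there (hd-∈ β n))
        ... | inj₁ e = R∉P r′∈ (α⊆ (rev⊆ (subst (λ z → hd z r′ ∈ reverse α) e m)))
        l₁∉ : l₁ ∉ β
        l₁∉ m with []? (reverse α)
        ... | inj₂ n = αβ (hd-∈ (reverse α) n) (there m)
        ... | inj₁ e = R∉P r∈ (β⊆ (there (subst (λ z → hd z r ∈ β) e m)))
        odd₁ : reverse α ≡ [] ⊎ pin (reverse α) (labs is₀) ≡ true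
        odd₁ with []? (reverse α)
        ... | inj₁ e = inj₁ e
        ... | inj₂ n = inj₂ (trans (cong₂ _xor_ (mem-∈ uα (hd-∈ (reverse α) n))
                (cong₂ _xor_ (mem-∉ (reverse α) l₂∉) (trans (pin-perm (↭-reverse α) (labs is)) eu))) refl)
        r₁ = run (reverse α) Sα uα ToL is₀ odd₁
        odd₂ : β ≡ [] ⊎ pin β (labs (Run.items r₁)) ≡ true
        odd₂ with []? β
        ... | inj₁ e = inj₁ e
        ... | inj₂ n = inj₂ (trans (Run.pins r₁ β (λ m → R∉P r∈ (β⊆ (there m))) (λ m k → αβ m (there k)))
                (trans (cong₂ _xor_ (mem-∉ β l₁∉) (cong₂ _xor_ (mem-∈ (Unique-++ʳ (y ∷ []) uyβ) (hd-∈ β n)) evenβ)) refl))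
        r₂ = run β (All.tabulate (λ m → PS (β⊆ (there m)))) (Unique-++ʳ (y ∷ []) uyβ) ToR (Run.items r₁) odd₂
        l₁-where : l₁ ∈ reverse α ⊎ l₁ ∈ β ⊎ l₁ ∈ R
        l₁-where with []? (reverse α)
        ... | inj₂ n = inj₁ (hd-∈ (reverse α) n)
        ... | inj₁ e = inj₂ (inj₂ (subst (λ z → hd z r ∈ R) (sym e) r∈))
        l₂-where : l₂ ∈ reverse α ⊎ l₂ ∈ β ⊎ l₂ ∈ R
        l₂-where with []? β
        ... | inj₂ n = inj₂ (inj₁ (hd-∈ β n))
        ... | inj₁ e = inj₂ (inj₂ (subst (λ z → hd z r′ ∈ R) (sym e) r′∈))
        lab1 : All (λ l → l ∈ reverse α ⊎ l ∈ β ⊎ l ∈ R) (labs is₀)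
        lab1 = l₁-where ∷ l₂-where ∷ All.zipWith (λ { (inj₂ k , _) → inj₂ (inj₂ k)
          ; (inj₁ k , ne) → [ (λ m → inj₁ (∈-resp-↭ (↭-sym (↭-reverse α)) m)) , (λ { (here e) → ⊥-elim (ne e) ; (there m) → inj₂ (inj₁ m) }) ]′ (∈-++⁻ α k) }) (lab0 , y∉)

    -- The vertices off the ear are covered before the ear itself, with labels on the ear or in `R`.
    -- By saturation none of these labels is `y`, as `coverEar` demands.
    partition : ∀ n {R D r} → length D ≤ n → R ++ D ↭ VS → r ∈ R →
                ∃ λ (is : List (Item (_∈ D))) → flat is ↭ D × All (_∈ R) (labs is)
    partition n {D = []} le pR r∈ = [] , ↭-refl , []
    partition (suc n) {R} {D@(_ ∷ _)} {r} le pR r∈ with ear pR r∈ (here refl)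
    ... | E with partition n {Ear.P E ++ R} {Ear.D′ E} {r} (shorter (Ear.P E) (Ear.y∈ E) (Ear.perm E))
                   (solve 3 (λ p r d → (p ⊕ r) ⊕ d ⊜ r ⊕ p ⊕ d) refl ((Ear.P E) ∷ R ∷ (Ear.D′ E) ∷ []) ∙ ++⁺ˡ R (Ear.perm E) ∙ pR)
                   (∈-++⁺ʳ (Ear.P E) r∈)
      where
      shorter : ∀ P {y D′} → y ∈ P → P ++ D′ ↭ D → length D′ ≤ n
      shorter (x ∷ P) {D′ = D′} _ p = ℕP.≤-trans (subst (length D′ ≤_) (sym (length-++ P)) (ℕP.m≤n+m _ _))
        (ℕP.≤-pred (subst (_≤ suc n) (sym (↭-length p)) le))
    ... | is , f , l with coverEar (λ m → ∈-resp-↭ (Ear.perm E) (∈-++⁺ˡ m)) uP (λ m k → Unique-disj R uRD m (∈-resp-↭ (Ear.perm E) (∈-++⁺ˡ k)))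
                            (Ear.path E) (Ear.ar E) (Ear.r∈ E) (Ear.br E) (Ear.r′∈ E) (Ear.y∈ E) (mapI up is)
                            (subst (All _) (sym (labs-mapI up is)) (All.map (λ { (d , m , e) refl → Ear.sat E (∈-resp-↭ f m) e }) (labAdj is)))
                            (subst (All _) (sym (labs-mapI up is)) l)
      where
      uRD : Unique (R ++ D)
      uRD = Unique-resp (↭-sym pR) uVS
      uP : Unique (Ear.P E)
      uP = Unique-++ˡ (Ear.P E) (Unique-resp (↭-sym (Ear.perm E)) (Unique-++ʳ R uRD))
      up : ∀ {w} → w ∈ Ear.D′ E → w ∈ D
      up m = ∈-resp-↭ (Ear.perm E) (∈-++⁺ʳ (Ear.P E) m)
    ... | is′ , f′ , l′ = is′ , (f′ ∙ ++⁺ˡ (Ear.P E) (↭-reflexive (flat-mapI up is) ∙ f) ∙ Ear.perm E) , l′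
      where
      up : ∀ {w} → w ∈ Ear.D′ E → w ∈ D
      up m = ∈-resp-↭ (Ear.perm E) (∈-++⁺ʳ (Ear.P E) m)

    -- If an ear is saturated at `x`, its neighbour `d` must lie on the ear and can take over.
    -- Either `d` is saturated as well, or rerouting from `d` yields a saturated vertex off the old
    -- path, and so different from `x`.
    earAvoid : ∀ {R D r x d} → R ++ D ↭ VS → r ∈ R → x ∈ D → d ∈ D → d ≢ x → x ~ d → ∃ λ (E : Ear R D) → Ear.y E ≢ x
    earAvoid {R} {D} {r} {x} {d} pR r∈ x∈ d∈ d≢x xd with ear pR r∈ x∈
    ... | E@(mkEar {y = y} {P} {D′} path ar r₁∈ br r₂∈ y∈ pe sat) with y ≟ x
    ... | no n = E , n
    ... | yes refl with ∈-++⁻ P (∈-resp-↭ (↭-sym pe) d∈)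
    ... | inj₂ m = ⊥-elim (sat m xd)
    ... | inj₁ d∈P with Any.any? (d ~?_) D′
    ... | no ne = mkEar path ar r₁∈ br r₂∈ d∈P pe (λ m e → ne (lose m e)) , d≢x
    ... | yes an with find an
    ... | h , h∈ , dh with reroute (length (Comp.C cp)) (Comp.C cp) (Comp.S′ cp) ℕP.≤-refl path ar r₁∈ br r₂∈ d∈P
                             (++⁺ˡ P (Comp.perm cp) ∙ pe) pR (Comp.h∈ cp) (λ m → All.lookup (Comp.conn cp) m) (Comp.sep cp) dh
      where cp = comp h∈
    ... | E′ , m = E′ , λ e → Unique-disj P (Unique-resp (↭-sym pe) (Unique-++ʳ R (Unique-resp (↭-sym pR) uVS))) y∈
            (∈-resp-↭ (Comp.perm (comp h∈)) (∈-++⁺ˡ (subst (_∈ Comp.C (comp h∈)) e m)))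

    -- The induction of `partition`, with the token dealt with as soon as `x` lies on the ear or is
    -- isolated in the rest. The ear is saturated away from `x`, so that a label-free vertex other
    -- than the token's place is available; `only` keeps the vertices of the token from creating
    -- labels other than `x`.
    partitionTok : ∀ n {R D r x d ts} → length D ≤ n → R ++ D ↭ VS → r ∈ R → x ∈ D → d ∈ D → d ≢ x → x ~ d →
                   Hung U x ts → (∀ {l t} → l ∈ VS → t ∈ ts → l ~ t → l ≡ x) →
                   ∃ λ (is : List (Item U)) → flat is ↭ ts ++ D × All (_∈ R) (labs is)
    partitionTok n {D = []} le pR r∈ ()
    partitionTok (suc n) {R} {D@(_ ∷ _)} {r} {x} {d} {ts} le pR r∈ x∈ d∈ d≢x xd tok only with earAvoid pR r∈ x∈ d∈ d≢x xd
    ... | mkEar {a} {b} {r₁} {r₂} {y} {P} {D′} path ar r₁∈ br r₂∈ y∈ pe sat , y≢x = main (∈-++⁻ P (∈-resp-↭ (↭-sym pe) x∈))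
      where
      Goal : Set
      Goal = ∃ λ (is : List (Item U)) → flat is ↭ ts ++ D × All (_∈ R) (labs is)
      uRD : Unique (R ++ D)
      uRD = Unique-resp (↭-sym pR) uVS
      uPD : Unique (P ++ D′)
      uPD = Unique-resp (↭-sym pe) (Unique-++ʳ R uRD)
      uP : Unique P
      uP = Unique-++ˡ P uPD
      RP : ∀ {v} → v ∈ R → v ∉ P
      RP m k = Unique-disj R uRD m (∈-resp-↭ pe (∈-++⁺ˡ k))
      ∈VS : ∀ {v} → v ∈ D → v ∈ VS
      ∈VS m = ∈-resp-↭ pR (∈-++⁺ʳ R m)
      P⊆D : ∀ {v} → v ∈ P → v ∈ D
      P⊆D m = ∈-resp-↭ pe (∈-++⁺ˡ m)
      shorter : ∀ P {y D′} → y ∈ P → P ++ D′ ↭ D → length D′ ≤ n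
      shorter (x ∷ P) {D′ = D′} _ p = ℕP.≤-trans (subst (length D′ ≤_) (sym (length-++ P)) (ℕP.m≤n+m _ _))
        (ℕP.≤-pred (subst (_≤ suc n) (sym (↭-length p)) le))
      pR′ : (P ++ R) ++ D′ ↭ VS
      pR′ = solve 3 (λ p r d → (p ⊕ r) ⊕ d ⊜ r ⊕ p ⊕ d) refl (P ∷ R ∷ D′ ∷ []) ∙ ++⁺ˡ R pe ∙ pR
      toU : ∀ {E} → List (Item (_∈ E)) → List (Item U)
      toU = mapI (λ _ → tt)
      onEar : ∀ {z us E} → Hung U z us → z ∈ P → y ≢ z → (is : List (Item U)) → flat is ↭ E → All (_≢ y) (labs is) →
              All (λ l → l ∈ P ⊎ l ∈ R) (labs is) → us ++ P ++ E ↭ ts ++ D → Goal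
      onEar {z} {us} tk z∈ y≢z is f y∉ lb p with ∈-∃++ z∈
      ... | α , γ , refl with EarTok.decide tk uP RP is lb α γ (EarTok.seat path ar r₁∈ br r₂∈ ↭-refl) (side (∈-++⁻ α y∈)) y∉
        where
        side : y ∈ α ⊎ y ∈ z ∷ γ → y ∈ α ⊎ y ∈ γ
        side (inj₁ m) = inj₁ m
        side (inj₂ (here e)) = ⊥-elim (y≢z e)
        side (inj₂ (there m)) = inj₂ m
      ... | is′ , f′ , l′ = is′ , (f′ ∙ ++⁺ˡ us (++⁺ˡ (α ++ z ∷ γ) f) ∙ p) , l′
      main : x ∈ P ⊎ x ∈ D′ → Goal
      main (inj₁ x∈P) with partition (length D′) {P ++ R} {D′} {r} ℕP.≤-refl pR′ (∈-++⁺ʳ P r∈)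
      ... | is , f , l = onEar tok x∈P y≢x (toU is) (↭-reflexive (flat-mapI _ is) ∙ f)
            (subst (All _) (sym (labs-mapI _ is)) (All.map (λ { (d , m , e) refl → sat (∈-resp-↭ f m) e }) (labAdj is)))
            (subst (All _) (sym (labs-mapI _ is)) (All.map (∈-++⁻ P) l)) (++⁺ˡ ts pe)
      main (inj₂ x∈D′) with remove x∈D′
      ... | D″ , pD″ with Any.any? (x ~?_) D″
      ... | yes an with find an
      ... | d′ , d′∈ , e with partitionTok n {P ++ R} {D′} {r} {x} {d′} {ts} (shorter P y∈ pe) pR′ (∈-++⁺ʳ P r∈) x∈D′
                               (∈-resp-↭ pD″ (there d′∈)) (λ { refl → Unique-disj (x ∷ []) (Unique-resp (↭-sym pD″) (Unique-++ʳ P uPD)) (here refl) d′∈ }) e tok only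
      ... | is , f , l with coverEar (λ _ → tt) uP RP path ar r₁∈ br r₂∈ y∈ is y∉ l
        where
        y∉ : All (_≢ y) (labs is)
        y∉ = All.map (λ { (d , m , e) refl → noY (∈-++⁻ ts (∈-resp-↭ f m)) e }) (labAdj is)
          where
          noY : ∀ {d} → d ∈ ts ⊎ d ∈ D′ → ¬ (y ~ d)
          noY (inj₁ k) e = y≢x (only (∈VS (P⊆D y∈)) k e)
          noY (inj₂ k) e = sat k e
      ... | is′ , f′ , l′ = is′ , (f′ ∙ ++⁺ˡ P f ∙ solve 3 (λ p t d → p ⊕ t ⊕ d ⊜ t ⊕ p ⊕ d) refl (P ∷ ts ∷ D′ ∷ []) ∙ ++⁺ˡ ts pe) , l′
      -- Having no neighbour in `D″`, the vertex `x` cannot be a label, and `d` lies on the ear. So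
      -- `x` followed by its token is hung at `d` and treated as a token there; `d` differs from
      -- `y`, which has no neighbour in `D′`.
      main (inj₂ x∈D′) | D″ , pD″ | no ne with tailH {U} {x} tt one tok
      ... | bt , ct , nt with partition (length D″) {x ∷ P ++ R} {D″} {r} ℕP.≤-refl
                               (solve 4 (λ x p r d → (x ⊕ p ⊕ r) ⊕ d ⊜ (p ⊕ r) ⊕ x ⊕ d) refl ((x ∷ []) ∷ P ∷ R ∷ D″ ∷ []) ∙ ++⁺ˡ (P ++ R) pD″ ∙ pR′) (there (∈-++⁺ʳ P r∈))
      ... | is , f , l = onEar (hg ct xd (nearLk {U} {x} tt nt xd)) d∈P (λ { refl → sat x∈D′ (~sym xd) }) (toU is) (↭-reflexive (flat-mapI _ is) ∙ f)
            (subst (All _) (sym (labs-mapI _ is)) (All.map (λ { (d , m , e) refl → sat (∈-resp-↭ pD″ (there (∈-resp-↭ f m))) e }) (labAdj is)))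
            (subst (All _) (sym (labs-mapI _ is)) (All.zipWith (λ { (here refl , (d , m , e)) → ⊥-elim (ne (lose (∈-resp-↭ f m) e)) ; (there k , _) → ∈-++⁻ P k }) (l , labAdj is)))
            (solve 4 (λ x t p d → (x ⊕ t) ⊕ p ⊕ d ⊜ t ⊕ p ⊕ x ⊕ d) refl ((x ∷ []) ∷ (reverse ts) ∷ P ∷ D″ ∷ []) ∙ ++⁺ (↭-reverse ts) (++⁺ˡ P pD″ ∙ pe))
        where
        d∈P : d ∈ P
        d∈P with ∈-++⁻ P (∈-resp-↭ (↭-sym pe) d∈)
        ... | inj₁ k = k
        ... | inj₂ k with ∈-resp-↭ (↭-sym pD″) k
        ... | here e = ⊥-elim (d≢x e)
        ... | there k′ = ⊥-elim (ne (lose k′ xd))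

    -- Legs

    record Leg (u : V) : Set where
      constructor mkLeg
      field
        {x} : V
        {B ts} : List V
        path : Ch _~_ u (u ∷ B) x
        tok : Hung U x ts
        only : ∀ {l t} → l ∈ VS → t ∈ ts → l ~ t → l ≡ x

    record Brought (A : V → Set) (u : V) (F : List V) : Set where
      constructor brought
      field
        {ts′} : List V
        tok′ : Hung U u ts′
        items : List (Item U)
        perm : ts′ ++ flat items ↭ F
        lab : All A (labs items)

    headCh : ∀ {R : V → V → Set} {a xs b} → Ch R a xs b → ∃ λ ys → xs ≡ a ∷ ys
    headCh one = _ , refl
    headCh (l ◅ c) = _ , refl

    -- The token is at the outer end, where the scan begins and nothing hangs yet, so it can always
    -- be inserted. What arrives at the foot, possibly nothing, is again a hung list and takes the
    -- place of the token.
    bring : ∀ {A : V → Set} {u} (l : Leg u) → A u → Unique (Leg.B l) → (is : List (Item U)) → All (λ v → v ∈ Leg.B l ⊎ A v) (labs is) →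
            Brought A u (Leg.ts l ++ Leg.B l ++ flat is)
    bring (mkLeg {B = []} one tok only) Au uB is al = brought tok is ↭-refl (All.map (λ { (inj₁ ()) ; (inj₂ k) → k }) al)
    bring {A} {u} (mkLeg {x} {B@(_ ∷ _)} {ts} (l ◅ c) tok only) Au uB is al with headCh (Ch-rev ~sym c)
    ... | ys , e = brought (Out.hung o) (Out.items o)
           (Out.perm o ∙ ↭-reflexive (cong₂ (λ p q → (p ++ x ∷ q) ++ flat is) (trans (cong (ts ++_) (toks-toSta {U} ys)) (++-identityʳ ts)) (verts-toSta {U} ys))
            ∙ ↭-reflexive (++-assoc ts (x ∷ ys) (flat is)) ∙ ++⁺ˡ ts (++⁺ʳ (flat is) pB))
           (OutProps.labelled o A Au (All.map (λ { (inj₁ m) → inj₁ (∈-subst (sym vs) (∈-resp-↭ (↭-sym pB) m)) ; (inj₂ k) → inj₂ k }) al))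
      where
      pB : x ∷ ys ↭ B
      pB = ↭-reflexive (sym e) ∙ ↭-reverse B
      vs : verts (sta x tok ∷ toSta {U} ys) ≡ x ∷ ys
      vs = cong (x ∷_) (verts-toSta {U} ys)
      o = scan (sta x tok) (toSta {U} ys) {u} {false} {[]} {labs is} is (allU _) (subst Unique (sym vs) (Unique-resp (↭-sym pB) uB))
            (ToEq (trans e (sym vs)) (ToCh (Ch-rev ~sym c) (~sym l))) nil (λ ()) (inj₁ refl) (Good-notoks _ (toSta {U} ys) _ (toks-toSta {U} ys)) ↭-refl

    pred : ∀ {u} (l : Leg u) → Unique (u ∷ Leg.B l) → (Leg.B l ≡ [] × Leg.x l ≡ u) ⊎ (∃ λ d → d ∈ u ∷ Leg.B l × d ≢ Leg.x l × Leg.x l ~ d)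
    pred {u} (mkLeg {x} {B} path tok only) un with Ch-rev ~sym path | Unique-resp (↭-sym (↭-reverse (u ∷ B))) un | ↭-reverse (u ∷ B)
    ... | c | un′ | p with reverse (u ∷ B)
    pred {u} (mkLeg {x} {[]} one tok only) un | c | un′ | p | w = inj₁ (refl , refl)
    pred {u} (mkLeg {x} {b ∷ B} path tok only) un | one | un′ | p | w with ↭-length p
    ... | ()
    pred {u} (mkLeg {x} {b ∷ B} path tok only) un | l ◅ c | n ∷ un′ | p | w =
      inj₂ (_ , ∈-resp-↭ p (there (ch-head c)) , (λ e → All.lookup n (ch-head c) (sym e)) , l)

    x∈ : ∀ {u} (l : Leg u) → Leg.x l ∈ u ∷ Leg.B l
    x∈ l = ch-last (Leg.path l)

    -- Cycles with four legs

    module Tour (TS : List V) where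

      -- With the fourth token absorbed in the covering of `D`, the legs are brought down one after
      -- the other; in between, labels may still lie on the legs to come. In the end all labels are
      -- on the cycle and `Three.three` applies.
      config3 : ∀ {u₁ u₂ u₃ x d ts D} (l₁ : Leg u₁) a₁ (l₂ : Leg u₂) a₂ (l₃ : Leg u₃) a₃ →
                let K = (u₁ ∷ a₁) ++ (u₂ ∷ a₂) ++ (u₃ ∷ a₃) in
                (K ++ Leg.B l₁ ++ Leg.B l₂ ++ Leg.B l₃) ++ D ↭ VS → Round K → Hung U x ts → (∀ {l t} → l ∈ VS → t ∈ ts → l ~ t → l ≡ x) →
                x ∈ D → d ∈ D → d ≢ x → x ~ d → Leg.ts l₁ ++ Leg.ts l₂ ++ Leg.ts l₃ ++ ts ↭ TS → Cyc (TS ++ VS)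
      config3 {u₁} {u₂} {u₃} {x} {d} {ts} {D} l₁ a₁ l₂ a₂ l₃ a₃ pR r tok only x∈ d∈ d≢ xd pT
        with partitionTok _ {K ++ B₁ ++ B₂ ++ B₃} ℕP.≤-refl pR (here refl) x∈ d∈ d≢ xd tok only
        where
        B₁ = Leg.B l₁
        B₂ = Leg.B l₂
        B₃ = Leg.B l₃
        K = (u₁ ∷ a₁) ++ (u₂ ∷ a₂) ++ (u₃ ∷ a₃)
      ... | is , f , al = stage₁
        where
        B₁ = Leg.B l₁
        B₂ = Leg.B l₂
        B₃ = Leg.B l₃
        K = (u₁ ∷ a₁) ++ (u₂ ∷ a₂) ++ (u₃ ∷ a₃)
        uR = Unique-++ˡ (K ++ B₁ ++ B₂ ++ B₃) (Unique-resp (↭-sym pR) uVS)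
        uB = Unique-++ʳ K uR
        uB′ = Unique-++ʳ B₁ uB
        A₃ A₂ A₁ : V → Set
        A₃ v = v ∈ K
        A₂ v = v ∈ B₃ ⊎ A₃ v
        A₁ v = v ∈ B₂ ⊎ A₂ v
        u₂∈ : u₂ ∈ K
        u₂∈ = ∈-++⁺ʳ (u₁ ∷ a₁) (here refl)
        u₃∈ : u₃ ∈ K
        u₃∈ = ∈-++⁺ʳ (u₁ ∷ a₁) (∈-++⁺ʳ (u₂ ∷ a₂) (here refl))
        lab : ∀ {v} → v ∈ K ++ B₁ ++ B₂ ++ B₃ → v ∈ B₁ ⊎ A₁ v
        lab m with ∈-++⁻ K m
        ... | inj₁ k = inj₂ (inj₂ (inj₂ k))
        ... | inj₂ k with ∈-++⁻ B₁ k
        ... | inj₁ k′ = inj₁ k′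
        ... | inj₂ k′ with ∈-++⁻ B₂ k′
        ... | inj₁ k″ = inj₂ (inj₁ k″)
        ... | inj₂ k″ = inj₂ (inj₂ (inj₁ k″))
        stage₁ : Cyc (TS ++ VS)
        stage₁ with bring {A₁} l₁ (inj₂ (inj₂ (here refl))) (Unique-++ˡ B₁ uB) is (All.map lab al)
        ... | brought {s₁} t₁ is₁ p₁ al₁ with bring {A₂} l₂ (inj₂ u₂∈) (Unique-++ˡ B₂ uB′) is₁ al₁
        ... | brought {s₂} t₂ is₂ p₂ al₂ with bring {A₃} l₃ u₃∈ (Unique-++ʳ B₂ uB′) is₂ al₂
        ... | brought {s₃} t₃ is₃ p₃ al₃ = Cyc-resp
            (solve 7 (λ s₁ s₂ s₃ a b c f → s₁ ⊕ s₂ ⊕ s₃ ⊕ a ⊕ b ⊕ c ⊕ f ⊜ s₁ ⊕ s₂ ⊕ (a ⊕ b ⊕ c) ⊕ (s₃ ⊕ f)) refl (s₁ ∷ s₂ ∷ s₃ ∷ (u₁ ∷ a₁) ∷ (u₂ ∷ a₂) ∷ (u₃ ∷ a₃) ∷ (flat is₃) ∷ [])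
             ∙ ++⁺ˡ s₁ (++⁺ˡ s₂ (++⁺ˡ K p₃)) ∙ solve 6 (λ s₁ s₂ k t b f → s₁ ⊕ s₂ ⊕ k ⊕ (t ⊕ b ⊕ f) ⊜ s₁ ⊕ k ⊕ t ⊕ b ⊕ (s₂ ⊕ f)) refl (s₁ ∷ s₂ ∷ K ∷ (Leg.ts l₃) ∷ B₃ ∷ (flat is₂) ∷ [])
             ∙ ++⁺ˡ s₁ (++⁺ˡ K (++⁺ˡ (Leg.ts l₃) (++⁺ˡ B₃ p₂))) ∙ solve 7 (λ s₁ k t₃ b₃ t b f → s₁ ⊕ k ⊕ t₃ ⊕ b₃ ⊕ t ⊕ b ⊕ f ⊜ k ⊕ (t₃ ⊕ b₃ ⊕ t ⊕ b) ⊕ s₁ ⊕ f) refl (s₁ ∷ K ∷ (Leg.ts l₃) ∷ B₃ ∷ (Leg.ts l₂) ∷ B₂ ∷ (flat is₁) ∷ [])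
             ∙ ++⁺ˡ K (++⁺ˡ (Leg.ts l₃ ++ B₃ ++ Leg.ts l₂ ++ B₂) (p₁ ∙ ++⁺ˡ (Leg.ts l₁) (++⁺ˡ B₁ f)))
             ∙ solve 9 (λ k t₃ b₃ t₂ b₂ t₁ b₁ t d → k ⊕ (t₃ ⊕ b₃ ⊕ t₂ ⊕ b₂) ⊕ t₁ ⊕ b₁ ⊕ t ⊕ d ⊜ (t₁ ⊕ t₂ ⊕ t₃ ⊕ t) ⊕ (k ⊕ b₁ ⊕ b₂ ⊕ b₃) ⊕ d) refl (K ∷ (Leg.ts l₃) ∷ B₃ ∷ (Leg.ts l₂) ∷ B₂ ∷ (Leg.ts l₁) ∷ B₁ ∷ ts ∷ D ∷ [])
             ∙ ++⁺ pT pR)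
            (Three.three is₃ (sta u₁ t₁) a₁ (sta u₂ t₂) a₂ (sta u₃ t₃) a₃ (Three.ok (Unique-++ˡ K uR) r al₃))

      record Config : Set where
        constructor config
        field
          {u₁ u₂ u₃ u₄} : V
          l₁ : Leg u₁
          l₂ : Leg u₂
          l₃ : Leg u₃
          l₄ : Leg u₄
          a₁ a₂ a₃ a₄ D : List V
        B₁ = Leg.B l₁
        B₂ = Leg.B l₂
        B₃ = Leg.B l₃
        B₄ = Leg.B l₄
        K = (u₁ ∷ a₁) ++ (u₂ ∷ a₂) ++ (u₃ ∷ a₃) ++ (u₄ ∷ a₄)
        O = B₁ ++ B₂ ++ B₃ ++ B₄
        field
          perm : (K ++ O) ++ D ↭ VS
          t₁ : To (u₁ ∷ a₁) u₂
          t₂ : To (u₂ ∷ a₂) u₃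
          t₃ : To (u₃ ∷ a₃) u₄
          t₄ : To (u₄ ∷ a₄) u₁
          tokens : Leg.ts l₁ ++ Leg.ts l₂ ++ Leg.ts l₃ ++ Leg.ts l₄ ↭ TS
        uKOD : Unique ((K ++ O) ++ D)
        uKOD = Unique-resp (↭-sym perm) uVS
        uK : Unique K
        uK = Unique-++ˡ K (Unique-++ˡ (K ++ O) uKOD)

      rot4 : ∀ (a b c d : List V) → a ++ b ++ c ++ d ↭ b ++ c ++ d ++ a
      rot4 a b c d = solve 4 (λ a b c d → a ⊕ b ⊕ c ⊕ d ⊜ b ⊕ c ⊕ d ⊕ a) refl (a ∷ b ∷ c ∷ d ∷ [])

      rot : Config → Config
      rot c = config l₂ l₃ l₄ l₁ a₂ a₃ a₄ a₁ D
        (++⁺ʳ D (++⁺ (↭-sym (rot4 (u₁ ∷ a₁) (u₂ ∷ a₂) (u₃ ∷ a₃) (u₄ ∷ a₄))) (↭-sym (rot4 B₁ B₂ B₃ B₄))) ∙ perm) t₂ t₃ t₄ t₁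
        (↭-sym (rot4 (Leg.ts l₁) (Leg.ts l₂) (Leg.ts l₃) (Leg.ts l₄)) ∙ tokens)
        where open Config c

      Bigger : Config → Config → Set
      Bigger c′ c = ∃ λ e → ∃ λ E → Config.O c′ ↭ e ∷ E ++ Config.O c

      Outcome : Config → Set
      Outcome c = Cyc (TS ++ VS) ⊎ ∃ λ c′ → Bigger c′ c

      unrot : ∀ c → Outcome (rot c) → Outcome c
      unrot c (inj₁ x) = inj₁ x
      unrot c (inj₂ (c′ , e , E , p)) = inj₂ (c′ , e , E , (p ∙ ++⁺ˡ (e ∷ E) (↭-sym (rot4 (Config.B₁ c) (Config.B₂ c) (Config.B₃ c) (Config.B₄ c)))))

      Other : V → V → Set
      Other x d = d ≢ x × x ~ d

      other? : ∀ x D → Dec (Any (Other x) D)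
      other? x D = Any.any? (λ d → ¬? (d ≟ x) ×-dec (x ~? d)) D

      -- What remains of a leg whose token cannot be absorbed: its whole contents hang directly at
      -- the foot. By `noD` no label of an item covering `D` lies on it.
      record Still {u} (l : Leg u) (D : List V) : Set where
        constructor still
        field
          {ts′} : List V
          tok′ : Hung U u ts′
          holds : ts′ ↭ Leg.ts l ++ Leg.B l
          noD : ∀ {o d} → o ∈ Leg.B l → d ∈ D → ¬ (o ~ d)

      settleLeg : ∀ {u} (l : Leg u) D → Unique (Leg.B l ++ D) → (Leg.x l ∈ Leg.B l × Any (Other (Leg.x l)) (Leg.B l ++ D)) ⊎ Still l D
      settleLeg (mkLeg {B = []} one tok only) D uB = inj₂ (still tok (↭-reflexive (sym (++-identityʳ _))) (λ ()))
      settleLeg {u} (mkLeg {x} {b ∷ B} {ts} (ub ◅ c) tok only) D uB with other? x ((b ∷ B) ++ D)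
      ... | yes an = inj₁ (ch-last c , an)
      ... | no ne with headCh c
      ... | _ , refl with pred (mkLeg c tok only) (Unique-++ˡ (b ∷ B) uB)
      -- A predecessor of `x` within `B` would be a neighbour of the kind just excluded, so `x` is
      -- the only vertex of `B`.
      ... | inj₂ (d , m , o) = ⊥-elim (ne (lose (∈-++⁺ˡ m) o))
      ... | inj₁ (refl , refl) with tailH {U} {x} tt one tok
      ... | e , ct , nt = inj₂ (still (hg ct (~sym ub) (nearLk {U} {x} tt nt (~sym ub)))
            (↭-prep x (↭-reverse ts) ∙ solve 2 (λ x t → x ⊕ t ⊜ t ⊕ x) refl ([ x ] ∷ ts ∷ []))
            (λ { (here refl) m e → ne (lose (there m) ((λ { refl → Unique-disj (x ∷ []) uB (here refl) m }) , e)) }))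

      -- To dissolve a leg, its foot is made an ordinary vertex of the cycle, which merges the two
      -- arcs at it, and the rest of the leg is added to `D`.
      settle : ∀ c → Cyc (TS ++ VS) ⊎ Still (Config.l₁ c) (Config.D c)
      settle c = go (settleLeg l₁ D uBD)
        where
        open Config c
        p′ : (((u₂ ∷ a₂) ++ (u₃ ∷ a₃) ++ (u₄ ∷ a₄ ++ u₁ ∷ a₁)) ++ B₂ ++ B₃ ++ B₄) ++ B₁ ++ D ↭ VS
        p′ = solve 9 (λ k₁ k₂ k₃ k₄ b₁ b₂ b₃ b₄ d → ((k₂ ⊕ k₃ ⊕ (k₄ ⊕ k₁)) ⊕ b₂ ⊕ b₃ ⊕ b₄) ⊕ b₁ ⊕ d ⊜ ((k₁ ⊕ k₂ ⊕ k₃ ⊕ k₄) ⊕ b₁ ⊕ b₂ ⊕ b₃ ⊕ b₄) ⊕ d) refl ((u₁ ∷ a₁) ∷ (u₂ ∷ a₂) ∷ (u₃ ∷ a₃) ∷ (u₄ ∷ a₄) ∷ B₁ ∷ B₂ ∷ B₃ ∷ B₄ ∷ D ∷ []) ∙ perm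
        uBD : Unique (B₁ ++ D)
        uBD = Unique-++ʳ (((u₂ ∷ a₂) ++ (u₃ ∷ a₃) ++ (u₄ ∷ a₄ ++ u₁ ∷ a₁)) ++ B₂ ++ B₃ ++ B₄) (Unique-resp (↭-sym p′) uVS)
        go : (Leg.x l₁ ∈ B₁ × Any (Other (Leg.x l₁)) (B₁ ++ D)) ⊎ Still l₁ D → Cyc (TS ++ VS) ⊎ Still l₁ D
        go (inj₂ s) = inj₂ s
        go (inj₁ (x∈B , an)) with find an
        ... | d , d∈ , d≢ , xd = inj₁ (config3 l₂ a₂ l₃ a₃ l₄ (a₄ ++ u₁ ∷ a₁) p′ (round3 {a₁ = a₂} {a₂ = a₃} t₂ t₃ (To-++⁺ (u₄ ∷ a₄) t₄ t₁)) (Leg.tok l₁) (Leg.only l₁) (∈-++⁺ˡ x∈B) d∈ d≢ xd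
              (↭-sym (rot4 (Leg.ts l₁) (Leg.ts l₂) (Leg.ts l₃) (Leg.ts l₄)) ∙ tokens))

      -- The arc `a₁′`, built with `Z`, leads past `u₂`, which falls off the cycle together with
      -- `μ`. If the end of its leg has a neighbour off the new cycle and the other three legs, its
      -- token is absorbed. Otherwise the leg is trivial, and a neighbour of `u₂` inside `a₁′` gives
      -- it a leg of length one, which is progress. Failing this, `u₂` has no neighbour in `D` or
      -- inside its two arcs, so these are empty.
      core : ∀ c Z D′ {a₁′ μ} → let open Config c in Z ++ D′ ↭ D → (u₁ ∷ a₁) ++ (u₂ ∷ a₂) ++ Z ↭ (u₁ ∷ a₁′) ++ u₂ ∷ μ →
             To (u₁ ∷ a₁′) u₃ → Outcome c ⊎ (a₁ ≡ [] × a₂ ≡ [] × (∀ {d} → d ∈ D → ¬ (u₂ ~ d)))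
      core c Z D′ {a₁′} {μ} pZ pK to = go (other? x₂ D″)
        where
        open Config c
        x₂ = Leg.x l₂
        Res : Set
        Res = Outcome c ⊎ (a₁ ≡ [] × a₂ ≡ [] × (∀ {d} → d ∈ D → ¬ (u₂ ~ d)))
        D″ = (u₂ ∷ μ) ++ B₂ ++ D′
        p′ : (((u₁ ∷ a₁′) ++ (u₃ ∷ a₃) ++ (u₄ ∷ a₄)) ++ B₁ ++ B₃ ++ B₄) ++ D″ ↭ VS
        p′ = solve 9 (λ k m k₃ k₄ b₁ b₂ b₃ b₄ d → ((k ⊕ k₃ ⊕ k₄) ⊕ b₁ ⊕ b₃ ⊕ b₄) ⊕ (m ⊕ b₂ ⊕ d) ⊜ (k ⊕ m) ⊕ k₃ ⊕ k₄ ⊕ b₁ ⊕ b₂ ⊕ b₃ ⊕ b₄ ⊕ d) refl ((u₁ ∷ a₁′) ∷ (u₂ ∷ μ) ∷ (u₃ ∷ a₃) ∷ (u₄ ∷ a₄) ∷ B₁ ∷ B₂ ∷ B₃ ∷ B₄ ∷ D′ ∷ []) ∙ ++⁺ʳ _ (↭-sym pK)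
           ∙ solve 10 (λ k₁ k₂ z k₃ k₄ b₁ b₂ b₃ b₄ d → (k₁ ⊕ k₂ ⊕ z) ⊕ k₃ ⊕ k₄ ⊕ b₁ ⊕ b₂ ⊕ b₃ ⊕ b₄ ⊕ d ⊜ ((k₁ ⊕ k₂ ⊕ k₃ ⊕ k₄) ⊕ b₁ ⊕ b₂ ⊕ b₃ ⊕ b₄) ⊕ z ⊕ d) refl ((u₁ ∷ a₁) ∷ (u₂ ∷ a₂) ∷ Z ∷ (u₃ ∷ a₃) ∷ (u₄ ∷ a₄) ∷ B₁ ∷ B₂ ∷ B₃ ∷ B₄ ∷ D′ ∷ []) ∙ ++⁺ˡ (K ++ O) pZ ∙ perm
        uBl : Unique (u₂ ∷ B₂)
        uBl = Unique-++ˡ (u₂ ∷ B₂) (Unique-resp (solve 4 (λ u m b d → (u ⊕ m) ⊕ b ⊕ d ⊜ (u ⊕ b) ⊕ m ⊕ d) refl ([ u₂ ] ∷ μ ∷ B₂ ∷ D′ ∷ []))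
                (Unique-++ʳ (((u₁ ∷ a₁′) ++ (u₃ ∷ a₃) ++ (u₄ ∷ a₄)) ++ B₁ ++ B₃ ++ B₄) (Unique-resp (↭-sym p′) uVS)))
        u₁₂ : Unique ((u₁ ∷ a₁) ++ u₂ ∷ a₂)
        u₁₂ = Unique-++ˡ ((u₁ ∷ a₁) ++ u₂ ∷ a₂) (Unique-resp (↭-reflexive (sym (++-assoc (u₁ ∷ a₁) (u₂ ∷ a₂) _))) uK)
        x∈D″ : x₂ ∈ D″
        x∈D″ with x∈ l₂
        ... | here e = here e
        ... | there m = there (∈-++⁺ʳ μ (∈-++⁺ˡ m))
        where₁ : ∀ {q} → q ∈ (u₁ ∷ a₁) ++ (u₂ ∷ a₂) ++ Z → q ≢ u₁ → q ≢ u₂ → q ∈ a₁′ ⊎ q ∈ μ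
        where₁ m n₁ n₂ with ∈-++⁻ (u₁ ∷ a₁′) (∈-resp-↭ pK m)
        ... | inj₁ (here e) = ⊥-elim (n₁ e)
        ... | inj₁ (there k) = inj₁ k
        ... | inj₂ (here e) = ⊥-elim (n₂ e)
        ... | inj₂ (there k) = inj₂ k
        grown : (l : Leg u₂) → Leg.B l ≡ [] → Leg.x l ≡ u₂ → ∀ {z} → z ~ u₂ → ∃ λ (l′ : Leg z) → Leg.B l′ ≡ u₂ ∷ [] × Leg.ts l′ ≡ Leg.ts l
        grown (mkLeg path tok only) e refl zu = mkLeg (zu ◅ one) tok only , refl , refl
        stuck : ¬ Any (Other x₂) D″ → B₂ ≡ [] → x₂ ≡ u₂ → Dec (Any (u₂ ~_) a₁′) → Res
        stuck ne eB ex (yes an) with find an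
        ... | z , z∈ , uz with ∈-∃++ z∈ | grown l₂ eB ex (~sym uz)
        ... | π , ρ , refl | l′ , eB′ , et = inj₁ (inj₂ (config l₁ l′ l₃ l₄ π ρ a₃ a₄ (μ ++ D′)
              (subst (λ w → (((u₁ ∷ π) ++ (z ∷ ρ) ++ (u₃ ∷ a₃) ++ (u₄ ∷ a₄)) ++ B₁ ++ w ++ B₃ ++ B₄) ++ μ ++ D′ ↭ VS) (sym eB′)
                (solve 11 (λ k z k₃ k₄ b₁ u b₂ b₃ b₄ m d → ((k ⊕ z ⊕ k₃ ⊕ k₄) ⊕ b₁ ⊕ u ⊕ b₃ ⊕ b₄) ⊕ m ⊕ d ⊜ (((k ⊕ z) ⊕ k₃ ⊕ k₄) ⊕ b₁ ⊕ b₃ ⊕ b₄) ⊕ (u ⊕ m) ⊕ id ⊕ d) refl ((u₁ ∷ π) ∷ (z ∷ ρ) ∷ (u₃ ∷ a₃) ∷ (u₄ ∷ a₄) ∷ B₁ ∷ [ u₂ ] ∷ B₂ ∷ B₃ ∷ B₄ ∷ μ ∷ D′ ∷ [])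
                 ∙ subst (λ w → (((u₁ ∷ π ++ z ∷ ρ) ++ (u₃ ∷ a₃) ++ (u₄ ∷ a₄)) ++ B₁ ++ B₃ ++ B₄) ++ (u₂ ∷ μ) ++ w ++ D′ ↭ VS) eB p′))
              (proj₁ split) (proj₂ split) t₃ t₄
              (subst (λ w → Leg.ts l₁ ++ w ++ Leg.ts l₃ ++ Leg.ts l₄ ↭ TS) (sym et) tokens)
            , u₂ , [] , (↭-reflexive (cong (λ w → B₁ ++ w ++ B₃ ++ B₄) eB′) ∙ solve 4 (λ b₁ u b₃ b₄ → b₁ ⊕ u ⊕ b₃ ⊕ b₄ ⊜ u ⊕ b₁ ⊕ b₃ ⊕ b₄) refl (B₁ ∷ [ u₂ ] ∷ B₃ ∷ B₄ ∷ [])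
                          ∙ ↭-reflexive (cong (λ w → u₂ ∷ B₁ ++ w ++ B₃ ++ B₄) (sym eB)))))
          where split = To-++⁻ (u₁ ∷ π) {z ∷ ρ} to
        stuck ne eB ex (no na) = inj₂ (e₁ , e₂ , noD)
          where
          none : ∀ {q} → q ∈ (u₁ ∷ a₁) ++ (u₂ ∷ a₂) ++ Z → q ≢ u₁ → q ≢ u₂ → ¬ (u₂ ~ q)
          none m n₁ n₂ e with where₁ m n₁ n₂
          ... | inj₁ k = na (lose k e)
          ... | inj₂ k = ne (lose (there (∈-++⁺ˡ k)) ((λ { refl → n₂ ex }) , subst (_~ _) (sym ex) e))
          e₁ : a₁ ≡ []
          e₁ with lastTo a₁ t₁
          ... | inj₁ e = e
          ... | inj₂ (q , q∈ , e) = ⊥-elim (none (∈-++⁺ˡ (there q∈)) (λ { refl → Unique-disj (u₁ ∷ []) u₁₂ (here refl) (∈-++⁺ˡ q∈) })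
                (λ { refl → Unique-disj (u₁ ∷ a₁) u₁₂ (there q∈) (here refl) }) (~sym e))
          next : ∀ a → To (u₂ ∷ a) u₃ → a ≡ [] ⊎ ∃ λ q → q ∈ a × u₂ ~ q
          next [] _ = inj₁ refl
          next (q ∷ a) (e , _) = inj₂ (q , here refl , e)
          e₂ : a₂ ≡ []
          e₂ with next a₂ t₂
          ... | inj₁ e = e
          ... | inj₂ (q , q∈ , e) = ⊥-elim (none (∈-++⁺ʳ (u₁ ∷ a₁) (∈-++⁺ˡ (there q∈))) (λ { refl → Unique-disj (u₁ ∷ a₁) u₁₂ (here refl) (there q∈) })
                (λ { refl → Unique-disj (u₂ ∷ []) (Unique-++ʳ (u₁ ∷ a₁) u₁₂) (here refl) q∈ }) e)
          K#D : ∀ {v d} → v ∈ K → d ∈ D → d ≢ v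
          K#D m k refl = Unique-disj (K ++ O) uKOD (∈-++⁺ˡ m) k
          noD : ∀ {d} → d ∈ D → ¬ (u₂ ~ d)
          noD {d} d∈ e with ∈-++⁻ Z (∈-resp-↭ (↭-sym pZ) d∈)
          ... | inj₁ k = none (∈-++⁺ʳ (u₁ ∷ a₁) (∈-++⁺ʳ (u₂ ∷ a₂) k)) (K#D (here refl) d∈) (K#D (∈-++⁺ʳ (u₁ ∷ a₁) (here refl)) d∈) e
          ... | inj₂ k = ne (lose (∈-++⁺ʳ (u₂ ∷ μ) (∈-++⁺ʳ B₂ k)) ((λ { refl → K#D (∈-++⁺ʳ (u₁ ∷ a₁) (here refl)) d∈ ex }) , subst (_~ _) (sym ex) e))
        after : ¬ Any (Other x₂) D″ → (B₂ ≡ [] × x₂ ≡ u₂) ⊎ (∃ λ d → d ∈ u₂ ∷ B₂ × d ≢ x₂ × x₂ ~ d) → Res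
        after ne (inj₁ (eB , ex)) = stuck ne eB ex (Any.any? (u₂ ~?_) a₁′)
        after ne (inj₂ (d , here e , o)) = ⊥-elim (ne (lose (here e) o))
        after ne (inj₂ (d , there m , o)) = ⊥-elim (ne (lose (there (∈-++⁺ʳ μ (∈-++⁺ˡ m))) o))
        dissolve : (∃ λ d → d ∈ D″ × Other x₂ d) → Res
        dissolve (d , d∈ , d≢ , xd) = inj₁ (inj₁ (config3 l₁ a₁′ l₃ a₃ l₄ a₄ p′ (round3 {a₁ = a₁′} {a₂ = a₃} to t₃ t₄) (Leg.tok l₂) (Leg.only l₂) x∈D″ d∈ d≢ xd
              (solve 4 (λ a b c d → a ⊕ c ⊕ d ⊕ b ⊜ a ⊕ b ⊕ c ⊕ d) refl (Leg.ts l₁ ∷ Leg.ts l₂ ∷ Leg.ts l₃ ∷ Leg.ts l₄ ∷ []) ∙ tokens)))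
        go : Dec (Any (Other x₂) D″) → Res
        go (yes an) = dissolve (find an)
        go (no ne) = after ne (pred l₂ uBl)

      -- A chord between opposite arcs cuts off two feet. Their legs are prolonged along the old
      -- cycle to the ends of the chord, which become the new feet with `Z` as the arc between them;
      -- the arc `a₂` is given up to `D`.
      twoTwo : ∀ c {σ v τ σ′ w τ′ a Z b D′} → let open Config c in a₁ ≡ σ ++ v ∷ τ → a₃ ≡ σ′ ++ w ∷ τ′ →
               v ~ a → Ch _~_ a Z b → b ~ w → Z ++ D′ ↭ D → Outcome c
      twoTwo (config {u₁} {u₂} {u₃} {u₄} l₁ l₂ l₃ l₄ _ a₂ _ a₄ D p t₁ t₂ t₃ t₄ tokens) {σ} {v} {τ} {σ′} {w} {τ′} {a} {Z} {b} {D′} refl refl va cZ bw pZ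
        with To-++⁻ (u₁ ∷ σ) {v ∷ τ} t₁ | To-++⁻ (u₃ ∷ σ′) {w ∷ τ′} t₃
      ... | t₁₁ , t₁₂ | t₃₁ , t₃₂ = inj₂ (config l₁
            (mkLeg (ToOnto v τ t₁₂ (Leg.path l₂)) (Leg.tok l₂) (Leg.only l₂))
            (mkLeg (revOnto σ′ (Leg.path l₃) t₃₁) (Leg.tok l₃) (Leg.only l₃)) l₄ σ Z τ′ a₄ (a₂ ++ D′)
            (++⁺ʳ (a₂ ++ D′) (++⁺ˡ ((u₁ ∷ σ) ++ (v ∷ Z) ++ (w ∷ τ′) ++ (u₄ ∷ a₄)) big)
             ∙ solve 16 (λ k v z w k₃ k₄ u₂ u₃ t s b₁ b₂ b₃ b₄ a d → ((k ⊕ (v ⊕ z) ⊕ (w ⊕ k₃) ⊕ k₄) ⊕ (u₂ ⊕ (u₃ ⊕ t ⊕ s) ⊕ b₁ ⊕ b₂ ⊕ b₃ ⊕ b₄)) ⊕ a ⊕ d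
                  ⊜ ((((k ⊕ v ⊕ t) ⊕ (u₂ ⊕ a) ⊕ ((u₃ ⊕ s) ⊕ w ⊕ k₃) ⊕ k₄) ⊕ b₁ ⊕ b₂ ⊕ b₃ ⊕ b₄)) ⊕ z ⊕ d) refl ((u₁ ∷ σ) ∷ [ v ] ∷ Z ∷ [ w ] ∷ τ′ ∷ (u₄ ∷ a₄) ∷ [ u₂ ] ∷ [ u₃ ] ∷ τ ∷ σ′ ∷ (Leg.B l₁) ∷ (Leg.B l₂) ∷ (Leg.B l₃) ∷ (Leg.B l₄) ∷ a₂ ∷ D′ ∷ [])
             ∙ ++⁺ˡ (((u₁ ∷ σ ++ v ∷ τ) ++ (u₂ ∷ a₂) ++ (u₃ ∷ σ′ ++ w ∷ τ′) ++ (u₄ ∷ a₄)) ++ Leg.B l₁ ++ Leg.B l₂ ++ Leg.B l₃ ++ Leg.B l₄) pZ ∙ p)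
            t₁₁ (to-Z cZ) t₃₂ t₄ tokens
          , u₂ , u₃ ∷ τ ++ σ′ , big)
        where
        to-Z : Ch _~_ a Z b → To (v ∷ Z) w
        to-Z c = subst (v ~_) (sym (hdCh w c)) va , ToCh c bw
        big : Leg.B l₁ ++ (τ ++ u₂ ∷ Leg.B l₂) ++ (reverse σ′ ++ u₃ ∷ Leg.B l₃) ++ Leg.B l₄ ↭ u₂ ∷ (u₃ ∷ τ ++ σ′) ++ Leg.B l₁ ++ Leg.B l₂ ++ Leg.B l₃ ++ Leg.B l₄
        big = ++⁺ˡ (Leg.B l₁) (++⁺ˡ (τ ++ u₂ ∷ Leg.B l₂) (++⁺ʳ (Leg.B l₄) (++⁺ʳ (u₃ ∷ Leg.B l₃) (↭-reverse σ′))))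
          ∙ solve 8 (λ b₁ t u₂ b₂ s u₃ b₃ b₄ → b₁ ⊕ (t ⊕ u₂ ⊕ b₂) ⊕ (s ⊕ u₃ ⊕ b₃) ⊕ b₄ ⊜ u₂ ⊕ (u₃ ⊕ t ⊕ s) ⊕ b₁ ⊕ b₂ ⊕ b₃ ⊕ b₄) refl ((Leg.B l₁) ∷ τ ∷ [ u₂ ] ∷ (Leg.B l₂) ∷ σ′ ∷ [ u₃ ] ∷ (Leg.B l₃) ∷ (Leg.B l₄) ∷ [])

      record Ready (c : Config) : Set where
        constructor ready
        open Config c
        field
          s₁ : Still l₁ D
          s₂ : Still l₂ D
          s₃ : Still l₃ D
          s₄ : Still l₄ D
          is : List (Item (_∈ D))
          fl : flat is ↭ D
          lab : All (_∈ K) (labs is)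

      rotReady : ∀ c → Ready c → Ready (rot c)
      rotReady c (ready s₁ s₂ s₃ s₄ is fl lab) = ready s₂ s₃ s₄ s₁ is fl (All.map (∈-resp-↭ (rot4 (u₁ ∷ a₁) (u₂ ∷ a₂) (u₃ ∷ a₃) (u₄ ∷ a₄))) lab)
        where open Config c

      assemble : ∀ c (r : Ready c) {F} → F ↭ Config.D c → let open Ready r in
                 Cyc ((Still.ts′ s₁ ++ Still.ts′ s₂ ++ Still.ts′ s₃ ++ Still.ts′ s₄) ++ Config.K c ++ F) → Cyc (TS ++ VS)
      assemble c r pF = Cyc-resp (++⁺ (++⁺ (Still.holds s₁) (++⁺ (Still.holds s₂) (++⁺ (Still.holds s₃) (Still.holds s₄)))) (++⁺ˡ K pF)
          ∙ solve 10 (λ t₁ b₁ t₂ b₂ t₃ b₃ t₄ b₄ k d → ((t₁ ⊕ b₁) ⊕ (t₂ ⊕ b₂) ⊕ (t₃ ⊕ b₃) ⊕ (t₄ ⊕ b₄)) ⊕ k ⊕ d ⊜ (t₁ ⊕ t₂ ⊕ t₃ ⊕ t₄) ⊕ (k ⊕ b₁ ⊕ b₂ ⊕ b₃ ⊕ b₄) ⊕ d) refl ((Leg.ts l₁) ∷ B₁ ∷ (Leg.ts l₂) ∷ B₂ ∷ (Leg.ts l₃) ∷ B₃ ∷ (Leg.ts l₄) ∷ B₄ ∷ K ∷ D ∷ [])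
          ∙ ++⁺ tokens perm)
        where
        open Config c
        open Ready r

      special : ∀ c → Ready c → let open Config c in a₁ ≡ [] → a₂ ≡ [] → a₃ ≡ [] → a₄ ≡ [] → (∀ {d} → d ∈ D → ¬ (u₂ ~ d)) → Cyc (TS ++ VS)
      special c@(config {u₁} {u₂} {u₃} {u₄} l₁ l₂ l₃ l₄ _ _ _ _ D p (t₁ , _) (t₂ , _) (t₃ , _) (t₄ , _) tokens) r@(ready s₁ s₂ s₃ s₄ is fl lab) refl refl refl refl noD =
        assemble c r (↭-reflexive (flat-mapI _ is) ∙ fl)
          (Cyc-resp (solve 9 (λ t₁ t₂ t₃ t₄ v₁ v₂ v₃ v₄ f → (t₂ ⊕ t₃ ⊕ t₄ ⊕ t₁ ⊕ id) ⊕ (v₂ ⊕ v₃ ⊕ v₄ ⊕ v₁) ⊕ f ⊜ (t₁ ⊕ t₂ ⊕ t₃ ⊕ t₄) ⊕ (v₁ ⊕ v₂ ⊕ v₃ ⊕ v₄) ⊕ f) refl ((Still.ts′ s₁) ∷ (Still.ts′ s₂) ∷ (Still.ts′ s₃) ∷ (Still.ts′ s₄) ∷ [ u₁ ] ∷ [ u₂ ] ∷ [ u₃ ] ∷ [ u₄ ] ∷ (flat isU) ∷ []))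
            (four (sta u₂ (Still.tok′ s₂)) (sta u₃ (Still.tok′ s₃)) (sta u₄ (Still.tok′ s₄)) (sta u₁ (Still.tok′ s₁)) isU
              (Unique-resp p₁ (Config.uK c)) (t₂ , t₃ , t₄ , t₁ , tt) (subst (All _) (sym (labs-mapI _ is)) (All.map (∈-resp-↭ p₁) lab))
              (trans (cong (pin (u₂ ∷ [])) (labs-mapI _ is)) (pin-∉ (u₂ ∷ []) (labs is) (All.map (λ { (d , m , e) (here refl) → noD (∈-resp-↭ fl m) e }) (labAdj is))))))
        where
        isU : List (Item U)
        isU = mapI (λ _ → tt) is
        p₁ : u₁ ∷ u₂ ∷ u₃ ∷ u₄ ∷ [] ↭ u₂ ∷ u₃ ∷ u₄ ∷ u₁ ∷ []
        p₁ = rot4 [ u₁ ] [ u₂ ] [ u₃ ] [ u₄ ]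

      -- Writing the second end of the chord as `hd ω u₃` covers the vertices of `a₂` and, for empty
      -- `ω`, the foot `u₃`.
      coreSplit : ∀ c {σ v τ β ω w a Z b D′} → let open Config c in u₁ ∷ a₁ ≡ σ ++ v ∷ τ → a₂ ≡ β ++ ω → w ≡ hd ω u₃ →
                  v ~ a → Ch _~_ a Z b → b ~ w → Z ++ D′ ↭ D → Outcome c ⊎ (a₁ ≡ [] × a₂ ≡ [] × (∀ {d} → d ∈ D → ¬ (u₂ ~ d)))
      coreSplit c@(config {u₁} {u₂} {u₃} {u₄} l₁ l₂ l₃ l₄ _ _ a₃ a₄ D p t₁ t₂ t₃ t₄ tokens) {[]} {_} {τ} {β} {ω} {w} {a} {Z} {b} {D′} refl refl refl va cZ bw pZ =
        core c Z D′ {Z ++ ω} {τ ++ β} pZ (solve 6 (λ u t v β ω z → (u ⊕ t) ⊕ (v ⊕ β ⊕ ω) ⊕ z ⊜ (u ⊕ z ⊕ ω) ⊕ v ⊕ t ⊕ β) refl ([ u₁ ] ∷ τ ∷ [ u₂ ] ∷ β ∷ ω ∷ Z ∷ []))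
          (To-++⁺ (u₁ ∷ Z) (subst (u₁ ~_) (sym (hdCh (hd ω u₃) cZ)) va , ToCh cZ bw) (proj₂ (To-++⁻ (u₂ ∷ β) {ω} t₂)))
      coreSplit c@(config {u₁} {u₂} {u₃} {u₄} l₁ l₂ l₃ l₄ _ _ a₃ a₄ D p t₁ t₂ t₃ t₄ tokens) {_ ∷ σ} {v} {τ} {β} {ω} {w} {a} {Z} {b} {D′} refl refl refl va cZ bw pZ =
        core c Z D′ {σ ++ v ∷ Z ++ ω} {τ ++ β} pZ
          (solve 8 (λ u s v t u₂ β ω z → (u ⊕ s ⊕ v ⊕ t) ⊕ (u₂ ⊕ β ⊕ ω) ⊕ z ⊜ (u ⊕ s ⊕ v ⊕ z ⊕ ω) ⊕ u₂ ⊕ t ⊕ β) refl ([ u₁ ] ∷ σ ∷ [ v ] ∷ τ ∷ [ u₂ ] ∷ β ∷ ω ∷ Z ∷ []))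
          (To-++⁺ (u₁ ∷ σ) (proj₁ (To-++⁻ (u₁ ∷ σ) {v ∷ τ} t₁))
            (To-++⁺ (v ∷ Z) (subst (v ~_) (sym (hdCh (hd ω u₃) cZ)) va , ToCh cZ bw) (proj₂ (To-++⁻ (u₂ ∷ β) {ω} t₂))))

      -- If nothing is gained at `u₂`, both arcs there are empty and the chord joins `u₁` to `u₃`;
      -- so it leads past `u₄` just as well. If nothing is gained there either, the cycle consists
      -- of the four feet and `u₂` has no neighbour in `D`.
      oneFoot : ∀ c → Ready c → ∀ {σ v τ β ω w a Z b D′} → let open Config c in u₁ ∷ a₁ ≡ σ ++ v ∷ τ → a₂ ≡ β ++ ω → w ≡ hd ω u₃ →
                v ~ a → Ch _~_ a Z b → b ~ w → Z ++ D′ ↭ D → Outcome c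
      oneFoot c r {σ} {v} {τ} {β} {ω} {w} {a} {Z} {b} {D′} e₁ e₂ e₃ va cZ bw pZ with coreSplit c {σ} {v} {τ} {β} {ω} e₁ e₂ e₃ va cZ bw pZ
      ... | inj₁ o = o
      ... | inj₂ (f₁ , f₂ , noD) with only σ (trans (cong (_ ∷_) (sym f₁)) e₁) | none β (trans (sym f₂) e₂)
        where
        only : ∀ σ {u} → u ∷ [] ≡ σ ++ v ∷ τ → v ≡ u
        only [] refl = refl
        only (_ ∷ []) ()
        only (_ ∷ _ ∷ _) ()
        none : ∀ β → [] ≡ β ++ ω → ω ≡ []
        none [] e = sym e
      ... | refl | refl with coreSplit (rot (rot c)) {[]} {Config.u₃ c} {Config.a₃ c} {Config.a₄ c} {[]} refl (sym (++-identityʳ _)) refl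
                               (subst (_~ b) e₃ (~sym bw)) (Ch-rev ~sym cZ) (~sym va) (++⁺ʳ D′ (↭-reverse Z) ∙ pZ)
      ... | inj₁ o = unrot c (unrot (rot c) o)
      ... | inj₂ (f₃ , f₄ , _) = inj₁ (special c r f₁ f₂ f₃ f₄ noD)

      -- Classification of chords

      data Near (c : Config) (v w : V) : Set where
        near₁ : let open Config c in InSeg u₁ a₁ u₂ v → InSeg u₁ a₁ u₂ w → Near c v w
        near₂ : let open Config c in InSeg u₂ a₂ u₃ v → InSeg u₂ a₂ u₃ w → Near c v w
        near₃ : let open Config c in InSeg u₃ a₃ u₄ v → InSeg u₃ a₃ u₄ w → Near c v w
        near₄ : let open Config c in InSeg u₄ a₄ u₁ v → InSeg u₄ a₄ u₁ w → Near c v w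

      Verdict : Config → V → V → Set
      Verdict c v w = Near c v w ⊎ Outcome c

      unturnV : ∀ c {v w} → Verdict (rot c) v w → Verdict c v w
      unturnV c (inj₁ (near₁ p q)) = inj₁ (near₂ p q)
      unturnV c (inj₁ (near₂ p q)) = inj₁ (near₃ p q)
      unturnV c (inj₁ (near₃ p q)) = inj₁ (near₄ p q)
      unturnV c (inj₁ (near₄ p q)) = inj₁ (near₁ p q)
      unturnV c (inj₂ o) = inj₂ (unrot c o)

      symV : ∀ c {v w} → Verdict c v w → Verdict c w v
      symV c (inj₁ (near₁ p q)) = inj₁ (near₁ q p)
      symV c (inj₁ (near₂ p q)) = inj₁ (near₂ q p)
      symV c (inj₁ (near₃ p q)) = inj₁ (near₃ q p)
      symV c (inj₁ (near₄ p q)) = inj₁ (near₄ q p)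
      symV c (inj₂ o) = inj₂ o

      record Chord (c : Config) (v w : V) : Set where
        constructor chord
        field
          {a b} : V
          {Z D′} : List V
          va : v ~ a
          path : Ch _~_ a Z b
          bw : b ~ w
          perm : Z ++ D′ ↭ Config.D c

      symC : ∀ {c v w} → Chord c v w → Chord c w v
      symC (chord {Z = Z} {D′} va p bw pe) = chord (~sym bw) (Ch-rev ~sym p) (~sym va) (++⁺ʳ D′ (↭-reverse Z) ∙ pe)

      inSeg : ∀ {u : V} {a l} u′ → l ∈ u ∷ a → InSeg u a u′ l
      inSeg u′ (here e) = inj₁ e
      inSeg u′ (there m) = inj₂ (inj₁ m)

      pair₁₂ : ∀ c → Ready c → ∀ {v w} → Chord c v w → let open Config c in v ∈ u₁ ∷ a₁ → w ∈ u₂ ∷ a₂ → Verdict c v w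
      pair₁₂ c r ch v∈ (here e) = inj₁ (near₁ (inSeg _ v∈) (inj₂ (inj₂ e)))
      pair₁₂ c r (chord va p bw pe) v∈ (there m) with ∈-∃++ v∈ | ∈-∃++ m
      ... | σ , τ , e | β , τ′ , e′ = inj₂ (oneFoot c r {σ} {τ = τ} {β} e e′ refl va p bw pe)

      -- A chord between opposite segments that ends in a foot leads past a single foot on one side;
      -- with both ends inside arcs it separates the feet two and two.
      pair₁₃ : ∀ c → Ready c → ∀ {v w} → Chord c v w → let open Config c in v ∈ u₁ ∷ a₁ → w ∈ u₃ ∷ a₃ → Verdict c v w
      pair₁₃ c r (chord va p bw pe) v∈ (here refl) with ∈-∃++ v∈
      ... | σ , τ , e = inj₂ (oneFoot c r {σ} {τ = τ} {Config.a₂ c} {[]} e (sym (++-identityʳ _)) refl va p bw pe)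
      pair₁₃ c r ch (here refl) w∈@(there _) with symC ch
      ... | chord va p bw pe with ∈-∃++ w∈
      ... | σ , τ , e = inj₂ (unrot c (unrot (rot c) (oneFoot (rot (rot c)) (rotReady (rot c) (rotReady c r)) {σ} {τ = τ} {Config.a₄ c} {[]} e (sym (++-identityʳ _)) refl va p bw pe)))
      pair₁₃ c r (chord va p bw pe) (there m) (there m′) with ∈-∃++ m | ∈-∃++ m′
      ... | _ , _ , e | _ , _ , e′ = inj₂ (twoTwo c e e′ va p bw pe)

      pair₁ : ∀ c → Ready c → ∀ {v w} → Chord c v w → let open Config c in v ∈ u₁ ∷ a₁ → w ∈ K → Verdict c v w
      pair₁ c r ch v∈ w∈ with ∈-++⁻ (_ ∷ Config.a₁ c) w∈
      ... | inj₁ m = inj₁ (near₁ (inSeg _ v∈) (inSeg _ m))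
      ... | inj₂ w∈′ with ∈-++⁻ (_ ∷ Config.a₂ c) w∈′
      ... | inj₁ m = pair₁₂ c r ch v∈ m
      ... | inj₂ w∈″ with ∈-++⁻ (_ ∷ Config.a₃ c) w∈″
      ... | inj₁ m = pair₁₃ c r ch v∈ m
      ... | inj₂ m = symV c (unturnV c (unturnV (rot c) (unturnV (rot (rot c))
            (pair₁₂ (rot (rot (rot c))) (rotReady (rot (rot c)) (rotReady (rot c) (rotReady c r))) (move (symC ch)) m v∈))))
        where
        move : ∀ {v w} → Chord c v w → Chord (rot (rot (rot c))) v w
        move (chord va p bw pe) = chord va p bw pe

      turn∈ : ∀ c {w} → w ∈ Config.K c → w ∈ Config.K (rot c)
      turn∈ c = ∈-resp-↭ (rot4 (u₁ ∷ a₁) (u₂ ∷ a₂) (u₃ ∷ a₃) (u₄ ∷ a₄))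
        where open Config c

      turnC : ∀ c {v w} → Chord c v w → Chord (rot c) v w
      turnC c (chord va p bw pe) = chord va p bw pe

      pair : ∀ c → Ready c → ∀ {v w} → Chord c v w → v ∈ Config.K c → w ∈ Config.K c → Verdict c v w
      pair c r ch v∈ w∈ with ∈-++⁻ (_ ∷ Config.a₁ c) v∈
      ... | inj₁ m = pair₁ c r ch m w∈
      ... | inj₂ v∈′ with ∈-++⁻ (_ ∷ Config.a₂ c) v∈′
      ... | inj₁ m = unturnV c (pair₁ (rot c) (rotReady c r) (turnC c ch) m (turn∈ c w∈))
      ... | inj₂ v∈″ with ∈-++⁻ (_ ∷ Config.a₃ c) v∈″
      ... | inj₁ m = unturnV c (unturnV (rot c) (pair₁ (rot (rot c)) (rotReady (rot c) (rotReady c r)) (turnC (rot c) (turnC c ch)) m (turn∈ (rot c) (turn∈ c w∈))))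
      ... | inj₂ m = unturnV c (unturnV (rot c) (unturnV (rot (rot c)) (pair₁ (rot (rot (rot c))) (rotReady (rot (rot c)) (rotReady (rot c) (rotReady c r)))
            (turnC (rot (rot c)) (turnC (rot c) (turnC c ch))) m (turn∈ (rot (rot c)) (turn∈ (rot c) (turn∈ c w∈))))))

      record Sorted (c : Config) (F : List V) : Set where
        constructor sorted
        open Config c
        field
          J₁ J₂ J₃ J₄ : List (Item U)
          m₁ : All (InSeg u₁ a₁ u₂) (labs J₁)
          m₂ : All (InSeg u₂ a₂ u₃) (labs J₂)
          m₃ : All (InSeg u₃ a₃ u₄) (labs J₃)
          m₄ : All (InSeg u₄ a₄ u₁) (labs J₄)
          perm : flat J₁ ++ flat J₂ ++ flat J₃ ++ flat J₄ ↭ F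

      -- An item is a path of the square, but the middle vertices of its links lie in `D`; inserting
      -- them and simplifying gives a path of the graph through `D`, that is, a chord between its
      -- labels.
      sort : ∀ c → Ready c → (js : List (Item (_∈ Config.D c))) → All (_∈ Config.D c) (flat js) → All (_∈ Config.K c) (labs js) → Outcome c ⊎ Sorted c (flat js)
      sort c r [] _ _ = inj₂ (sorted [] [] [] [] [] [] [] [] ↭-refl)
      sort c r (mkItem {s} {a} {b} {t} {xs} ch sa bt ∷ js) inD (ms ∷ mt ∷ ml) with sort c r js (AllP.++⁻ʳ xs inD) ml | through ch (AllP.++⁻ˡ xs inD)
      ... | inj₁ o | _ = inj₁ o
      ... | inj₂ so | ys , p , ally with simple p
      ... | zs , q , uz , sub with takeOut zs uz (All.map (All.lookup ally) sub)
      ... | D′ , pD with pair c r (chord sa q bt pD) ms mt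
      ... | inj₂ o = inj₁ o
      ... | inj₁ nr = inj₂ (add nr so)
        where
        i : Item U
        i = mkItem (Ch-map (Lk-map (λ _ → tt)) ch) sa bt
        add : Near c s t → Sorted c (flat js) → Sorted c (xs ++ flat js)
        add (near₁ p q) (sorted J₁ J₂ J₃ J₄ m₁ m₂ m₃ m₄ pe) = sorted (i ∷ J₁) J₂ J₃ J₄ (p ∷ q ∷ m₁) m₂ m₃ m₄
          (solve 5 (λ x a b c d → (x ⊕ a) ⊕ b ⊕ c ⊕ d ⊜ x ⊕ a ⊕ b ⊕ c ⊕ d) refl (xs ∷ (flat J₁) ∷ (flat J₂) ∷ (flat J₃) ∷ (flat J₄) ∷ []) ∙ ++⁺ˡ xs pe)
        add (near₂ p q) (sorted J₁ J₂ J₃ J₄ m₁ m₂ m₃ m₄ pe) = sorted J₁ (i ∷ J₂) J₃ J₄ m₁ (p ∷ q ∷ m₂) m₃ m₄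
          (solve 5 (λ x a b c d → a ⊕ (x ⊕ b) ⊕ c ⊕ d ⊜ x ⊕ a ⊕ b ⊕ c ⊕ d) refl (xs ∷ (flat J₁) ∷ (flat J₂) ∷ (flat J₃) ∷ (flat J₄) ∷ []) ∙ ++⁺ˡ xs pe)
        add (near₃ p q) (sorted J₁ J₂ J₃ J₄ m₁ m₂ m₃ m₄ pe) = sorted J₁ J₂ (i ∷ J₃) J₄ m₁ m₂ (p ∷ q ∷ m₃) m₄
          (solve 5 (λ x a b c d → a ⊕ b ⊕ (x ⊕ c) ⊕ d ⊜ x ⊕ a ⊕ b ⊕ c ⊕ d) refl (xs ∷ (flat J₁) ∷ (flat J₂) ∷ (flat J₃) ∷ (flat J₄) ∷ []) ∙ ++⁺ˡ xs pe)
        add (near₄ p q) (sorted J₁ J₂ J₃ J₄ m₁ m₂ m₃ m₄ pe) = sorted J₁ J₂ J₃ (i ∷ J₄) m₁ m₂ m₃ (p ∷ q ∷ m₄)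
          (solve 5 (λ x a b c d → a ⊕ b ⊕ c ⊕ (x ⊕ d) ⊜ x ⊕ a ⊕ b ⊕ c ⊕ d) refl (xs ∷ (flat J₁) ∷ (flat J₂) ∷ (flat J₃) ∷ (flat J₄) ∷ []) ∙ ++⁺ˡ xs pe)

      outcome : ∀ c → Ready c → Outcome c
      outcome c r with sort c r (Ready.is r) (All-resp-↭ (↭-sym (Ready.fl r)) (All.tabulate (λ m → m))) (Ready.lab r)
      ... | inj₁ o = o
      ... | inj₂ (sorted J₁ J₂ J₃ J₄ m₁ m₂ m₃ m₄ pe) = inj₁ (assemble c r (pe ∙ fl)
            (worldA (sta u₁ (Still.tok′ s₁)) a₁ (sta u₂ (Still.tok′ s₂)) a₂ (sta u₃ (Still.tok′ s₃)) a₃ (sta u₄ (Still.tok′ s₄)) a₄ J₁ J₂ J₃ J₄ uK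
              (round4 {a₁ = a₁} {a₂ = a₂} {a₃ = a₃} t₁ t₂ t₃ t₄) m₁ m₂ m₃ m₄))
        where
        open Config c
        open Ready r

      prepare : ∀ c → Cyc (TS ++ VS) ⊎ Ready c
      prepare c = go (settle c) (settle (rot c)) (settle (rot (rot c))) (settle (rot (rot (rot c))))
        where
        open Config c
        Goal : Set
        Goal = Cyc (TS ++ VS) ⊎ Ready c
        done : Still l₁ D → Still l₂ D → Still l₃ D → Still l₄ D → (∃ λ (is : List (Item (_∈ D))) → flat is ↭ D × All (_∈ K ++ O) (labs is)) → Goal
        done s₁ s₂ s₃ s₄ (is , fl , lab) = inj₂ (ready s₁ s₂ s₃ s₄ is fl (All.zipWith (λ { (m , (d , d∈ , e)) → onK (∈-++⁻ K m) (∈-resp-↭ fl d∈) e }) (lab , labAdj is)))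
          where
          onK : ∀ {l d} → l ∈ K ⊎ l ∈ O → d ∈ D → l ~ d → l ∈ K
          onK (inj₁ m) _ _ = m
          onK (inj₂ m) d∈ e with ∈-++⁻ B₁ m
          ... | inj₁ k = ⊥-elim (Still.noD s₁ k d∈ e)
          ... | inj₂ m with ∈-++⁻ B₂ m
          ... | inj₁ k = ⊥-elim (Still.noD s₂ k d∈ e)
          ... | inj₂ m with ∈-++⁻ B₃ m
          ... | inj₁ k = ⊥-elim (Still.noD s₃ k d∈ e)
          ... | inj₂ k = ⊥-elim (Still.noD s₄ k d∈ e)
        go : Cyc (TS ++ VS) ⊎ Still l₁ D → Cyc (TS ++ VS) ⊎ Still l₂ D → Cyc (TS ++ VS) ⊎ Still l₃ D → Cyc (TS ++ VS) ⊎ Still l₄ D → Goal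
        go (inj₁ x) _ _ _ = inj₁ x
        go _ (inj₁ x) _ _ = inj₁ x
        go _ _ (inj₁ x) _ = inj₁ x
        go _ _ _ (inj₁ x) = inj₁ x
        go (inj₂ s₁) (inj₂ s₂) (inj₂ s₃) (inj₂ s₄) = done s₁ s₂ s₃ s₄ (partition (length D) {K ++ O} ℕP.≤-refl perm (here refl))

      -- Every step but the last one lengthens the legs.
      cycle : ∀ n c → length VS ≤ n + length (Config.O c) → Cyc (TS ++ VS)
      cycle n c le = [ (λ x → x) , (λ r → next n le (outcome c r)) ]′ (prepare c)
        where
        open Config c
        -- The cycle is not empty, so the legs never exhaust `VS`.
        small : suc (length O) ≤ length VS
        small = subst (suc (length O) ≤_) (trans (sym (length-++ (K ++ O))) (↭-length perm))
          (ℕP.≤-trans (subst (suc (length O) ≤_) (sym (length-++ K)) (ℕP.+-monoˡ-≤ (length O) (s≤s {n = length (a₁ ++ (u₂ ∷ a₂) ++ (u₃ ∷ a₃) ++ u₄ ∷ a₄)} z≤n))) (ℕP.m≤m+n _ (length D)))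
        next : ∀ n → length VS ≤ n + length O → Outcome c → Cyc (TS ++ VS)
        next _ _ (inj₁ x) = x
        next zero le (inj₂ _) = ⊥-elim (ℕP.<-irrefl refl (ℕP.≤-trans small le))
        next (suc n′) le (inj₂ (c′ , e , E , p)) = cycle n′ c′ (ℕP.≤-trans le (subst (_≤ n′ + length (Config.O c′)) (ℕP.+-suc n′ (length O))
            (ℕP.+-monoʳ-≤ n′ (subst (suc (length O) ≤_) (sym (↭-length p)) (s≤s (subst (length O ≤_) (sym (length-++ E)) (ℕP.m≤n+m _ _)))))))

    -- Menger's theorem for two paths

    record Linkage (A B : List V) : Set where
      constructor linkage
      field
        {s t s′ t′} : V
        {P Q} : List V
        path : Ch _~_ s P t
        path′ : Ch _~_ s′ Q t′
        s∈ : s ∈ A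
        s′∈ : s′ ∈ A
        t∈ : t ∈ B
        t′∈ : t′ ∈ B
        uniq : Unique (P ++ Q)
        inVS : All (_∈ VS) (P ++ Q)

    module _ {A B : List V} {b b′ : V} (b′∈ : b′ ∈ B) (b′∈VS : b′ ∈ VS) (b≢b′ : b ≢ b′) (b∈ : b ∈ B) where

      -- The path H z L₂ ends at b and a disjoint path from A ends next to z.  Avoiding z, one of the two is
      -- prolonged to a later vertex of L₂ or to another vertex of B.
      augment : ∀ n H z L₂ {s s′ x X} → length L₂ ≤ n → Ch _~_ s (H ++ z ∷ L₂) b → s ∈ A → Ch _~_ s′ X x → s′ ∈ A → x ~ z →
                Unique (X ++ H ++ z ∷ L₂) → All (_∈ VS) (X ++ H ++ z ∷ L₂) → Linkage A B

      -- Hitting `L₂` at `t` leads back to the situation of `augment`, with `t` for `z` and a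
      -- shorter remainder behind it; hitting `B` elsewhere completes the pair of paths.
      extend : ∀ n H z L₂ Y R {s s′ t r} → length L₂ ≤ n → Ch _~_ s (H ++ z ∷ L₂) b → s ∈ A → Ch _~_ s′ (Y ++ R) r → s′ ∈ A → r ~ t →
               Unique ((Y ++ R) ++ H ++ z ∷ L₂) → All (_∈ VS) ((Y ++ R) ++ H ++ z ∷ L₂) → t ∈ VS →
               t ∈ L₂ ⊎ (t ∈ B × t ∉ (Y ++ R) ++ H ++ z ∷ L₂) → Linkage A B
      extend n H z L₂ Y R le cL s∈ cY s′∈ rt u al t∈VS (inj₂ (t∈B , t∉)) =
        linkage cL (Ch-++ cY rt one) s∈ s′∈ b∈ t∈B (Unique-resp p (Unique-add _ u ([] ∷ []) (λ { (here refl) → t∉ }))) (All-resp-↭ p (AllP.++⁺ al (t∈VS ∷ [])))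
        where
        p : ∀ {t} → ((Y ++ R) ++ H ++ z ∷ L₂) ++ t ∷ [] ↭ (H ++ z ∷ L₂) ++ (Y ++ R) ++ t ∷ []
        p {t} = solve 3 (λ y l t → (y ⊕ l) ⊕ t ⊜ l ⊕ y ⊕ t) refl ((Y ++ R) ∷ (H ++ z ∷ L₂) ∷ (t ∷ []) ∷ [])
      extend n H z L₂ Y R le cL s∈ cY s′∈ rt u al t∈VS (inj₁ t∈) with ∈-∃++ t∈
      ... | M , N , refl with n
      ... | zero = ⊥-elim (nz M le)
        where
        nz : ∀ M {t N} → ¬ (length (M ++ t ∷ N) ≤ 0)
        nz [] ()
        nz (_ ∷ _) ()
      ... | suc n′ = augment n′ (H ++ z ∷ M) _ N (shorter M le) (subst (λ w → Ch _~_ _ w b) e cL) s∈ cY s′∈ rt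
            (subst (λ w → Unique ((Y ++ R) ++ w)) e u) (subst (λ w → All (_∈ VS) ((Y ++ R) ++ w)) e al)
        where
        e : ∀ {t N} → H ++ z ∷ M ++ t ∷ N ≡ (H ++ z ∷ M) ++ t ∷ N
        e {t} {N} = sym (++-assoc H (z ∷ M) (t ∷ N))
        shorter : ∀ M {t N} → length (M ++ t ∷ N) ≤ suc n′ → length N ≤ n′
        shorter [] (s≤s le) = le
        shorter (_ ∷ M) {t} {N} (s≤s le) = ℕP.≤-trans (subst (length N ≤_) (sym (length-++ M)) (ℕP.≤-trans (ℕP.n≤1+n _) (ℕP.m≤n+m _ _))) le

      augment n H z L₂ {s} {s′} {x} {X} le cL s∈ cX s′∈ xz u al = byEnd L₂ refl
        where
        L = H ++ z ∷ L₂
        ∈VS : ∀ {v} → v ∈ X ++ L → v ∈ VS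
        ∈VS = All.lookup al
        z∈ : z ∈ X ++ L
        z∈ = ∈-++⁺ʳ X (∈-++⁺ʳ H (here refl))
        x∈X : x ∈ X
        x∈X = ch-last cX
        x≢z : x ≢ z
        x≢z refl = Unique-disj X u x∈X (∈-++⁺ʳ H (here refl))
        uXH : Unique ((X ++ H) ++ z ∷ L₂)
        uXH = Unique-resp (↭-reflexive (sym (++-assoc X H (z ∷ L₂)))) u
        Target : V → Set
        Target v = v ∈ L₂ ⊎ (v ∈ B × v ∉ X ++ L)
        target? : ∀ v → Dec (Target v)
        target? v = (v ∈? L₂) ⊎-dec ((v ∈? B) ×-dec ¬? (v ∈? X ++ L))
        split : ∀ {t δ γ w} → γ ++ w ∷ δ ≡ γ ++ w ∷ δ → Ch _~_ t (t ∷ γ ++ w ∷ δ) x → ∃ λ r → Ch _~_ w (w ∷ reverse γ) r × r ~ t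
        split {t} {δ} {γ} {w} _ c with chInit (w ∷ reverse γ) (subst (λ q → Ch _~_ w q t) e (Ch-rev ~sym (chTo (t ∷ γ) c)))
          where
          e : reverse ((t ∷ γ) ++ w ∷ []) ≡ (w ∷ reverse γ) ++ t ∷ []
          e = trans (reverse-++ (t ∷ γ) (w ∷ [])) (cong (w ∷_) (unfold-reverse t γ))
        ... | inj₂ (r , c′ , e) = r , c′ , e
        toward : ∀ {y} → y ∈ VS → y ≢ z → Target y → Linkage A B
        toward y∈ y≢z ty with conn (∈VS z∈) (∈VS (∈-++⁺ˡ x∈X)) y∈ x≢z y≢z
        ... | q₀ , c₀ , al₀ with simple c₀
        -- Only a piece of this walk is used: from its last vertex on `X` or `H` before the first
        -- target, up to that target. In between it avoids both paths.
        ... | q , c , uq , sub with first target? q (lose (ch-last c) ty)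
        ... | α , t , β , refl , nα , tt′ with Ch-rev ~sym (chTo α c)
        ... | c₁ with subst (λ w → Ch _~_ t w x) (reverse-++ α (t ∷ [])) c₁
        ... | c₂ = cut (first (λ v → v ∈? X ++ H) (reverse α) (lose x∈rα (∈-++⁺ˡ x∈X)))
          where
          t≢x : t ≢ x
          t≢x refl = [ (λ k → Unique-disj X u x∈X (∈-++⁺ʳ H (there k))) , (λ k → proj₂ k (∈-++⁺ˡ x∈X)) ]′ tt′
          x∈rα : x ∈ reverse α
          x∈rα with ch-last c₂
          ... | here e = ⊥-elim (t≢x (sym e))
          ... | there m = m
          inα : ∀ {v} → v ∈ reverse α → v ∈ α
          inα = ∈-resp-↭ (↭-reverse α)
          okα : ∀ {v} → v ∈ α → v ∈ VS × v ≢ z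
          okα m = All.lookup al₀ (All.lookup sub (∈-++⁺ˡ m))
          t∈VS : t ∈ VS
          t∈VS = proj₁ (All.lookup al₀ (All.lookup sub (∈-++⁺ʳ α (here refl))))
          cut : (∃ λ γ → ∃ λ w → ∃ λ δ → reverse α ≡ γ ++ w ∷ δ × All (λ v → ¬ (v ∈ X ++ H)) γ × w ∈ X ++ H) → Linkage A B
          cut (γ , w , δ , e , nγ , w∈) with split {γ = γ} refl (subst (λ k → Ch _~_ t (t ∷ k) x) e c₂)
          ... | r , cR , rt = side (∈-++⁻ X w∈)
            where
            R = reverse γ
            γ⊆α : ∀ {v} → v ∈ γ → v ∈ α
            γ⊆α m = inα (subst (_ ∈_) (sym e) (∈-++⁺ˡ m))
            uγ : Unique γ
            uγ = Unique-++ˡ γ (subst Unique e (Unique-resp (↭-sym (↭-reverse α)) (Unique-++ˡ α uq)))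
            R# : ∀ {v} → v ∈ R → v ∉ X ++ L
            R# m k with ∈-resp-↭ (↭-reverse γ) m
            ... | m′ with ∈-++⁻ (X ++ H) (∈-subst (sym (++-assoc X H (z ∷ L₂))) k)
            ... | inj₁ k′ = All.lookup nγ m′ k′
            ... | inj₂ (here refl) = proj₂ (okα (γ⊆α m′)) refl
            ... | inj₂ (there k′) = All.lookup nα (γ⊆α m′) (inj₁ k′)
            uAll : Unique ((X ++ L) ++ R)
            uAll = Unique-add (X ++ L) u (Unique-resp (↭-sym (↭-reverse γ)) uγ) R#
            alAll : All (_∈ VS) ((X ++ L) ++ R)
            alAll = AllP.++⁺ al (All.tabulate (λ m → proj₁ (okα (γ⊆α (∈-resp-↭ (↭-reverse γ) m)))))
            t∉R : t ∉ R
            t∉R m = All.lookup nα (γ⊆α (∈-resp-↭ (↭-reverse γ) m)) tt′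
            aim : ∀ {ys} → (∀ {v} → v ∈ ys → v ∈ (X ++ L) ++ R) → t ∈ L₂ ⊎ (t ∈ B × t ∉ ys)
            aim sub′ = [ inj₁ , (λ k → inj₂ (proj₁ k , λ m → [ proj₂ k , t∉R ]′ (∈-++⁻ (X ++ L) (sub′ m)))) ]′ tt′
            side : w ∈ X ⊎ w ∈ H → Linkage A B
            side (inj₁ w∈X) with ∈-∃++ w∈X
            ... | X₁ , X₂ , refl = extend n H z L₂ X₁ (w ∷ R) le cL s∈ (chGlue X₁ (chTo X₁ cX) cR) s′∈ rt
                  (Unique-++ˡ N (Unique-resp p uAll)) (AllP.++⁻ˡ N (All-resp-↭ p alAll)) t∈VS (aim (λ m → ∈-resp-↭ (↭-sym p) (∈-++⁺ˡ m)))
              where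
              N = (X₁ ++ w ∷ R) ++ H ++ z ∷ L₂
              p : ((X₁ ++ w ∷ X₂) ++ L) ++ R ↭ N ++ X₂
              p = solve 5 (λ a w b l r → ((a ⊕ w ⊕ b) ⊕ l) ⊕ r ⊜ ((a ⊕ w ⊕ r) ⊕ l) ⊕ b) refl (X₁ ∷ [ w ] ∷ X₂ ∷ L ∷ R ∷ [])
            -- The piece leaves from `H`, so the paths exchange roles: `X` continues through `z`
            -- along `L₂`, and the beginning of `H` takes the new piece.
            side (inj₂ w∈H) with ∈-∃++ w∈H
            ... | H₁ , H₂ , refl = extend n X z L₂ H₁ (w ∷ R) le (Ch-++ cX xz (chFrom (H₁ ++ w ∷ H₂) cL)) s′∈
                  (chGlue H₁ (chTo H₁ (subst (λ k → Ch _~_ s k b) (++-assoc H₁ (w ∷ H₂) (z ∷ L₂)) cL)) cR) s∈ rt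
                  (Unique-++ˡ N (Unique-resp p uAll)) (AllP.++⁻ˡ N (All-resp-↭ p alAll)) t∈VS (aim (λ m → ∈-resp-↭ (↭-sym p) (∈-++⁺ˡ m)))
              where
              N = (H₁ ++ w ∷ R) ++ X ++ z ∷ L₂
              p : (X ++ (H₁ ++ w ∷ H₂) ++ z ∷ L₂) ++ R ↭ N ++ H₂
              p = solve 6 (λ x a w b l r → (x ⊕ (a ⊕ w ⊕ b) ⊕ l) ⊕ r ⊜ ((a ⊕ w ⊕ r) ⊕ x ⊕ l) ⊕ b) refl (X ∷ H₁ ∷ [ w ] ∷ H₂ ∷ (z ∷ L₂) ∷ R ∷ [])
        byEnd : ∀ M → M ≡ L₂ → Linkage A B
        byEnd (y ∷ M) refl = toward (∈VS (∈-++⁺ʳ X (∈-++⁺ʳ H (there m)))) (λ { refl → Unique-disj (z ∷ []) (Unique-++ʳ (X ++ H) uXH) (here refl) m }) (inj₁ m)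
          where
          lastIn : ∀ {a} → Ch _~_ z (z ∷ y ∷ M) a → a ∈ y ∷ M
          lastIn (l ◅ c) = ch-last c
          m : b ∈ y ∷ M
          m = lastIn (chFrom H cL)
        -- Here `z` is `b`, so the other path must end at a different vertex of `B`, and `b′` is
        -- aimed at. If `b′` already lies on one of the paths, that path is cut there and the other
        -- one ends at `b`.
        byEnd [] refl with zb (chFrom H cL)
          where
          zb : Ch _~_ z (z ∷ []) b → z ≡ b
          zb one = refl
        ... | refl with b′ ∈? X ++ L
        ... | no n = toward b′∈VS (λ e → b≢b′ (sym e)) (inj₂ (b′∈ , n))
        ... | yes m with ∈-++⁻ X m
        ... | inj₁ k with ∈-∃++ k
        ... | X₁ , X₂ , refl = linkage cL (chTo X₁ cX) s∈ s′∈ b∈ b′∈ (Unique-++ˡ N (Unique-resp p u)) (AllP.++⁻ˡ N (All-resp-↭ p al))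
              where
              N = L ++ X₁ ++ b′ ∷ []
              p : (X₁ ++ b′ ∷ X₂) ++ L ↭ N ++ X₂
              p = solve 4 (λ a w b l → (a ⊕ w ⊕ b) ⊕ l ⊜ (l ⊕ a ⊕ w) ⊕ b) refl (X₁ ∷ [ b′ ] ∷ X₂ ∷ L ∷ [])
        byEnd [] refl | refl | yes m | inj₂ k with ∈-++⁻ H k
        ... | inj₂ (here e) = ⊥-elim (b≢b′ (sym e))
        ... | inj₁ k′ with ∈-∃++ k′
        ... | H₁ , H₂ , refl = linkage (Ch-++ cX xz one) (chTo H₁ (subst (λ q → Ch _~_ s q b) (++-assoc H₁ (b′ ∷ H₂) (b ∷ [])) cL)) s′∈ s∈ b∈ b′∈
              (Unique-++ˡ N (Unique-resp p u)) (AllP.++⁻ˡ N (All-resp-↭ p al))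
              where
              N = (X ++ b ∷ []) ++ H₁ ++ b′ ∷ []
              p : X ++ (H₁ ++ b′ ∷ H₂) ++ b ∷ [] ↭ N ++ H₂
              p = solve 5 (λ x a w b l → x ⊕ (a ⊕ w ⊕ b) ⊕ l ⊜ ((x ⊕ l) ⊕ a ⊕ w) ⊕ b) refl (X ∷ H₁ ∷ [ b′ ] ∷ H₂ ∷ [ b ] ∷ [])

      begin : ∀ {s L s′} → Ch _~_ s L b → s ∈ A → Unique L → All (_∈ VS) L → s′ ∈ A → s′ ∈ VS → s′ ∉ L → Linkage A B
      begin {s} {L} {s′} cL s∈ uL alL s′∈ s′∈VS s′∉ with conn₀ s′∈VS (All.lookup alL (ch-head cL))
      ... | q₀ , c₀ , al₀ with simple c₀
      ... | q , c , uq , sub with first (_∈? L) q (lose (ch-last c) (ch-head cL))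
      ... | α , z , β , refl , nα , z∈ with ∈-∃++ z∈ | chInit α (chTo α c)
      ... | _ | inj₁ refl = ⊥-elim (s′∉ (start-z c z∈))
        where
        start-z : ∀ {z β a} → Ch _~_ s′ (z ∷ β) a → z ∈ L → s′ ∈ L
        start-z one m = m
        start-z (_ ◅ _) m = m
      ... | H , L₂ , refl | inj₂ (x , cX , xz) = augment (length L₂) H z L₂ ℕP.≤-refl cL s∈ cX s′∈ xz
            (Unique-add α (Unique-++ˡ α uq) uL (λ m k → All.lookup nα k m))
            (AllP.++⁺ {xs = α} (All.tabulate (λ m → All.lookup al₀ (All.lookup sub (∈-++⁺ˡ m)))) alL)

    -- Should the path from `a` to `b` pass through `a′`, its part from `a′` on is kept and `a`
    -- becomes the start of the second path.
    linked : ∀ {A B a a′ b b′} → a ∈ A → a′ ∈ A → a ≢ a′ → b ∈ B → b′ ∈ B → b ≢ b′ → All (_∈ VS) A → All (_∈ VS) B → Linkage A B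
    linked {A} {B} {a} {a′} a∈ a′∈ a≢ b∈ b′∈ b≢ alA alB with conn₀ (All.lookup alA a∈) (All.lookup alB b∈)
    ... | q₀ , c₀ , al₀ with simple c₀
    ... | q , c , uq , sub with a′ ∈? q
    ... | no n = begin b′∈ (All.lookup alB b′∈) b≢ b∈ c a∈ uq (All.map (All.lookup al₀) sub) a′∈ (All.lookup alA a′∈) n
    ... | yes m with ∈-∃++ m
    ... | α , β , refl = begin b′∈ (All.lookup alB b′∈) b≢ b∈ (chFrom α c) a′∈ (Unique-++ʳ α uq) (AllP.++⁻ʳ α (All.map (All.lookup al₀) sub)) a∈ (All.lookup alA a∈)
          (λ k → Unique-disj α uq (a∈α α c) k)
      where
      a∈α : ∀ α {β e} → Ch _~_ a (α ++ a′ ∷ β) e → a ∈ α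
      a∈α [] one = ⊥-elim (a≢ refl)
      a∈α [] (_ ◅ _) = ⊥-elim (a≢ refl)
      a∈α (_ ∷ []) (_ ◅ _) = here refl
      a∈α (_ ∷ _ ∷ _) (_ ◅ _) = here refl

    record Link (A B P : List V) : Set where
      constructor link
      field
        {α β} : List V
        {p q} : V
        w : List V
        eq : P ≡ α ++ (p ∷ w) ++ q ∷ β
        p∈ : p ∈ A
        q∈ : q ∈ B
        to : To (p ∷ w) q
        offA : All (_∉ A) w
        offB : All (_∉ B) w

    -- The path is cut at its first vertex in `B` and then at the last vertex in `A` before it, so
    -- that the vertices in between avoid both lists.
    trim : ∀ {A B s t P} → (∀ {v} → v ∈ A → v ∉ B) → Ch _~_ s P t → s ∈ A → t ∈ B → Link A B P
    trim {A} {B} {s} {t} {P} A#B c s∈ t∈ with first (_∈? B) P (lose (ch-last c) t∈)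
    ... | μ , q , β , refl , nμ , q∈ = go (first (_∈? A) (reverse μ) (lose (∈-resp-↭ (↭-sym (↭-reverse μ)) (s∈μ μ c)) s∈))
      where
      s∈μ : ∀ μ {t} → Ch _~_ s (μ ++ q ∷ β) t → s ∈ μ
      s∈μ [] one = ⊥-elim (A#B s∈ q∈)
      s∈μ [] (_ ◅ _) = ⊥-elim (A#B s∈ q∈)
      s∈μ (_ ∷ []) (_ ◅ _) = here refl
      s∈μ (_ ∷ _ ∷ _) (_ ◅ _) = here refl
      go : (∃ λ γ → ∃ λ p → ∃ λ δ → reverse μ ≡ γ ++ p ∷ δ × All (_∉ A) γ × p ∈ A) → Link A B (μ ++ q ∷ β)
      go (γ , p , δ , e , nγ , p∈) = link {α = reverse δ} (reverse γ) (trans (cong (_++ q ∷ β) eμ) (++-assoc (reverse δ) (p ∷ reverse γ) (q ∷ β))) p∈ q∈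
        (proj₂ (To-++⁻ (reverse δ) (subst (λ k → To k q) eμ (ChTo′ μ (chTo μ c)))))
        (All-resp-↭ (↭-sym (↭-reverse γ)) nγ)
        (AllP.++⁻ʳ (reverse δ ++ p ∷ []) (subst (All (_∉ B)) (trans eμ (sym (++-assoc (reverse δ) (p ∷ []) (reverse γ)))) nμ))
        where
        eμ : μ ≡ reverse δ ++ p ∷ reverse γ
        eμ = trans (sym (reverse-involutive μ)) (trans (cong reverse e) (rev-mid γ p δ))

    -- The initial cycle and its legs

    module Start (tk : V → List V) {x₁ x₂ x₃ x₄ : V} (uX : Unique (x₁ ∷ x₂ ∷ x₃ ∷ x₄ ∷ [])) (xVS : All (_∈ VS) (x₁ ∷ x₂ ∷ x₃ ∷ x₄ ∷ []))
                 (hung : ∀ {x} → x ∈ x₁ ∷ x₂ ∷ x₃ ∷ x₄ ∷ [] → Hung U x (tk x))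
                 (only : ∀ {x l t} → x ∈ x₁ ∷ x₂ ∷ x₃ ∷ x₄ ∷ [] → l ∈ VS → t ∈ tk x → l ~ t → l ≡ x) where

      TS = tk x₁ ++ tk x₂ ++ tk x₃ ++ tk x₄

      X : List V
      X = x₁ ∷ x₂ ∷ x₃ ∷ x₄ ∷ []

      -- two disjoint paths and two disjoint links between them form a cycle with four legs
      ladder : ∀ {s t s′ t′} π p ρ p′ σ π′ q ρ′ q′ σ′ w w′ → Ch _~_ s (π ++ p ∷ ρ ++ p′ ∷ σ) t → Ch _~_ s′ (π′ ++ q ∷ ρ′ ++ q′ ∷ σ′) t′ →
               To (p ∷ w) q → To (p′ ∷ w′) q′ → s ∈ X → t ∈ X → s′ ∈ X → t′ ∈ X → tk s ++ tk t ++ tk t′ ++ tk s′ ↭ TS →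
               Unique ((π ++ p ∷ ρ ++ p′ ∷ σ) ++ (π′ ++ q ∷ ρ′ ++ q′ ∷ σ′) ++ w ++ w′) → All (_∈ VS) ((π ++ p ∷ ρ ++ p′ ∷ σ) ++ (π′ ++ q ∷ ρ′ ++ q′ ∷ σ′) ++ w ++ w′) → Cyc (TS ++ VS)
      ladder {s} {t} {s′} {t′} π p ρ p′ σ π′ q ρ′ q′ σ′ w w′ c c′ tw tw′ s∈ t∈ s′∈ t′∈ pT u al with takeOut _ u al
      ... | D , pD = Tour.cycle TS (length VS) cfg (ℕP.m≤m+n _ _)
        where
        leg : ∀ {u x B} → Ch _~_ u (u ∷ B) x → x ∈ X → Leg u
        leg path x∈ = mkLeg path (hung x∈) (only x∈)
        legRev : ∀ {x u y} π {β} → Ch _~_ x (π ++ u ∷ β) y → Ch _~_ u (u ∷ reverse π) x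
        legRev {x} {u} π d = subst (λ k → Ch _~_ u k x) (reverse-++ π (u ∷ [])) (Ch-rev ~sym (chTo π d))
        seg : ∀ {x y} π p ρ p′ {σ} → Ch _~_ x (π ++ p ∷ ρ ++ p′ ∷ σ) y → To (p ∷ ρ) p′ × Ch _~_ p′ (p′ ∷ σ) y
        seg π p ρ p′ d = ChTo′ (p ∷ ρ) (chTo (p ∷ ρ) (chFrom π d)) , chFrom (p ∷ ρ) (chFrom π d)
        cfg : Tour.Config TS
        cfg = Tour.config (leg (legRev π c) s∈) (leg (proj₂ (seg π p ρ p′ c)) t∈) (leg (proj₂ (seg π′ q ρ′ q′ c′)) t′∈) (leg (legRev π′ c′) s′∈)
          ρ w′ (reverse ρ′) (reverse w) D
          (++⁺ʳ D (++⁺ (++⁺ˡ (p ∷ ρ) (++⁺ˡ (p′ ∷ w′) (++⁺ (↭-prep q′ (↭-reverse ρ′)) (↭-prep q (↭-reverse w))))) (++⁺ (↭-reverse π) (++⁺ˡ σ (++⁺ˡ σ′ (↭-reverse π′)))))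
           ∙ solve 13 (λ p r p′ w′ q′ r′ q w π σ σ′ π′ d → (((p ⊕ r) ⊕ (p′ ⊕ w′) ⊕ (q′ ⊕ r′) ⊕ q ⊕ w) ⊕ π ⊕ σ ⊕ σ′ ⊕ π′) ⊕ d
                ⊜ ((π ⊕ p ⊕ r ⊕ p′ ⊕ σ) ⊕ (π′ ⊕ q ⊕ r′ ⊕ q′ ⊕ σ′) ⊕ w ⊕ w′) ⊕ d) refl ([ p ] ∷ ρ ∷ [ p′ ] ∷ w′ ∷ [ q′ ] ∷ ρ′ ∷ [ q ] ∷ w ∷ π ∷ σ ∷ σ′ ∷ π′ ∷ D ∷ [])
           ∙ pD)
          (proj₁ (seg π p ρ p′ c)) tw′ (revTo ρ′ (proj₁ (seg π′ q ρ′ q′ c′))) (revTo w tw) pT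

      Two : List V → V → V → Set
      Two P p p′ = ∃ λ π → ∃ λ ρ → ∃ λ σ → P ≡ π ++ p ∷ ρ ++ p′ ∷ σ

      twoOn : ∀ {P p p′} → p ∈ P → p′ ∈ P → p ≢ p′ → Two P p p′ ⊎ Two P p′ p
      twoOn {p = p} {p′} m m′ ne with ∈-∃++ m
      ... | α , β , refl with ∈-++⁻ α m′
      ... | inj₂ (here e) = ⊥-elim (ne (sym e))
      ... | inj₂ (there k) with ∈-∃++ k
      ... | ρ , σ , refl = inj₁ (α , ρ , σ , refl)
      twoOn {p = p} {p′} m m′ ne | α , β , refl | inj₁ k with ∈-∃++ k
      ... | π , ρ , refl = inj₂ (π , ρ , β , ++-assoc π (p′ ∷ ρ) (p ∷ β))

      revTwo : ∀ {P p p′} → Two P p p′ → Two (reverse P) p′ p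
      revTwo {p = p} {p′} (π , ρ , σ , refl) = reverse σ , reverse ρ , reverse π ,
        trans (rev-mid π p (ρ ++ p′ ∷ σ)) (trans (cong (_++ p ∷ reverse π) (rev-mid ρ p′ σ)) (++-assoc (reverse σ) (p′ ∷ reverse ρ) (p ∷ reverse π)))

      straight : ∀ {s t s′ t′ P Q p p′ q q′} w w′ → Ch _~_ s P t → Ch _~_ s′ Q t′ → Two P p p′ → Two Q q q′ → To (p ∷ w) q → To (p′ ∷ w′) q′ →
                 s ∈ X → t ∈ X → s′ ∈ X → t′ ∈ X → tk s ++ tk t ++ tk t′ ++ tk s′ ↭ TS → Unique (P ++ Q ++ w ++ w′) → All (_∈ VS) (P ++ Q ++ w ++ w′) → Cyc (TS ++ VS)
      straight w w′ c c′ (π , ρ , σ , refl) (π′ , ρ′ , σ′ , refl) tw tw′ s∈ t∈ s′∈ t′∈ pT u al =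
        ladder π _ ρ _ σ π′ _ ρ′ _ σ′ w w′ c c′ tw tw′ s∈ t∈ s′∈ t′∈ pT u al

      -- the second path is reversed if the two links meet the two paths in different orders
      rungs : ∀ {s t s′ t′ P Q p p′ q q′} w w′ → Ch _~_ s P t → Ch _~_ s′ Q t′ → Two P p p′ → Two Q q q′ ⊎ Two Q q′ q → To (p ∷ w) q → To (p′ ∷ w′) q′ →
              s ∈ X → t ∈ X → s′ ∈ X → t′ ∈ X → tk s ++ tk t ++ tk t′ ++ tk s′ ↭ TS → Unique (P ++ Q ++ w ++ w′) → All (_∈ VS) (P ++ Q ++ w ++ w′) → Cyc (TS ++ VS)
      rungs w w′ c c′ two (inj₁ two′) = straight w w′ c c′ two two′
      rungs {s} {t} {s′} {t′} {P} {Q} w w′ c c′ two (inj₂ two′) tw tw′ s∈ t∈ s′∈ t′∈ pT u al =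
        straight w w′ c (Ch-rev ~sym c′) two (revTwo two′) tw tw′ s∈ t∈ t′∈ s′∈
          (solve 4 (λ a b c d → a ⊕ b ⊕ d ⊕ c ⊜ a ⊕ b ⊕ c ⊕ d) refl ((tk s) ∷ (tk t) ∷ (tk t′) ∷ (tk s′) ∷ []) ∙ pT) (Unique-resp p u) (All-resp-↭ p al)
        where
        p : P ++ Q ++ w ++ w′ ↭ P ++ reverse Q ++ w ++ w′
        p = ++⁺ˡ P (++⁺ʳ (w ++ w′) (↭-sym (↭-reverse Q)))

      both : ∀ {a b s s′ : V} → s ∈ a ∷ b ∷ [] → s′ ∈ a ∷ b ∷ [] → s ≢ s′ → tk s ++ tk s′ ↭ tk a ++ tk b
      both (here refl) (here refl) n = ⊥-elim (n refl)
      both (here refl) (there (here refl)) n = ↭-refl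
      both {a} {b} (there (here refl)) (here refl) n = ++-comm (tk b) (tk a)
      both (there (here refl)) (there (here refl)) n = ⊥-elim (n refl)

      -- The linkage of `x₁ x₂` with `x₃ x₄` consists of two disjoint paths whose ends are the four
      -- vertices. A linkage of the vertex sets of these two paths, trimmed, provides the two links.
      hamiltonian : Cyc (TS ++ VS)
      hamiltonian with linked {x₁ ∷ x₂ ∷ []} {x₃ ∷ x₄ ∷ []} (here refl) (there (here refl)) (n₁₂ uX) (here refl) (there (here refl)) (n₃₄ uX)
                         (AllP.++⁻ˡ (x₁ ∷ x₂ ∷ []) xVS) (AllP.++⁻ʳ (x₁ ∷ x₂ ∷ []) xVS)
        where
        n₁₂ : Unique X → x₁ ≢ x₂
        n₁₂ ((n ∷ _) ∷ _) = n
        n₃₄ : Unique X → x₃ ≢ x₄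
        n₃₄ (_ ∷ _ ∷ (n ∷ []) ∷ _) = n
      ... | linkage {s} {t} {s′} {t′} {P} {Q} c c′ s∈ s′∈ t∈ t′∈ uPQ alPQ
        with linked {P} {Q} (ch-head c) (ch-last c) s≢t (ch-head c′) (ch-last c′) s′≢t′ (AllP.++⁻ˡ P alPQ) (AllP.++⁻ʳ P alPQ)
        where
        A#B : ∀ {v} → v ∈ x₁ ∷ x₂ ∷ [] → v ∉ x₃ ∷ x₄ ∷ []
        A#B = Unique-disj (x₁ ∷ x₂ ∷ []) uX
        s≢t : s ≢ t
        s≢t refl = A#B s∈ t∈
        s′≢t′ : s′ ≢ t′
        s′≢t′ refl = A#B s′∈ t′∈
      ... | linkage {P = P₁} {Q₁} d d′ p₁∈ p₁′∈ q₁∈ q₁′∈ uW alW with trim (Unique-disj P uPQ) d p₁∈ q₁∈ | trim (Unique-disj P uPQ) d′ p₁′∈ q₁′∈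
      ... | link {α} {β} {p} {q} w refl p∈ q∈ to offA offB | link {α′} {β′} {p′} {q′} w′ refl p′∈ q′∈ to′ offA′ offB′ =
        choose (twoOn p∈ p′∈ p≢p′) (twoOn q∈ q′∈ q≢q′)
        where
        a⊆ : ∀ {v} → v ∈ x₁ ∷ x₂ ∷ [] → v ∈ X
        a⊆ = ∈-++⁺ˡ
        b⊆ : ∀ {v} → v ∈ x₃ ∷ x₄ ∷ [] → v ∈ X
        b⊆ = ∈-++⁺ʳ (x₁ ∷ x₂ ∷ [])
        arr : ((α ++ (p ∷ w) ++ q ∷ β) ++ α′ ++ (p′ ∷ w′) ++ q′ ∷ β′) ↭ ((p ∷ w) ++ p′ ∷ w′) ++ (q ∷ q′ ∷ []) ++ (α ++ β) ++ α′ ++ β′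
        arr = solve 8 (λ a k q b a′ k′ q′ b′ → ((a ⊕ k ⊕ q ⊕ b) ⊕ a′ ⊕ k′ ⊕ q′ ⊕ b′) ⊜ (k ⊕ k′) ⊕ (q ⊕ q′) ⊕ (a ⊕ b) ⊕ a′ ⊕ b′) refl (α ∷ (p ∷ w) ∷ [ q ] ∷ β ∷ α′ ∷ (p′ ∷ w′) ∷ [ q′ ] ∷ β′ ∷ [])
        uA : Unique (((p ∷ w) ++ p′ ∷ w′) ++ (q ∷ q′ ∷ []) ++ (α ++ β) ++ α′ ++ β′)
        uA = Unique-resp arr uW
        uK : Unique ((p ∷ w) ++ p′ ∷ w′)
        uK = Unique-++ˡ ((p ∷ w) ++ p′ ∷ w′) uA
        p≢p′ : p ≢ p′
        p≢p′ refl = Unique-disj (p ∷ w) uK (here refl) (here refl)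
        q≢q′ : q ≢ q′
        q≢q′ refl = Unique-disj (q ∷ []) (Unique-++ʳ ((p ∷ w) ++ p′ ∷ w′) uA) (here refl) (here refl)
        arrK : (p ∷ w) ++ p′ ∷ w′ ↭ (w ++ w′) ++ p ∷ p′ ∷ []
        arrK = solve 4 (λ p w p′ w′ → (p ⊕ w) ⊕ p′ ⊕ w′ ⊜ (w ⊕ w′) ⊕ p ⊕ p′) refl ([ p ] ∷ w ∷ [ p′ ] ∷ w′ ∷ [])
        uw : Unique (w ++ w′)
        uw = Unique-++ˡ (w ++ w′) (Unique-resp arrK uK)
        w∉ : ∀ {v} → v ∈ w ++ w′ → v ∉ P ++ Q
        w∉ m k with ∈-++⁻ w m | ∈-++⁻ P k
        ... | inj₁ a | inj₁ b = All.lookup offA a b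
        ... | inj₁ a | inj₂ b = All.lookup offB a b
        ... | inj₂ a | inj₁ b = All.lookup offA′ a b
        ... | inj₂ a | inj₂ b = All.lookup offB′ a b
        assoc : (P ++ Q) ++ w ++ w′ ↭ P ++ Q ++ w ++ w′
        assoc = ↭-reflexive (++-assoc P Q (w ++ w′))
        u : Unique (P ++ Q ++ w ++ w′)
        u = Unique-resp assoc (Unique-add (P ++ Q) uPQ uw w∉)
        al : All (_∈ VS) (P ++ Q ++ w ++ w′)
        al = All-resp-↭ assoc (AllP.++⁺ alPQ (AllP.++⁻ˡ (w ++ w′) (All-resp-↭ arrK (AllP.++⁻ˡ ((p ∷ w) ++ p′ ∷ w′) (All-resp-↭ arr alW)))))
        pT : tk s ++ tk t ++ tk t′ ++ tk s′ ↭ TS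
        pT = solve 4 (λ a b c d → a ⊕ b ⊕ c ⊕ d ⊜ (a ⊕ d) ⊕ b ⊕ c) refl ((tk s) ∷ (tk t) ∷ (tk t′) ∷ (tk s′) ∷ [])
          ∙ ++⁺ (both s∈ s′∈ s≢s′) (both t∈ t′∈ t≢t′) ∙ ↭-reflexive (++-assoc (tk x₁) (tk x₂) _)
          where
          s≢s′ : s ≢ s′
          s≢s′ refl = Unique-disj P uPQ (ch-head c) (ch-head c′)
          t≢t′ : t ≢ t′
          t≢t′ refl = Unique-disj P uPQ (ch-last c) (ch-last c′)
        swap : P ++ Q ++ w ++ w′ ↭ P ++ Q ++ w′ ++ w
        swap = ++⁺ˡ P (++⁺ˡ Q (++-comm w w′))
        choose : Two P p p′ ⊎ Two P p′ p → Two Q q q′ ⊎ Two Q q′ q → Cyc (TS ++ VS)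
        choose (inj₁ k) k′ = rungs w w′ c c′ k k′ to to′ (a⊆ s∈) (b⊆ t∈) (a⊆ s′∈) (b⊆ t′∈) pT u al
        choose (inj₂ k) k′ = rungs w′ w c c′ k ([ inj₂ , inj₁ ]′ k′) to′ to (a⊆ s∈) (b⊆ t∈) (a⊆ s′∈) (b⊆ t′∈) pT (Unique-resp swap u) (All-resp-↭ swap al)

-- From tours with pendant paths to hamiltonian cycles

linkAt : ∀ {A : Set} {R : A → A → Set} {a xs b} → Ch R a xs b → (j k : Fin (length xs)) → toℕ k ≡ suc (toℕ j) → R (lookup xs j) (lookup xs k)
linkAt one zero zero ()
linkAt (l ◅ one) zero (suc zero) e = l
linkAt (l ◅ (m ◅ c)) zero (suc zero) e = l
linkAt (l ◅ c) (suc j) (suc k) e = linkAt c j k (ℕP.suc-injective e)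

headAt : ∀ {A : Set} {R : A → A → Set} {a xs b} → Ch R a xs b → (k : Fin (length xs)) → toℕ k ≡ 0 → lookup xs k ≡ a
headAt one zero e = refl
headAt (l ◅ c) zero e = refl

lastAt : ∀ {A : Set} {R : A → A → Set} {a xs b} → Ch R a xs b → (j : Fin (length xs)) → suc (toℕ j) ≡ length xs → lookup xs j ≡ b
lastAt one zero e = refl
lastAt (l ◅ one) zero ()
lastAt (l ◅ (m ◅ c)) zero ()
lastAt (l ◅ c) (suc j) e = lastAt c j (ℕP.suc-injective e)

lookup-inj : ∀ {A : Set} {xs : List A} → Unique xs → (i j : Fin (length xs)) → lookup xs i ≡ lookup xs j → i ≡ j
lookup-inj (n ∷ u) zero zero e = refl
lookup-inj {xs = x ∷ xs} (n ∷ u) zero (suc j) e = ⊥-elim (All.lookup n (∈-lookup {xs = xs} j) e)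
lookup-inj {xs = x ∷ xs} (n ∷ u) (suc i) zero e = ⊥-elim (All.lookup n (∈-lookup {xs = xs} i) (sym e))
lookup-inj (n ∷ u) (suc i) (suc j) e = cong suc (lookup-inj u i j e)

closed⇒single : ∀ {A : Set} {R : A → A → Set} {a xs} → Ch R a xs a → Unique xs → length xs ≡ 1
closed⇒single one u = refl
closed⇒single (l ◅ c) (n ∷ u) = ⊥-elim (All.lookup n (ch-last c) refl)

module Tokens {n : ℕ} (4≤n : 4 ≤ n) (G : Graph n) (x : Fin 4 → Fin n) (x-inj : ∀ i j → x i ≡ x j → i ≡ j) where

  V : Set
  V = Fin n ⊎ Fin 4 × Bool

  -- A path x i – p i – q i is hung at each x i.
  pattern r u = inj₁ u
  pattern p i = inj₂ (i , false)
  pattern q i = inj₂ (i , true)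

  _≟_ : (u v : V) → Dec (u ≡ v)
  _≟_ = ⊎P.≡-dec FinP._≟_ (×P.≡-dec FinP._≟_ BoolP._≟_)

  infix 4 _~_
  _~_ : V → V → Set
  r u ~ r v = Adj G u v
  r u ~ p i = u ≡ x i
  p i ~ r u = u ≡ x i
  p i ~ q j = i ≡ j
  q i ~ p j = i ≡ j
  r _ ~ q _ = ⊥
  q _ ~ r _ = ⊥
  p _ ~ p _ = ⊥
  q _ ~ q _ = ⊥

  Adj-sym : ∀ {u v} → Adj G u v → Adj G v u
  Adj-sym {u} {v} e = trans (adj-sym G v u) e

  ~sym : ∀ {u v} → u ~ v → v ~ u
  ~sym {r u} {r v} e = Adj-sym e
  ~sym {r u} {p i} e = e
  ~sym {p i} {r u} e = e
  ~sym {p i} {q j} e = sym e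
  ~sym {q i} {p j} e = sym e

  _~?_ : ∀ u v → Dec (u ~ v)
  r u ~? r v = adj G u v BoolP.≟ true
  r u ~? p i = u FinP.≟ x i
  p i ~? r u = u FinP.≟ x i
  p i ~? q j = i FinP.≟ j
  q i ~? p j = i FinP.≟ j
  r _ ~? q _ = no (λ ())
  q _ ~? r _ = no (λ ())
  p _ ~? p _ = no (λ ())
  q _ ~? q _ = no (λ ())

  setting : Setting
  setting = record { V = V ; _≟_ = _≟_ ; _~_ = _~_ ; ~sym = λ {u} {v} → ~sym {u} {v} ; _~?_ = _~?_ }

  U : V → Set
  U = Core.U setting

  Lk : (V → Set) → V → V → Set
  Lk = Core.Lk setting

  Hung : (V → Set) → V → List V → Set
  Hung = Core.Hung setting

  Cyc : List V → Set
  Cyc = Core.Cyc setting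

  near-q : ∀ {i v} → Lk U (q i) v → v ≡ p i ⊎ v ≡ r (x i) ⊎ v ≡ q i
  near-q {i} {p j} (inj₁ refl) = inj₁ refl
  near-q {i} {p j} (inj₂ (p _ , _ , refl , ()))
  near-q {i} {r u} (inj₂ (p _ , _ , refl , refl)) = inj₂ (inj₁ refl)
  near-q {i} {q j} (inj₂ (p _ , _ , refl , refl)) = inj₂ (inj₂ refl)

  near-p : ∀ {i v} → Lk U (p i) v → v ≡ r (x i) ⊎ v ≡ q i ⊎ v ≡ p i ⊎ ∃ λ w → v ≡ r w × Adj G (x i) w
  near-p {i} {r u} (inj₁ refl) = inj₁ refl
  near-p {i} {q j} (inj₁ refl) = inj₂ (inj₁ refl)
  near-p {i} {r w} (inj₂ (r _ , _ , refl , e)) = inj₂ (inj₂ (inj₂ (w , refl , e)))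
  near-p {i} {r w} (inj₂ (q _ , _ , _ , ()))
  near-p {i} {q j} (inj₂ (r _ , _ , _ , ()))
  near-p {i} {q j} (inj₂ (q _ , _ , _ , ()))
  near-p {i} {p j} (inj₂ (r _ , _ , refl , e)) = inj₂ (inj₂ (inj₁ (cong (λ k → p k) (sym (x-inj i j e)))))
  near-p {i} {p j} (inj₂ (q _ , _ , refl , e)) = inj₂ (inj₂ (inj₁ (cong (λ k → p k) (sym e))))

  near-r : ∀ {u v} → Lk U (r u) (r v) → u ≢ v → Adj² G u v
  near-r (inj₁ e) ne = ne , inj₁ e
  near-r (inj₂ (r w , _ , e , f)) ne = ne , inj₂ (w , e , f)
  near-r (inj₂ (p i , _ , e , f)) ne = ⊥-elim (ne (trans e (sym f)))

  Mk : Fin 4 → V → V → Set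
  Mk i u v = ∃ λ w → Adj G (x i) w × (u ≡ r (x i) × v ≡ r w ⊎ u ≡ r w × v ≡ r (x i))

  -- links of the square, and edges of G at x i replacing a removed path
  data Ln (u v : V) : Set where
    plain : Lk U u v → Ln u v
    mark : ∀ i → Mk i u v → Ln u v

  Ln-sym : ∀ {u v} → Ln u v → Ln v u
  Ln-sym (plain l) = plain (Core.Lk-sym setting l)
  Ln-sym (mark i (w , e , inj₁ (a , b))) = mark i (w , e , inj₂ (b , a))
  Ln-sym (mark i (w , e , inj₂ (a , b))) = mark i (w , e , inj₁ (b , a))

  -- A link bears at most one mark. This finally yields that the four edges are distinct: equal
  -- edges would be the same link of the cycle.
  data Has (i : Fin 4) {u v : V} : Ln u v → Set where
    has : ∀ {m} → Has i (mark i m)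

  Has-sym : ∀ {i u v} {l : Ln u v} → Has i l → Has i (Ln-sym l)
  Has-sym {l = mark i (w , e , inj₁ _)} has = has
  Has-sym {l = mark i (w , e , inj₂ _)} has = has

  Has-unique : ∀ {i j u v} {l : Ln u v} → Has i l → Has j l → i ≡ j
  Has-unique has has = refl

  data In (i : Fin 4) : ∀ {a xs b} → Ch Ln a xs b → Set where
    hereL : ∀ {a b c xs} {l : Ln a b} {d : Ch Ln b xs c} → Has i l → In i (l ◅ d)
    thereL : ∀ {a b c xs} {l : Ln a b} {d : Ch Ln b xs c} → In i d → In i (l ◅ d)

  In-++ˡ : ∀ {i a xs b c ys d} {k : Ch Ln a xs b} {l : Ln b c} {m : Ch Ln c ys d} → In i k → In i (Ch-++ k l m)
  In-++ˡ (hereL h) = hereL h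
  In-++ˡ (thereL h) = thereL (In-++ˡ h)

  In-mid : ∀ {i a xs b c ys d} (k : Ch Ln a xs b) {l : Ln b c} {m : Ch Ln c ys d} → Has i l → In i (Ch-++ k l m)
  In-mid one h = hereL h
  In-mid (_ ◅ k) h = thereL (In-mid k h)

  In-++ʳ : ∀ {i a xs b c ys d} (k : Ch Ln a xs b) {l : Ln b c} {m : Ch Ln c ys d} → In i m → In i (Ch-++ k l m)
  In-++ʳ one h = thereL h
  In-++ʳ (_ ◅ k) h = thereL (In-++ʳ k h)

  In-subst : ∀ {i a xs ys b} (e : xs ≡ ys) {k : Ch Ln a xs b} → In i k → In i (subst (λ z → Ch Ln a z b) e k)
  In-subst refl h = h

  In-rev : ∀ {i a xs b} {k : Ch Ln a xs b} → In i k → In i (Ch-rev Ln-sym k)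
  In-rev {k = _◅_ {a = a} {xs = xs} l k} (hereL h) = In-subst (sym (unfold-reverse a xs)) (In-mid (Ch-rev Ln-sym k) (Has-sym h))
  In-rev {k = _◅_ {a = a} {xs = xs} l k} (thereL h) = In-subst (sym (unfold-reverse a xs)) (In-++ˡ (In-rev h))

  -- Cycles with marked edges, and the removal of a hung path

  record Cy (a : V) (F : List V) (I : List (Fin 4)) : Set where
    constructor cy
    field
      {xs} : List V
      {b} : V
      path : Ch Ln a xs b
      close : Ln b a
      perm : xs ↭ F
      marks : ∀ {i} → i ∈ I → In i path ⊎ Has i close

  record Split (a v b : V) (xs : List V) (k : Ch Ln a xs b) : Set where
    constructor split
    field
      {d} : V
      {ys zs} : List V
      left : Ch Ln a ys d
      link : Ln d v
      right : Ch Ln v zs b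
      eq : ys ++ zs ≡ xs
      keep : ∀ {i} → In i k → In i left ⊎ Has i link ⊎ In i right

  splitAt : ∀ {a v b xs} (k : Ch Ln a xs b) → v ∈ xs → v ≡ a ⊎ Split a v b xs k
  splitAt one (here e) = inj₁ e
  splitAt (l ◅ k) (here e) = inj₁ e
  splitAt (l ◅ k) (there m) with splitAt k m
  ... | inj₁ refl = inj₂ (split one l k refl (λ { (hereL h) → inj₂ (inj₁ h) ; (thereL h) → inj₂ (inj₂ h) }))
  ... | inj₂ (split c₁ l₁ c₂ refl kp) = inj₂ (split (l ◅ c₁) l₁ c₂ refl
        (λ { (hereL h) → inj₁ (hereL h) ; (thereL h) → [ (λ h → inj₁ (thereL h)) , inj₂ ]′ (kp h) }))

  rotateTo : ∀ {a v F I} → v ∈ F → Cy a F I → Cy v F I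
  rotateTo m (cy k l pe mk) with splitAt k (∈-resp-↭ (↭-sym pe) m)
  ... | inj₁ refl = cy k l pe mk
  ... | inj₂ (split {ys = ys} {zs} c₁ l₁ c₂ refl kp) = cy (Ch-++ c₂ l c₁) l₁ (↭-trans (++-comm zs ys) pe)
        (λ i∈ → [ (λ h → [ (λ h → inj₁ (In-++ʳ c₂ h)) , [ inj₂ , (λ h → inj₁ (In-++ˡ h)) ]′ ]′ (kp h)) , (λ h → inj₁ (In-mid c₂ h)) ]′ (mk i∈))

  shortcut : ∀ {i ys J F} (k : Ch Ln (p i) ys (r (x i))) → Unique ys → q i ∉ ys → 3 ≤ length ys → ys ↭ p i ∷ F → (∀ {j} → j ∈ J → In j k) →
             ∃ λ w → Cy w F (i ∷ J)
  shortcut (mark _ (_ , _ , inj₁ (() , _)) ◅ k) u nq le pe mk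
  shortcut (mark _ (_ , _ , inj₂ (() , _)) ◅ k) u nq le pe mk
  shortcut {i} {J = J} (plain l ◅ k) (n ∷ u) nq le pe mk with near-p l
  ... | inj₁ refl = ⊥-elim (ℕP.<-irrefl refl (subst (3 ≤_) (cong suc (closed⇒single k u)) le))
  ... | inj₂ (inj₁ refl) = ⊥-elim (nq (there (ch-head k)))
  ... | inj₂ (inj₂ (inj₁ refl)) = ⊥-elim (All.lookup n (ch-head k) refl)
  -- The list ends with `x i` and, without `p i`, begins with a neighbour `w` of it; so the closing
  -- link can be the edge from `x i` to `w`.
  ... | inj₂ (inj₂ (inj₂ (w , refl , e))) = r w , cy k (mark i (w , e , inj₁ (refl , refl))) (drop-∷ pe) marks′
    where
    tail : ∀ {j v} {l : Lk U (p i) (r v)} {ws c} {k : Ch Ln (r v) ws c} → In j (plain l ◅ k) → In j k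
    tail (thereL h) = h
    marks′ : ∀ {j} → j ∈ i ∷ J → In j k ⊎ Has j (mark i (w , e , inj₁ (refl , refl)))
    marks′ (here refl) = inj₂ has
    marks′ (there m) = inj₁ (tail (mk m))

  -- Earlier marks survive, because a mark joins two vertices of `G` and so never sits on a link at
  -- `p i` or `q i`. The bound on `F` excludes that the two cycle neighbours of `q i` coincide or
  -- that nothing separates them on the other side.
  dropPath : ∀ {i a F I} → Cy a (p i ∷ q i ∷ F) I → Unique (p i ∷ q i ∷ F) → 2 ≤ length F → ∃ λ w → Cy w F (i ∷ I)
  dropPath {i} {a} {F} {I} c uF le = go (rotateTo (there (here refl)) c)
    where
    only : ∀ {v} → Ln (q i) v → v ≡ p i ⊎ v ≡ r (x i) ⊎ v ≡ q i
    only (plain l) = near-q l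
    only (mark _ (_ , _ , inj₁ (() , _)))
    only (mark _ (_ , _ , inj₂ (() , _)))
    none : ∀ {j v} {l : Ln (q i) v} → ¬ Has j l
    none {l = mark _ (_ , _ , inj₁ (() , _))} has
    none {l = mark _ (_ , _ , inj₂ (() , _))} has
    none′ : ∀ {j v} {l : Ln v (q i)} → ¬ Has j l
    none′ {l = mark _ (_ , _ , inj₁ (_ , ()))} has
    none′ {l = mark _ (_ , _ , inj₂ (_ , ()))} has
    short : ∀ {zs : List V} → q i ∷ zs ↭ p i ∷ q i ∷ F → zs ↭ p i ∷ F
    short e = drop-∷ (↭-trans e (↭-swap _ _ ↭-refl))
    long : ∀ {zs : List V} → q i ∷ zs ↭ p i ∷ q i ∷ F → 3 ≤ length zs
    long e = subst (3 ≤_) (sym (↭-length (short e))) (s≤s le)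
    go : Cy (q i) (p i ∷ q i ∷ F) I → ∃ λ w → Cy w F (i ∷ I)
    go (cy one l pe mk) with ↭-length pe
    ... | ()
    go (cy (_◅_ {xs = zs} l k) l′ pe mk) with Unique-resp (↭-sym pe) uF
    ... | n ∷ u with only l | only (Ln-sym l′)
    ... | inj₂ (inj₂ refl) | _ = ⊥-elim (All.lookup n (ch-head k) refl)
    ... | _ | inj₂ (inj₂ refl) = ⊥-elim (All.lookup n (ch-last k) refl)
    ... | inj₁ refl | inj₁ refl = ⊥-elim (ℕP.<⇒≱ (s≤s (s≤s z≤n)) (subst (3 ≤_) (closed⇒single k u) (long pe)))
    ... | inj₂ (inj₁ refl) | inj₂ (inj₁ refl) = ⊥-elim (ℕP.<⇒≱ (s≤s (s≤s z≤n)) (subst (3 ≤_) (closed⇒single k u) (long pe)))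
    ... | inj₁ refl | inj₂ (inj₁ refl) = shortcut k u (λ m → All.lookup n m refl) (long pe) (short pe) (λ j∈ → inner (mk j∈))
      where
      inner : ∀ {j} → In j (l ◅ k) ⊎ Has j l′ → In j k
      inner (inj₁ (hereL h)) = ⊥-elim (none h)
      inner (inj₁ (thereL h)) = h
      inner (inj₂ h) = ⊥-elim (none′ h)
    ... | inj₂ (inj₁ refl) | inj₁ refl = shortcut (Ch-rev Ln-sym k) (Unique-resp (↭-sym (↭-reverse _)) u) (λ m → All.lookup n (∈-resp-↭ (↭-reverse _) m) refl)
          (subst (3 ≤_) (sym (↭-length (↭-reverse zs))) (long pe)) (↭-trans (↭-reverse _) (short pe)) (λ j∈ → In-rev (inner (mk j∈)))
      where
      inner : ∀ {j} → In j (l ◅ k) ⊎ Has j l′ → In j k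
      inner (inj₁ (hereL h)) = ⊥-elim (none h)
      inner (inj₁ (thereL h)) = h
      inner (inj₂ h) = ⊥-elim (none′ h)

  -- Reading off the hamiltonian cycle

  VS : List V
  VS = map inj₁ (allFin n)

  uVS : Unique VS
  uVS = UP.map⁺ ⊎P.inj₁-injective (UP.allFin⁺ n)

  conclude : ∀ {a I} → Cy a VS I → (∀ i → i ∈ I) →
    Σ (Fin 4 → Fin n) λ y → (∀ i → Adj G (x i) (y i)) × (∀ i j → i ≢ j → ¬ SamePair (x i) (y i) (x j) (y j)) ×
    Σ (HamCycle (Adj² G)) λ C → ∀ i → CycleContains C (x i) (y i)
  conclude {a} (cy {xs} {b} k l pe mk) all = y , adjacent , distinct , C , contains
    where
    len : length xs ≡ n
    len = trans (↭-length pe) (trans (length-map inj₁ (allFin n)) (length-tabulate {n = n} (λ z → z)))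
    u : Unique xs
    u = Unique-resp (↭-sym pe) uVS
    real : ∀ {v} → v ∈ VS → ∃ λ w → v ≡ r w
    real m with ∈-map⁻ inj₁ m
    ... | w , _ , e = w , e
    up : Fin n → Fin (length xs)
    up = cast (sym len)
    at : ∀ j → ∃ λ w → lookup xs (up j) ≡ r w
    at j = real (∈-resp-↭ pe (∈-lookup {xs = xs} (up j)))
    f : Fin n → Fin n
    f j = proj₁ (at j)
    pos : ∀ w → r w ∈ xs
    pos w = ∈-resp-↭ (↭-sym pe) (∈-map⁺ inj₁ (∈-allFin w))
    g : Fin n → Fin n
    g w = cast len (Any.index (pos w))
    up-g : ∀ w → up (g w) ≡ Any.index (pos w)
    up-g w = FinP.cast-involutive (sym len) len _
    fg : ∀ w → f (g w) ≡ w
    fg w = ⊎P.inj₁-injective (trans (sym (proj₂ (at (g w)))) (trans (cong (lookup xs) (up-g w)) (sym (AnyP.lookup-index (pos w)))))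
    gf : ∀ j → g (f j) ≡ j
    gf j = trans (cong (cast len) (lookup-inj u _ _ (trans (sym (AnyP.lookup-index (pos (f j)))) (sym (proj₂ (at j)))))) (FinP.cast-involutive len (sym len) j)
    f-inj : ∀ {i j} → f i ≡ f j → i ≡ j
    f-inj {i} {j} e = trans (sym (gf i)) (trans (cong g e) (gf j))
    up-suc : ∀ {j k : Fin n} → toℕ k ≡ suc (toℕ j) → toℕ (up k) ≡ suc (toℕ (up j))
    up-suc {j} {k} e = trans (FinP.toℕ-cast (sym len) k) (trans e (cong suc (sym (FinP.toℕ-cast (sym len) j))))
    n∸1 : suc (n ∸ 1) ≡ n
    n∸1 = ℕP.m+[n∸m]≡n (ℕP.≤-trans (s≤s z≤n) 4≤n)
    at-last : ∀ {j : Fin n} → toℕ j ≡ n ∸ 1 → b ≡ r (f j)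
    at-last {j} e = trans (sym (lastAt k (up j) (trans (cong suc (trans (FinP.toℕ-cast (sym len) j) e)) (trans n∸1 (sym len))))) (proj₂ (at j))
    at-first : ∀ {j : Fin n} → toℕ j ≡ 0 → a ≡ r (f j)
    at-first {j} e = trans (sym (headAt k (up j) (trans (FinP.toℕ-cast (sym len) j) e))) (proj₂ (at j))
    link : ∀ {j m} → CycSucc j m → Ln (r (f j)) (r (f m))
    link {j} {m} (inj₁ e) = subst₂ Ln (proj₂ (at j)) (proj₂ (at m)) (linkAt k (up j) (up m) (up-suc {j} {m} e))
    link (inj₂ (e , e′)) = subst₂ Ln (at-last e) (at-first e′) l
    -- The last position is at least 3, so the closing edge is neither a loop nor the reverse of the
    -- edge from position 0 to position 1.
    1≢n : ∀ {j : Fin n} → toℕ j ≡ n ∸ 1 → ∀ {c} → toℕ j ≡ c → c ≤ 1 → ⊥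
    1≢n e e′ le = ℕP.<-irrefl refl (ℕP.≤-trans (s≤s (ℕP.≤-trans (ℕP.≤-reflexive (trans (sym n∸1) (cong suc (trans (sym e) e′)))) (s≤s le))) (ℕP.≤-trans (s≤s (s≤s (s≤s z≤n))) 4≤n))
    apart : ∀ {j m : Fin n} → CycSucc j m → j ≢ m
    apart (inj₁ e) refl = ℕP.1+n≢n (sym e)
    apart (inj₂ (e , e′)) refl = 1≢n e e′ z≤n
    adj² : ∀ {w v} → Ln (r w) (r v) → w ≢ v → Adj² G w v
    adj² (plain l) ne = near-r l ne
    adj² (mark i (_ , e , inj₁ (refl , refl))) ne = ne , inj₁ e
    adj² (mark i (_ , e , inj₂ (refl , refl))) ne = ne , inj₁ (Adj-sym e)
    C : HamCycle (Adj² G)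
    C = record { three = ℕP.≤-trans (s≤s (s≤s (s≤s z≤n))) 4≤n ; order = permutation f g fg gf ; cons = λ j m s → adj² (link s) (λ e → apart s (f-inj e)) }

    Pos : Fin 4 → Fin n → Fin n → Set
    Pos i j m = (∃ λ e → Has i (linkAt k (up j) (up m) e)) ⊎ (toℕ j ≡ n ∸ 1 × toℕ m ≡ 0 × Has i l)

    inAt : ∀ {i a xs b} {k : Ch Ln a xs b} → In i k → ∃ λ j → ∃ λ m → ∃ λ e → Has i (linkAt k j m e)
    inAt {k = l ◅ one} (hereL h) = zero , suc zero , refl , h
    inAt {k = l ◅ (_ ◅ k)} (hereL h) = zero , suc zero , refl , h
    inAt {k = l ◅ one} (thereL ())
    inAt {k = l ◅ k@(_ ◅ _)} (thereL h) with inAt h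
    ... | j , m , e , h′ = suc j , suc m , cong suc e , subst (λ z → Has _ (linkAt k j m z)) (ℕP.≡-irrelevant _ _) h′

    down : ∀ (j : Fin (length xs)) → up (cast len j) ≡ j
    down j = FinP.cast-involutive (sym len) len j

    firstJ lastJ : Fin n
    firstJ = cast n∸1 zero
    lastJ = cast n∸1 (Fin.fromℕ (n ∸ 1))

    position : ∀ i → ∃ λ j → ∃ λ m → Pos i j m
    position i with mk (all i)
    ... | inj₂ h = lastJ , firstJ , inj₂ (trans (FinP.toℕ-cast n∸1 (Fin.fromℕ (n ∸ 1))) (FinP.toℕ-fromℕ (n ∸ 1)) , FinP.toℕ-cast n∸1 zero , h)
    ... | inj₁ h with inAt h
    ... | j , m , e , h′ = cast len j , cast len m , inj₁ (shiftAt (down j) (down m) (e , h′))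
      where
      shiftAt : ∀ {j j′ m m′} → j′ ≡ j → m′ ≡ m → (∃ λ e → Has i (linkAt k j m e)) → ∃ λ e → Has i (linkAt k j′ m′ e)
      shiftAt refl refl z = z

    succ : ∀ {i j m} → Pos i j m → CycSucc j m
    succ {i} {j} {m} (inj₁ (e , _)) = inj₁ (trans (sym (FinP.toℕ-cast (sym len) m)) (trans e (cong suc (FinP.toℕ-cast (sym len) j))))
    succ (inj₂ (e , e′ , _)) = inj₂ (e , e′)

    mkOf : ∀ {i w v} {l : Ln w v} → Has i l → Mk i w v
    mkOf {l = mark i m} has = m

    ends : ∀ {i j m} → Pos i j m → Mk i (r (f j)) (r (f m))
    ends {i} {j} {m} (inj₁ (e , h)) = subst₂ (Mk i) (proj₂ (at j)) (proj₂ (at m)) (mkOf h)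
    ends {i} (inj₂ (e , e′ , h)) = subst₂ (Mk i) (at-last e) (at-first e′) (mkOf h)

    past : ∀ {j m : Fin n} → toℕ (up m) ≡ suc (toℕ (up j)) → toℕ j ≡ n ∸ 1 → ⊥
    past {j} {m} s e = ℕP.<-irrefl (trans (trans (sym (FinP.toℕ-cast (sym len) m)) s) (trans (cong suc (trans (FinP.toℕ-cast (sym len) j) e)) n∸1)) (FinP.toℕ<n m)

    same : ∀ {i i′ j m m′} → Pos i j m → Pos i′ j m′ → i ≡ i′
    same {m = m} {m′} (inj₁ (e , h)) (inj₁ (e′ , h′)) = step (FinP.toℕ-injective (trans e (sym e′))) h h′
      where
      step : ∀ {i i′ j m m′ e e′} → m ≡ m′ → Has i (linkAt k j m e) → Has i′ (linkAt k j m′ e′) → i ≡ i′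
      step {i} {j = j} {m} {e = e} {e′} refl h h′ = Has-unique (subst (λ z → Has i (linkAt k j m z)) (ℕP.≡-irrelevant e e′) h) h′
    same (inj₂ (_ , _ , h)) (inj₂ (_ , _ , h′)) = Has-unique h h′
    same {j = j} {m} (inj₁ z) (inj₂ (e , _)) = ⊥-elim (past {j} {m} (proj₁ z) e)
    same {j = j} {m′ = m} (inj₂ (e , _)) (inj₁ z) = ⊥-elim (past {j} {m} (proj₁ z) e)

    y : Fin 4 → Fin n
    y i = proj₁ (ends (proj₂ (proj₂ (position i))))
    adjacent : ∀ i → Adj G (x i) (y i)
    adjacent i = proj₁ (proj₂ (ends (proj₂ (proj₂ (position i)))))
    Sides : Fin 4 → Fin n → Fin n → Set
    Sides i j m = f j ≡ x i × f m ≡ y i ⊎ f j ≡ y i × f m ≡ x i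
    sides : ∀ i → Sides i (proj₁ (position i)) (proj₁ (proj₂ (position i)))
    sides i with proj₂ (proj₂ (ends (proj₂ (proj₂ (position i)))))
    ... | inj₁ (e , e′) = inj₁ (⊎P.inj₁-injective e , ⊎P.inj₁-injective e′)
    ... | inj₂ (e , e′) = inj₂ (⊎P.inj₁-injective e , ⊎P.inj₁-injective e′)
    contains : ∀ i → CycleContains C (x i) (y i)
    contains i = _ , _ , succ (proj₂ (proj₂ (position i))) , sides i
    noLoop : ∀ {j m : Fin n} → CycSucc j m → ¬ CycSucc m j
    noLoop (inj₁ e) (inj₁ e′) = ℕP.<-irrefl (trans e′ (cong suc e)) (s≤s (ℕP.n≤1+n _))
    noLoop {j} {m} (inj₁ e) (inj₂ (e′ , z)) = 1≢n {m} e′ (trans e (cong suc z)) ℕP.≤-refl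
    noLoop {j} {m} (inj₂ (e′ , z)) (inj₁ e) = 1≢n {j} e′ (trans e (cong suc z)) ℕP.≤-refl
    noLoop {j} {m} (inj₂ (e , z)) (inj₂ (e′ , z′)) = 1≢n {j} e z′ z≤n
    distinct : ∀ i j → i ≢ j → ¬ SamePair (x i) (y i) (x j) (y j)
    distinct i j ne (inj₁ (e , _)) = ne (x-inj i j e)
    -- The two edges agree crosswise, so their positions on the cycle are equal or reversed: the
    -- former contradicts the uniqueness of marks, the latter is excluded by `noLoop`.
    distinct i j ne (inj₂ (e , e′)) = cases (sides i) (sides j)
      where
      at-i = proj₂ (proj₂ (position i))
      at-j = proj₂ (proj₂ (position j))
      clash : ∀ {a b m m′} → a ≡ b → Pos i a m → Pos j b m′ → ⊥
      clash refl s t = ne (same s t)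
      turn : ∀ {a b m m′} → a ≡ m′ → m ≡ b → Pos i a m → Pos j b m′ → ⊥
      turn refl refl s t = noLoop (succ s) (succ t)
      cases : Sides i _ _ → Sides j _ _ → ⊥
      cases (inj₁ (s , t)) (inj₁ (s′ , t′)) = turn (f-inj (trans s (trans e (sym t′)))) (f-inj (trans t (trans e′ (sym s′)))) at-i at-j
      cases (inj₁ (s , t)) (inj₂ (s′ , t′)) = clash (f-inj (trans s (trans e (sym s′)))) at-i at-j
      cases (inj₂ (s , t)) (inj₁ (s′ , t′)) = clash (f-inj (trans s (trans e′ (sym s′)))) at-i at-j
      cases (inj₂ (s , t)) (inj₂ (s′ , t′)) = turn (f-inj (trans s (trans e′ (sym t′)))) (f-inj (trans t (trans e (sym s′)))) at-i at-j

  -- Removing the four hung paths one by one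

  hang : List (Fin 4) → List V
  hang [] = VS
  hang (i ∷ is) = p i ∷ q i ∷ hang is

  hang-∈ : ∀ is {v} → v ∈ hang is → (∃ λ u → v ≡ r u) ⊎ ∃ λ i → i ∈ is × (v ≡ p i ⊎ v ≡ q i)
  hang-∈ [] m with ∈-map⁻ inj₁ m
  ... | u , _ , e = inj₁ (u , e)
  hang-∈ (i ∷ is) (here e) = inj₂ (i , here refl , inj₁ e)
  hang-∈ (i ∷ is) (there (here e)) = inj₂ (i , here refl , inj₂ e)
  hang-∈ (i ∷ is) (there (there m)) with hang-∈ is m
  ... | inj₁ e = inj₁ e
  ... | inj₂ (j , j∈ , e) = inj₂ (j , there j∈ , e)

  hang-unique : ∀ is → Unique is → Unique (hang is)
  hang-unique [] _ = uVS
  hang-unique (i ∷ is) (ni ∷ u) = ((λ ()) ∷ All.tabulate p∉) ∷ All.tabulate q∉ ∷ hang-unique is u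
    where
    p∉ : ∀ {v} → v ∈ hang is → p i ≢ v
    p∉ m e with hang-∈ is m
    p∉ m refl | inj₁ (_ , ())
    p∉ m refl | inj₂ (j , j∈ , inj₁ refl) = All.lookup ni j∈ refl
    p∉ m refl | inj₂ (j , j∈ , inj₂ ())
    q∉ : ∀ {v} → v ∈ hang is → q i ≢ v
    q∉ m e with hang-∈ is m
    q∉ m refl | inj₁ (_ , ())
    q∉ m refl | inj₂ (j , j∈ , inj₁ ())
    q∉ m refl | inj₂ (j , j∈ , inj₂ refl) = All.lookup ni j∈ refl

  hang-long : ∀ is → 2 ≤ length (hang is)
  hang-long [] = subst (2 ≤_) (sym (trans (length-map inj₁ (allFin n)) (length-tabulate {n = n} (λ z → z)))) (ℕP.≤-trans (s≤s (s≤s z≤n)) 4≤n)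
  hang-long (i ∷ is) = s≤s (s≤s z≤n)

  dropAll : ∀ is {a I} → Unique is → Cy a (hang is) I → ∃ λ b → ∃ λ J → Cy b VS J × (∀ {j} → j ∈ is ⊎ j ∈ I → j ∈ J)
  dropAll [] u c = _ , _ , c , λ { (inj₁ ()) ; (inj₂ m) → m }
  dropAll (i ∷ is) u@(_ ∷ u′) c with dropPath c (hang-unique (i ∷ is) u) (hang-long is)
  ... | _ , c′ with dropAll is u′ c′
  ... | b , J , c″ , sub = b , J , c″ , λ { (inj₁ (here refl)) → sub (inj₂ (here refl)) ; (inj₁ (there m)) → sub (inj₁ m) ; (inj₂ m) → sub (inj₂ (there m)) }

  walk : ∀ {S u w} → WalkIn G S u w → ∃ λ xs → Ch _~_ (r u) xs (r w) × All (λ v → ∃ λ z → v ≡ r z × S z) xs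
  walk (stop s) = _ , one , (_ , refl , s) ∷ []
  walk (onward s e k) with walk k
  ... | xs , c , al = _ , e ◅ c , (_ , refl , s) ∷ al

  r∈ : ∀ u → r u ∈ VS
  r∈ u = ∈-map⁺ inj₁ (∈-allFin u)

  un-r : ∀ {v} → v ∈ VS → ∃ λ u → v ≡ r u
  un-r m with ∈-map⁻ inj₁ m
  ... | u , _ , e = u , e

  module _ (tc : TwoConnected G) where

    conn₀ : ∀ {u w} → u ∈ VS → w ∈ VS → ∃ λ xs → Ch _~_ u xs w × All (_∈ VS) xs
    conn₀ u∈ w∈ with un-r u∈ | un-r w∈
    ... | u , refl | w , refl with walk (proj₁ (proj₂ tc) u w tt tt)
    ... | xs , c , al = xs , c , All.map (λ { (z , refl , _) → r∈ z }) al

    conn : ∀ {z u w} → z ∈ VS → u ∈ VS → w ∈ VS → u ≢ z → w ≢ z → ∃ λ xs → Ch _~_ u xs w × All (λ v → v ∈ VS × v ≢ z) xs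
    conn z∈ u∈ w∈ u≢ w≢ with un-r z∈ | un-r u∈ | un-r w∈
    ... | z , refl | u , refl | w , refl with walk (proj₂ (proj₂ tc) z u w (λ { refl → u≢ refl }) (λ { refl → w≢ refl }))
    ... | xs , c , al = xs , c , All.map (λ { (v , refl , ne) → r∈ v , λ { refl → ne refl } }) al

    token : ∀ {u} → Dec (∃ λ i → x i ≡ u) → List V
    token (yes (i , _)) = p i ∷ q i ∷ []
    token (no _) = []

    tk : V → List V
    tk (r u) = token (FinP.any? (λ i → x i FinP.≟ u))
    tk (inj₂ _) = []

    tk-x : ∀ i → tk (r (x i)) ≡ p i ∷ q i ∷ []
    tk-x i = go (FinP.any? (λ j → x j FinP.≟ x i))
      where
      go : (d : Dec (∃ λ j → x j ≡ x i)) → token d ≡ p i ∷ q i ∷ []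
      go (yes (j , e)) = cong (λ k → p k ∷ q k ∷ []) (x-inj j i e)
      go (no ne) = ⊥-elim (ne (i , refl))

    x₀ x₁ x₂ x₃ : V
    x₀ = r (x zero)
    x₁ = r (x (suc zero))
    x₂ = r (x (suc (suc zero)))
    x₃ = r (x (suc (suc (suc zero))))

    X : List V
    X = map (λ i → r (x i)) (allFin 4)

    uX : Unique X
    uX = UP.map⁺ (λ e → x-inj _ _ (⊎P.inj₁-injective e)) (UP.allFin⁺ 4)

    inX : ∀ {v} → v ∈ X → ∃ λ i → v ≡ r (x i)
    inX m with ∈-map⁻ (λ i → r (x i)) m
    ... | i , _ , e = i , e

    hung : ∀ {v} → v ∈ X → Hung U v (tk v)
    hung m with inX m
    ... | i , refl = subst (Hung U (r (x i))) (sym (tk-x i)) (Core.hg (inj₁ refl ◅ one) refl (inj₂ (p i , tt , refl , refl)))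

    only : ∀ {v l t} → v ∈ X → l ∈ VS → t ∈ tk v → l ~ t → l ≡ v
    only {l = l} {t} m l∈ t∈ e with inX m | un-r l∈
    ... | i , refl | u , refl with subst (t ∈_) (tk-x i) t∈
    ... | here refl = cong (λ z → r z) e
    ... | there (here refl) = ⊥-elim e

    tour : Cyc ((tk x₀ ++ tk x₁ ++ tk x₂ ++ tk x₃) ++ VS)
    tour = Core.Biconnected.Start.hamiltonian setting (record { VS = VS ; uVS = uVS ; conn₀ = conn₀ ; conn = conn }) tk {x₀} {x₁} {x₂} {x₃} uX (All.tabulate (λ m → subst (_∈ VS) (sym (proj₂ (inX m))) (r∈ _))) hung only

    tour′ : Cyc (hang (allFin 4))
    tour′ = subst Cyc (cong₂ (λ y z → (y ++ z) ++ VS) (tk-x zero) (cong₂ _++_ (tk-x (suc zero)) (cong₂ _++_ (tk-x (suc (suc zero))) (tk-x (suc (suc (suc zero))))))) tour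

    answer : Σ (Fin 4 → Fin n) λ y → (∀ i → Adj G (x i) (y i)) × (∀ i j → i ≢ j → ¬ SamePair (x i) (y i) (x j) (y j)) ×
      Σ (HamCycle (Adj² G)) λ C → ∀ i → CycleContains C (x i) (y i)
    answer = finish tour′
      where
      Answer : Set
      Answer = Σ (Fin 4 → Fin n) λ y → (∀ i → Adj G (x i) (y i)) × (∀ i j → i ≢ j → ¬ SamePair (x i) (y i) (x j) (y j)) ×
        Σ (HamCycle (Adj² G)) λ C → ∀ i → CycleContains C (x i) (y i)
      last : (∃ λ b → ∃ λ J → Cy b VS J × (∀ {j} → j ∈ allFin 4 ⊎ j ∈ [] → j ∈ J)) → Answer
      last (_ , _ , k , sub) = conclude k (λ i → sub (inj₁ (∈-allFin i)))
      finish : Cyc (hang (allFin 4)) → Answer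
      finish (a , xs , b , c , l , pe) = last (dropAll (allFin 4) {I = []} (UP.allFin⁺ 4) (cy (Ch-map plain c) (plain l) pe (λ ())))

H₄ : (n : ℕ) → 4 ≤ n → (G : Graph n) → TwoConnected G → Hk 4 G
H₄ n 4≤n G tc x x-inj = Tokens.answer 4≤n G x x-inj tc

-- A graph without the H₅ property

CycSucc-functional : ∀ {n} {j k k′ : Fin n} → CycSucc j k → CycSucc j k′ → k ≡ k′
CycSucc-functional (inj₁ e) (inj₁ e′) = FinP.toℕ-injective (trans e (sym e′))
CycSucc-functional {suc n} {k = k} (inj₁ e) (inj₂ (e′ , _)) = ⊥-elim (ℕP.<-irrefl (trans e (cong suc e′)) (FinP.toℕ<n k))
CycSucc-functional {suc n} {k′ = k} (inj₂ (e′ , _)) (inj₁ e) = ⊥-elim (ℕP.<-irrefl (trans e (cong suc e′)) (FinP.toℕ<n k))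
CycSucc-functional (inj₂ (_ , e)) (inj₂ (_ , e′)) = FinP.toℕ-injective (trans e (sym e′))

CycSucc-injective : ∀ {n} {j j′ k : Fin n} → CycSucc j k → CycSucc j′ k → j ≡ j′
CycSucc-injective (inj₁ e) (inj₁ e′) = FinP.toℕ-injective (ℕP.suc-injective (trans (sym e) e′))
CycSucc-injective (inj₁ e) (inj₂ (_ , e′)) = ⊥-elim (ℕP.1+n≢0 (trans (sym e) e′))
CycSucc-injective (inj₂ (_ , e′)) (inj₁ e) = ⊥-elim (ℕP.1+n≢0 (trans (sym e) e′))
CycSucc-injective (inj₂ (e , _)) (inj₂ (e′ , _)) = FinP.toℕ-injective (trans e (sym e′))

hub : ∀ {n} → Fin n → Bool
hub zero = true
hub (suc zero) = true
hub (suc (suc _)) = false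

-- K_{2,n-2}, the two hubs being one side
TwoHubs : ∀ n → Graph n
TwoHubs n = record
  { adj = λ u v → hub u xor hub v
  ; sym = λ u v → BoolP.xor-comm (hub u) (hub v)
  ; irref = λ u → BoolP.xor-same (hub u) }

-- One vertex of each side within `S` suffices: two vertices on the same side have the given vertex
-- of the other side as a common neighbour.
TwoHubs-connectedOn : ∀ {n} {S : Fin n → Set} {h l} → S h → hub h ≡ true → S l → hub l ≡ false → ConnectedOn (TwoHubs n) S
TwoHubs-connectedOn {n} {S} {h} {l} Sh eh Sl el u v Su Sv = go (hub u) (hub v) refl refl
  where
  go : ∀ b c → hub u ≡ b → hub v ≡ c → WalkIn (TwoHubs n) S u v
  go true true eu ev = onward Su (cong₂ _xor_ eu el) (onward Sl (cong₂ _xor_ el ev) (stop Sv))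
  go false false eu ev = onward Su (cong₂ _xor_ eu eh) (onward Sh (cong₂ _xor_ eh ev) (stop Sv))
  go true false eu ev = onward Su (cong₂ _xor_ eu ev) (stop Sv)
  go false true eu ev = onward Su (cong₂ _xor_ eu ev) (stop Sv)

TwoHubs-twoConnected : ∀ n → 4 ≤ n → TwoConnected (TwoHubs n)
TwoHubs-twoConnected n@(suc (suc (suc (suc _)))) (s≤s (s≤s (s≤s (s≤s _)))) =
  s≤s (s≤s (s≤s z≤n)) , TwoHubs-connectedOn {h = zero} {suc (suc zero)} tt refl tt refl , del
  where
  del : ∀ v → ConnectedOn (TwoHubs n) (_≢ v)
  del zero = TwoHubs-connectedOn {h = suc zero} {suc (suc zero)} (λ ()) refl (λ ()) refl
  del (suc zero) = TwoHubs-connectedOn {h = zero} {suc (suc zero)} (λ ()) refl (λ ()) refl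
  del (suc (suc zero)) = TwoHubs-connectedOn {h = zero} {suc (suc (suc zero))} (λ ()) refl (λ ()) refl
  del (suc (suc (suc v))) = TwoHubs-connectedOn {h = zero} {suc (suc zero)} (λ ()) refl (λ ()) refl

-- A cycle has at most four edges at the hubs: each of them is given by a hub and a direction.
TwoHubs-not-H₅ : ∀ n → 5 ≤ n → ¬ Hk 5 (TwoHubs n)
-- The choice of the five vertices is immaterial: whichever edges are obtained at them, each
-- contains a hub.
TwoHubs-not-H₅ n 5≤n h5 with h5 (λ i → inject≤ i 5≤n) (λ i j → FinP.inject≤-injective 5≤n 5≤n i j)
... | y , adjacent , distinct , C , contains = clash (FinP.pigeonhole {4} {5} ℕP.≤-refl (λ i → proj₁ (code i)))
  where
  x : Fin 5 → Fin n
  x i = inject≤ i 5≤n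
  f : Fin n → Fin n
  f j = order C ⟨$⟩ʳ j
  f-inj : ∀ {i j} → f i ≡ f j → i ≡ j
  f-inj {i} {j} e = trans (sym (Inverse.strictlyInverseʳ (order C) i)) (trans (cong (Inverse.from (order C)) e) (Inverse.strictlyInverseʳ (order C) j))
  src tgt : Fin 5 → Fin n
  src i = proj₁ (contains i)
  tgt i = proj₁ (proj₂ (contains i))
  suc! : ∀ i → CycSucc (src i) (tgt i)
  suc! i = proj₁ (proj₂ (proj₂ (contains i)))
  ends : ∀ i → (f (src i) ≡ x i × f (tgt i) ≡ y i) ⊎ (f (src i) ≡ y i × f (tgt i) ≡ x i)
  ends i = proj₂ (proj₂ (proj₂ (contains i)))
  At : Fin 5 → Fin 4 → Set
  At i zero = toℕ (f (src i)) ≡ 0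
  At i (suc zero) = toℕ (f (src i)) ≡ 1
  At i (suc (suc zero)) = toℕ (f (tgt i)) ≡ 0
  At i (suc (suc (suc zero))) = toℕ (f (tgt i)) ≡ 1
  hub-index : ∀ {n} (u : Fin n) → hub u ≡ true → toℕ u ≡ 0 ⊎ toℕ u ≡ 1
  hub-index zero e = inj₁ refl
  hub-index (suc zero) e = inj₂ refl
  one-of : ∀ b {u v : Bool} → u ≡ b → u xor v ≡ true → u ≡ true ⊎ v ≡ true
  one-of true e a = inj₁ e
  one-of false refl a = inj₂ a
  at-hub : ∀ i → hub (f (src i)) ≡ true ⊎ hub (f (tgt i)) ≡ true
  at-hub i with ends i
  ... | inj₁ (e , e′) = one-of (hub (f (src i))) refl (subst₂ (λ u v → hub u xor hub v ≡ true) (sym e) (sym e′) (adjacent i))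
  ... | inj₂ (e , e′) = one-of (hub (f (src i))) refl
        (subst₂ (λ u v → hub u xor hub v ≡ true) (sym e) (sym e′) (trans (adj-sym (TwoHubs n) (y i) (x i)) (adjacent i)))
  code : ∀ i → ∃ (At i)
  code i with at-hub i
  ... | inj₁ h = [ (λ e → zero , e) , (λ e → suc zero , e) ]′ (hub-index _ h)
  ... | inj₂ h = [ (λ e → suc (suc zero) , e) , (λ e → suc (suc (suc zero)) , e) ]′ (hub-index _ h)
  same : ∀ {i j} c → At i c → At j c → src i ≡ src j × tgt i ≡ tgt j
  byS : ∀ {i j} → src i ≡ src j → src i ≡ src j × tgt i ≡ tgt j
  byS {i} {j} e = e , CycSucc-functional (suc! i) (subst (λ z → CycSucc z (tgt j)) (sym e) (suc! j))
  byT : ∀ {i j} → tgt i ≡ tgt j → src i ≡ src j × tgt i ≡ tgt j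
  byT {i} {j} e = CycSucc-injective (suc! i) (subst (CycSucc (src j)) (sym e) (suc! j)) , e
  same {i} {j} zero e e′ = byS {i} {j} (f-inj (FinP.toℕ-injective (trans e (sym e′))))
  same {i} {j} (suc zero) e e′ = byS {i} {j} (f-inj (FinP.toℕ-injective (trans e (sym e′))))
  same {i} {j} (suc (suc zero)) e e′ = byT {i} {j} (f-inj (FinP.toℕ-injective (trans e (sym e′))))
  same {i} {j} (suc (suc (suc zero))) e e′ = byT {i} {j} (f-inj (FinP.toℕ-injective (trans e (sym e′))))
  pair : ∀ {i j} → f (src i) ≡ f (src j) → f (tgt i) ≡ f (tgt j) → SamePair (x i) (y i) (x j) (y j)
  pair {i} {j} e e′ with ends i | ends j
  ... | inj₁ (a , b) | inj₁ (c , d) = inj₁ (trans (sym a) (trans e c) , trans (sym b) (trans e′ d))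
  ... | inj₁ (a , b) | inj₂ (c , d) = inj₂ (trans (sym a) (trans e c) , trans (sym b) (trans e′ d))
  ... | inj₂ (a , b) | inj₁ (c , d) = inj₂ (trans (sym b) (trans e′ d) , trans (sym a) (trans e c))
  ... | inj₂ (a , b) | inj₂ (c , d) = inj₁ (trans (sym b) (trans e′ d) , trans (sym a) (trans e c))
  clash : (∃ λ i → ∃ λ j → i Fin.< j × proj₁ (code i) ≡ proj₁ (code j)) → ⊥
  clash (i , j , lt , e) with same {i} {j} (proj₁ (code j)) (subst (At i) e (proj₂ (code i))) (proj₂ (code j))
  ... | s , t = distinct i j (λ { refl → ℕP.<-irrefl refl lt }) (pair {i} {j} (cong f s) (cong f t))

theorem1 : ((n : ℕ) → 4 ≤ n → (G : Graph n) → TwoConnected G → Hk 4 G)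
    × ((n : ℕ) → 4 < n → Σ (Graph n) λ G → TwoConnected G × ¬ Hk 5 G)
theorem1 = H₄ , λ n 5≤n → TwoHubs n , TwoHubs-twoConnected n (ℕP.<⇒≤ 5≤n) , TwoHubs-not-H₅ n 5≤n
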